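{- For all $k\in\mathbb N$: $\mathrm{XC}_1\star\mathrm{AoUC}\not\le_{\mathrm W}\mathrm{XC}_k$.
   Context: A represented space $\mathbf X$ is a set $X$ with a partial surjection $\delta_{\mathbf X}:\subseteq\mathbb N^{\mathbb N}\to X$ (a $p$ with $\delta_{\mathbf X}(p)=x$ is a name of $x$). A realizer of a (partial) multivalued function $f:\subseteq\mathbf X\rightrightarrows\mathbf Y$ is a partial $F:\subseteq\mathbb N^{\mathbb N}\to\mathbb N^{\mathbb N}$ with $\delta_{\mathbf Y}(F(p))\in f(\delta_{\mathbf X}(p))$ for all names $p$ of points of $\mathrm{dom}(f)$; write $F\vdash f$. Weihrauch reducibility: $f\le_{\mathrm W}g$ iff there are computable $H,K:\subseteq\mathbb N^{\mathbb N}\to\mathbb N^{\mathbb N}$ such that $(p\mapsto K\langle p,GH(p)\rangle)\vdash f$ for every $G\vdash g$; $\equiv_{\mathrm W}$ is the induced equivalence. The compositional product $f\star g$ is (a representative of) the Weihrauch degree $\max_{\le_{\mathrm W}}\{f_1\circ g_1 : f_1\le_{\mathrm W}f,\ g_1\le_{\mathrm W}g\}$ (this maximum is known to exist), where the composition of multivalued functions has $\mathrm{dom}(f_1\circ g_1)=\{x\in\mathrm{dom}(g_1): g_1(x)\subseteq\mathrm{dom}(f_1)\}$ and $(f_1\circ g_1)(x)=\bigcup_{y\in g_1(x)}f_1(y)$. $\mathcal A(\mathbf X)$ is the represented space of closed subsets of $\mathbf X$ with negative information: a name of $A$ is a name of the open set $X\setminus A$ (its continuous characteristic function into Sierpiński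 space). Closed choice $\mathrm C_{\mathbf X}:\subseteq\mathcal A(\mathbf X)\rightrightarrows\mathbf X$ maps a non-empty closed set $A$ to an arbitrary point of $A$. $\mathrm{XC}_n$ is the restriction of $\mathrm C_{[0,1]^n}$ to (non-empty closed) convex sets. $\mathrm{AoUC}$ (all-or-unique choice) is the restriction of $\mathrm C_{\{0,1\}^{\mathbb N}}$ to the inputs $A$ with $A=\{0,1\}^{\mathbb N}$ or $A=\{x\}$ for some $x\in\{0,1\}^{\mathbb N}$ (up to $\equiv_{\mathrm W}$, $\{0,1\}^{\mathbb N}$ may be replaced by $[0,1]^d$, $d\ge1$). -}

module Defs where

open import Data.Bool using (Bool; true; false)
open import Data.Empty using (⊥-elim)
open import Data.Fin using (Fin; toℕ)
open import Data.Fin.Properties using (toℕ<n; toℕ-fromℕ<; toℕ-injective)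
open import Data.Integer using (_⊖_; +_; -[1+_]; +≤+)
open import Data.List using (List; []; _∷_; applyUpTo)
open import Data.Nat using (ℕ; zero; suc; _+_; _*_; _≤_; _<_; z≤n; s≤s)
open import Data.Nat.DivMod using (_/_; _mod_; [m+kn]%n≡m%n; m<n⇒m%n≡m; m<n⇒m/n≡0;
  +-distrib-/-∣ʳ; m*n/n≡m)
open import Data.Nat.Divisibility using (divides)
import Data.Nat.Properties as ℕ
open import Data.Product using (_×_; _,_; ∃; ∃-syntax; proj₁; proj₂)
open import Data.Rational as ℚ using (ℚ; mkℚ; 0ℚ; 1ℚ; ½; ↥_)
import Data.Rational.Properties as ℚ
open import Data.Rational.Solver using (module +-*-Solver)
open import Data.Rational.Unnormalised as ℚᵘ using (mkℚᵘ)
import Data.Rational.Unnormalised.Properties as ℚᵘ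
open import Algebra.Definitions.RawSemiring ℚ.+-*-rawSemiring using (_^_)
open import Data.Sum using (_⊎_; inj₁; inj₂)
import Data.Vec.Functional.Relation.Binary.Equality.Setoid as Vector
open import Data.Vec using (Vec; []; _∷_; lookup)
open import Data.Vec.Relation.Binary.Pointwise.Inductive using (Pointwise)
open import Function using (_∘_; _⇔_; mk⇔; Equivalence; Func)
open import Level using (0ℓ)
open import Relation.Binary using (Setoid; _Respects_; tri<; tri≈; tri>)
import Relation.Binary.Construct.On as On
open import Relation.Binary.PropositionalEquality
  using (_≡_; _≢_; _≗_; refl; sym; trans; cong; cong₂; subst; _→-setoid_; setoid)
open import Relation.Nullary using (¬_)

Baire : Set
Baire = ℕ → ℕ

-- ⟨ p , q ⟩ = p₀ q₀ p₁ q₁ p₂ …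
⟨_,_⟩ : Baire → Baire → Baire
⟨ p , q ⟩ zero    = p zero
⟨ p , q ⟩ (suc n) = ⟨ q , p ∘ suc ⟩ n

⟨,⟩-cong : ∀ {p p′ q q′} → p ≗ p′ → q ≗ q′ → ⟨ p , q ⟩ ≗ ⟨ p′ , q′ ⟩
⟨,⟩-cong p≗p′ q≗q′ zero    = p≗p′ zero
⟨,⟩-cong p≗p′ q≗q′ (suc n) = ⟨,⟩-cong q≗q′ (p≗p′ ∘ suc) n

-- Cantor's enumeration of ℕ × ℕ and its inverse.
triangle : ℕ → ℕ
triangle zero    = zero
triangle (suc n) = suc n + triangle n

pair : ℕ → ℕ → ℕ
pair a b = b + triangle (a + b)

unpair : ℕ → ℕ × ℕ
unpair zero    = 0 , 0
unpair (suc n) with unpair n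
... | zero  , b = suc b , 0
... | suc a , b = a , suc b

unpair-pair : ∀ a b → unpair (pair a b) ≡ (a , b)
unpair-pair a b = go (a + b) a b refl
  where
  go : ∀ s a b → a + b ≡ s → unpair (b + triangle s) ≡ (a , b)
  go s       a       (suc b) eq rewrite go s (suc a) b (trans (sym (ℕ.+-suc a b)) eq) = refl
  go zero    zero    zero    eq = refl
  go (suc s) (suc a) zero    eq rewrite ℕ.+-identityʳ a | ℕ.suc-injective eq | go s 0 s refl = refl

code : List ℕ → ℕ
code []       = 0
code (x ∷ xs) = suc (pair x (code xs))

-- Syntax of the functions partial recursive in an oracle, by arity.
data Program : ℕ → Set where
  zeroᵖ  : ∀ {n} → Program n
  sucᵖ   : Program 1
  oracle : Program 1
  proj   : ∀ {n} → Fin n → Program n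
  comp   : ∀ {m n} → Program m → Vec (Program n) m → Program n
  prec   : ∀ {n} → Program n → Program (suc (suc n)) → Program (suc n)
  μ      : ∀ {n} → Program (suc n) → Program n

-- p ⊢ e · xs ⇓ y: with oracle p, program e halts on xs with result y.
data _⊢_·_⇓_ (p : Baire) : ∀ {n} → Program n → Vec ℕ n → ℕ → Set where
  zeroᵖ  : ∀ {n} {xs : Vec ℕ n} → p ⊢ zeroᵖ · xs ⇓ 0
  sucᵖ   : ∀ {x} → p ⊢ sucᵖ · x ∷ [] ⇓ suc x
  oracle : ∀ {x} → p ⊢ oracle · x ∷ [] ⇓ p x
  proj   : ∀ {n} {xs : Vec ℕ n} i → p ⊢ proj i · xs ⇓ lookup xs i
  comp   : ∀ {m n} {f : Program m} {gs : Vec (Program n) m} {xs ys z} →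
           Pointwise (λ g y → p ⊢ g · xs ⇓ y) gs ys → p ⊢ f · ys ⇓ z →
           p ⊢ comp f gs · xs ⇓ z
  prec-z : ∀ {n} {f : Program n} {g xs y} →
           p ⊢ f · xs ⇓ y → p ⊢ prec f g · 0 ∷ xs ⇓ y
  prec-s : ∀ {n} {f : Program n} {g xs m y z} →
           p ⊢ prec f g · m ∷ xs ⇓ y → p ⊢ g · m ∷ y ∷ xs ⇓ z →
           p ⊢ prec f g · suc m ∷ xs ⇓ z
  μ      : ∀ {n} {f : Program (suc n)} {xs m} →
           (∀ i → i < m → ∃[ y ] p ⊢ f · i ∷ xs ⇓ suc y) → p ⊢ f · m ∷ xs ⇓ 0 →
           p ⊢ μ f · xs ⇓ m

record PartialFunction : Set₁ where
  field
    Graph      : Baire → Baire → Set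
    resp       : ∀ {p p′ q q′} → p ≗ p′ → q ≗ q′ → Graph p q → Graph p′ q′
    functional : ∀ {p q q′} → Graph p q → Graph p q′ → q ≗ q′

open PartialFunction using (Graph)

-- The graph of F need only be a restriction of that of the program.
Computable : PartialFunction → Set
Computable F = ∃[ e ] ∀ {p q} → Graph F p q → ∀ n → p ⊢ e · n ∷ [] ⇓ q n

-- p names x means δ(p) = x; the graph of δ is single-valued and onto.
record RepresentedSpace : Set₁ where
  infix 4 _names_
  field
    points     : Setoid 0ℓ 0ℓ
  open Setoid points public using (Carrier; _≈_)
  field
    _names_    : Baire → Carrier → Set
    resp       : ∀ {p q x y} → p ≗ q → x ≈ y → p names x → q names y
    functional : ∀ {p x y} → p names x → p names y → x ≈ y
    surjective : ∀ x → ∃[ p ] p names x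
  module ≈ = Setoid points

open RepresentedSpace using (Carrier; points)

-- Multivalued functions, as relations; the domain consists of the points
-- with at least one value.
infix 1 _⇉_
record _⇉_ (X Y : RepresentedSpace) : Set₁ where
  private
    module X = RepresentedSpace X
    module Y = RepresentedSpace Y
  field
    _↦_  : X.Carrier → Y.Carrier → Set
    resp : ∀ {x x′ y y′} → x X.≈ x′ → y Y.≈ y′ → x ↦ y → x′ ↦ y′

  dom : X.Carrier → Set
  dom x = ∃[ y ] x ↦ y

infixr 9 _⊙_
_⊙_ : ∀ {X Y Z} → Y ⇉ Z → X ⇉ Y → X ⇉ Z
_⊙_ {X} {Y} {Z} f g = record
  { _↦_  = λ x z → (∀ y → x g.↦ y → f.dom y) × (∃[ y ] x g.↦ y × y f.↦ z)
  ; resp = λ x≈x′ z≈z′ (total , y , gxy , fyz) →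
             (λ y′ gx′y′ → total y′ (g.resp (X.≈.sym x≈x′) Y.≈.refl gx′y′))
             , y , g.resp x≈x′ Y.≈.refl gxy , f.resp Y.≈.refl z≈z′ fyz
  }
  where
  module f = _⇉_ f
  module g = _⇉_ g
  module X = RepresentedSpace X
  module Y = RepresentedSpace Y

restrict : ∀ {X Y} → X ⇉ Y → (P : Carrier X → Set) →
           P Respects RepresentedSpace._≈_ X → X ⇉ Y
restrict f P P-resp = record
  { _↦_  = λ x y → P x × x f.↦ y
  ; resp = λ x≈x′ y≈y′ (Px , fxy) → P-resp x≈x′ Px , f.resp x≈x′ y≈y′ fxy
  }
  where module f = _⇉_ f

infix 4 _⊩_
_⊩_ : ∀ {X Y} → PartialFunction → X ⇉ Y → Set
_⊩_ {X} {Y} F f = ∀ p x → p X.names x → f.dom x →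
  ∃[ q ] Graph F p q × (∃[ y ] q Y.names y × x f.↦ y)
  where
  module f = _⇉_ f
  module X = RepresentedSpace X
  module Y = RepresentedSpace Y

-- p ↦ K⟨p, G H(p)⟩
transform : (H K G : PartialFunction) → PartialFunction
transform H K G = record
  { Graph      = λ p q → ∃[ h ] ∃[ r ] Graph H p h × Graph G h r × Graph K ⟨ p , r ⟩ q
  ; resp       = λ p≗p′ q≗q′ (h , r , Hph , Ghr , Kq) →
                   h , r , H.resp p≗p′ (λ _ → refl) Hph , Ghr
                   , K.resp (⟨,⟩-cong p≗p′ (λ _ → refl)) q≗q′ Kq
  ; functional = λ (h , r , Hph , Ghr , Kq) (h′ , r′ , Hph′ , Gh′r′ , Kq′) →
                   let h′≗h = H.functional Hph′ Hph
                       r′≗r = G.functional (G.resp h′≗h (λ _ → refl) Gh′r′) Ghr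
                   in K.functional Kq (K.resp (⟨,⟩-cong (λ _ → refl) r′≗r) (λ _ → refl) Kq′)
  }
  where
  module H = PartialFunction H
  module K = PartialFunction K
  module G = PartialFunction G

infix 4 _≤W_ _≡W_
_≤W_ : ∀ {X Y U V} → X ⇉ Y → U ⇉ V → Set₁
f ≤W g = ∃[ H ] ∃[ K ] Computable H × Computable K ×
         (∀ G → G ⊩ g → transform H K G ⊩ f)

_≡W_ : ∀ {X Y U V} → X ⇉ Y → U ⇉ V → Set₁
f ≡W g = f ≤W g × g ≤W f

-- h represents the degree f ⋆ g = max { f₁ ∘ g₁ : f₁ ≤W f, g₁ ≤W g }.
record _Represents_⋆_ {A B C D E F} (h : A ⇉ B) (f : C ⇉ D) (g : E ⇉ F) : Set₁ where
  field
    attained   : ∃[ X ] ∃[ Y ] ∃[ Z ] ∃[ f₁ ] ∃[ g₁ ]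
                 f₁ ≤W f × g₁ ≤W g × h ≡W _⊙_ {X} {Y} {Z} f₁ g₁
    upperBound : ∀ {X Y Z} (f₁ : Y ⇉ Z) (g₁ : X ⇉ Y) →
                 f₁ ≤W f → g₁ ≤W g → f₁ ⊙ g₁ ≤W h

-- α ∙ r ≈> q: the partial continuous function on Baire space with associate
-- α (in Kleene's sense) maps r to q.  Reading longer and longer prefixes of
-- r, the first non-zero answer suc k of α to the question n means q n ≡ k.
_∙_≈>_ : Baire → Baire → Baire → Set
α ∙ r ≈> q = ∀ n → ∃[ m ] answer n m ≡ suc (q n) × (∀ i → i < m → answer n i ≡ 0)
  where
  answer : ℕ → ℕ → ℕ
  answer n m = α (code (n ∷ applyUpTo r m))

∙-functional : ∀ {α r q q′} → α ∙ r ≈> q → α ∙ r ≈> q′ → q ≗ q′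
∙-functional d d′ n with d n | d′ n
... | m , eq , min | m′ , eq′ , min′ with ℕ.<-cmp m m′
... | tri< m<m′ _ _ with () ← trans (sym eq) (min′ m m<m′)
... | tri≈ _ refl _ = ℕ.suc-injective (trans (sym eq) eq′)
... | tri> _ _ m′<m with () ← trans (sym eq′) (min m′ m′<m)

∙-resp : ∀ {α β r q} → α ≗ β → α ∙ r ≈> q → β ∙ r ≈> q
∙-resp α≗β d n with d n
... | m , eq , min =
  m , trans (sym (α≗β _)) eq , λ i i<m → trans (sym (α≗β _)) (min i i<m)

module _ (X Y : RepresentedSpace) where
  private
    module X = RepresentedSpace X
    module Y = RepresentedSpace Y

  _IsAssociateOf_ : Baire → Func X.points Y.points → Set
  α IsAssociateOf f = ∀ r x → r X.names x → ∃[ q ] α ∙ r ≈> q × q Y.names Func.to f x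

  𝒞 : RepresentedSpace
  𝒞 = record
    { points     = record
      { Carrier       = ∃[ f ] ∃[ α ] α IsAssociateOf f
      ; _≈_           = λ (f , _) (g , _) → ∀ x → Func.to f x Y.≈ Func.to g x
      ; isEquivalence = record
        { refl  = λ x → Y.≈.refl
        ; sym   = λ f≈g x → Y.≈.sym (f≈g x)
        ; trans = λ f≈g g≈h x → Y.≈.trans (f≈g x) (g≈h x)
        }
      }
    ; _names_    = λ α (f , _) → α IsAssociateOf f
    ; resp       = λ α≗β f≈g α-f r x r-x →
                     let q , d , q-fx = α-f r x r-x
                     in q , ∙-resp {r = r} α≗β d , Y.resp (λ _ → refl) (f≈g x) q-fx
    ; functional = λ {α} α-f α-g x →
                     let r , r-x       = X.surjective x
                         q , d , q-fx  = α-f r x r-x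
                         q′ , d′ , q′-gx = α-g r x r-x
                     in Y.functional q-fx
                          (Y.resp (∙-functional {α} {r} d′ d) Y.≈.refl q′-gx)
    ; surjective = proj₂
    }

-- Sierpiński space, with false as ⊥ and true as ⊤.
𝕊 : RepresentedSpace
𝕊 = record
  { points     = setoid Bool
  ; _names_    = _names_
  ; resp       = λ { {x = x} p≗q refl → resp x p≗q }
  ; functional = λ {p} {x} {y} → functional x y
  ; surjective = λ { false → (λ _ → 0) , λ _ → refl ; true → (λ _ → 1) , 0 , λ () }
  }
  where
  _names_ : Baire → Bool → Set
  p names false = ∀ n → p n ≡ 0
  p names true  = ∃[ n ] p n ≢ 0

  resp : ∀ {p q} x → p ≗ q → p names x → q names x
  resp false p≗q p-x n       = trans (sym (p≗q n)) (p-x n)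
  resp true  p≗q (n , pn≢0) = n , λ qn≡0 → pn≢0 (trans (p≗q n) qn≡0)

  functional : ∀ {p} x y → p names x → p names y → x ≡ y
  functional false false _         _         = refl
  functional false true  p≡0       (n , p≢0) = ⊥-elim (p≢0 (p≡0 n))
  functional true  false (n , p≢0) p≡0       = ⊥-elim (p≢0 (p≡0 n))
  functional true  true  _         _         = refl

-- A closed set is given by the characteristic function of its complement.
𝒜 : RepresentedSpace → RepresentedSpace
𝒜 X = 𝒞 X 𝕊

Member : ∀ X → Carrier X → Carrier (𝒜 X) → Set
Member X x (χ , _) = Func.to χ x ≡ false

infix 4 Member
syntax Member X x A = x ∈[ X ] A

C : (X : RepresentedSpace) → 𝒜 X ⇉ X
C X = record
  { _↦_  = λ A x → x ∈[ X ] A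
  ; resp = λ { {χ , _} {x′ = χ′ , _} A≈A′ x≈x′ x∈A →
             trans (Func.cong χ′ (X.≈.sym x≈x′)) (trans (sym (A≈A′ _)) x∈A) }
  }
  where module X = RepresentedSpace X

bit : Bool → ℕ
bit false = 0
bit true  = 1

Cantor : RepresentedSpace
Cantor = record
  { points     = ℕ →-setoid Bool
  ; _names_    = λ p x → ∀ n → p n ≡ bit (x n)
  ; resp       = λ p≗q x≗y p-x n → trans (sym (p≗q n)) (trans (p-x n) (cong bit (x≗y n)))
  ; functional = λ p-x p-y n → bit-injective (trans (sym (p-x n)) (p-y n))
  ; surjective = λ x → bit ∘ x , λ n → refl
  }
  where
  bit-injective : ∀ {a b} → bit a ≡ bit b → a ≡ b
  bit-injective {false} {false} _ = refl
  bit-injective {true}  {true}  _ = refl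

AllOrUnique : Carrier (𝒜 Cantor) → Set
AllOrUnique A = (∀ x → x ∈[ Cantor ] A) ⊎ (∃[ x ] ∀ y → y ∈[ Cantor ] A ⇔ y ≗ x)

AllOrUnique-resp : AllOrUnique Respects RepresentedSpace._≈_ (𝒜 Cantor)
AllOrUnique-resp A≈A′ (inj₁ all)        = inj₁ λ x → trans (sym (A≈A′ x)) (all x)
AllOrUnique-resp A≈A′ (inj₂ (x , uniq)) = inj₂ (x , λ y → mk⇔
  (λ y∈A′ → Equivalence.to (uniq y) (trans (A≈A′ y) y∈A′))
  (λ y≗x → trans (sym (A≈A′ y)) (Equivalence.from (uniq y) y≗x)))

AoUC : 𝒜 Cantor ⇉ Cantor
AoUC = restrict (C Cantor) AllOrUnique (λ {A} {A′} → AllOrUnique-resp {A} {A′})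

2⁻_ : ℕ → ℚ
2⁻ n = ½ ^ n

-- a and b are fast Cauchy sequences with the same limit, if also
-- Close a a and Close b b.
record Close (a b : ℕ → ℚ) : Set where
  constructor close
  field bound : ∀ m n → ℚ.∣ a m ℚ.- b n ∣ ℚ.≤ 2⁻ m ℚ.+ 2⁻ n

2⁻n≤1/n+1 : ∀ n → ℚ.toℚᵘ (2⁻ n) ℚᵘ.≤ mkℚᵘ (+ 1) n
2⁻n≤1/n+1 zero    = ℚᵘ.≤-refl
2⁻n≤1/n+1 (suc n) = begin
  ℚ.toℚᵘ (½ ℚ.* 2⁻ n)      ≃⟨ ℚ.toℚᵘ-homo-* ½ (2⁻ n) ⟩
  ℚᵘ.½ ℚᵘ.* ℚ.toℚᵘ (2⁻ n)  ≤⟨ ℚᵘ.*-monoʳ-≤-nonNeg ℚᵘ.½ (2⁻n≤1/n+1 n) ⟩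
  ℚᵘ.½ ℚᵘ.* mkℚᵘ (+ 1) n   ≤⟨ ℚᵘ.*≤* (+≤+ (s≤s (ℕ.m≤n⇒m≤n+o 0 (ℕ.m≤n+m (suc (n + 0)) n)))) ⟩
  mkℚᵘ (+ 1) (suc n)       ∎
  where open ℚᵘ.≤-Reasoning

1/n+1≤pos : ∀ p → 0ℚ ℚ.< p → ∃[ n ] mkℚᵘ (+ 1) n ℚᵘ.≤ ℚ.toℚᵘ p
1/n+1≤pos p 0<p with p | ℚ.positive 0<p
... | mkℚ (+ suc a) d _ | _ = d , ℚᵘ.*≤* (+≤+ (ℕ.*-monoˡ-≤ (suc d) {1} {suc a} (s≤s z≤n)))

archimedean : ∀ p → 0ℚ ℚ.< p → ∃[ n ] 2⁻ n ℚ.≤ p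
archimedean p 0<p = let n , 1/n+1≤p = 1/n+1≤pos p 0<p
                    in n , ℚ.toℚᵘ-cancel-≤ (ℚᵘ.≤-trans (2⁻n≤1/n+1 n) 1/n+1≤p)

0<2⁻n : ∀ n → 0ℚ ℚ.< 2⁻ n
0<2⁻n zero    = ℚ.positive⁻¹ 1ℚ
0<2⁻n (suc n) = ℚ.*-monoʳ-<-pos ½ (0<2⁻n n)

half+half : ∀ p → ½ ℚ.* p ℚ.+ ½ ℚ.* p ≡ p
half+half = solve 1 (λ p → con ½ :* p :+ con ½ :* p := p) refl
  where open +-*-Solver

limit-≤ : ∀ p q → (∀ n → p ℚ.≤ q ℚ.+ 2⁻ n) → p ℚ.≤ q
limit-≤ p q p≤q+ = ℚ.≮⇒≥ λ q<p →
  let n , 2⁻n≤p-q = archimedean (p ℚ.- q) (subst (ℚ._< p ℚ.- q) (ℚ.+-inverseʳ q) (ℚ.+-monoˡ-< (ℚ.- q) q<p))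
  in ℚ.<-irrefl refl (begin-strict
    p                       ≤⟨ p≤q+ (suc n) ⟩
    q ℚ.+ 2⁻ suc n          ≡⟨ ℚ.+-identityʳ _ ⟨
    q ℚ.+ 2⁻ suc n ℚ.+ 0ℚ   <⟨ ℚ.+-monoʳ-< (q ℚ.+ 2⁻ suc n) (0<2⁻n (suc n)) ⟩
    q ℚ.+ 2⁻ suc n ℚ.+ 2⁻ suc n    ≡⟨ ℚ.+-assoc q _ _ ⟩
    q ℚ.+ (2⁻ suc n ℚ.+ 2⁻ suc n)  ≡⟨ cong (q ℚ.+_) (half+half (2⁻ n)) ⟩
    q ℚ.+ 2⁻ n              ≤⟨ ℚ.+-monoʳ-≤ q 2⁻n≤p-q ⟩
    q ℚ.+ (p ℚ.- q)         ≡⟨ solve 2 (λ p q → q :+ (p :- q) := p) refl p q ⟩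
    p                       ∎)
  where
  open ℚ.≤-Reasoning
  open +-*-Solver

Close-sym : ∀ {a b} → Close a b → Close b a
Close-sym {a} {b} (close ab) = close λ m n → begin
  ℚ.∣ b m ℚ.- a n ∣        ≡⟨ cong ℚ.∣_∣ (solve 2 (λ p q → p :- q := :- (q :- p)) refl (b m) (a n)) ⟩
  ℚ.∣ ℚ.- (a n ℚ.- b m) ∣  ≡⟨ ℚ.∣-p∣≡∣p∣ (a n ℚ.- b m) ⟩
  ℚ.∣ a n ℚ.- b m ∣        ≤⟨ ab n m ⟩
  2⁻ n ℚ.+ 2⁻ m            ≡⟨ ℚ.+-comm (2⁻ n) (2⁻ m) ⟩
  2⁻ m ℚ.+ 2⁻ n            ∎
  where
  open ℚ.≤-Reasoning
  open +-*-Solver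

Close-trans : ∀ {a b c} → Close a b → Close b c → Close a c
Close-trans {a} {b} {c} (close ab) (close bc) = close λ m n → limit-≤ _ _ λ k → let j = suc k in begin
  ℚ.∣ a m ℚ.- c n ∣
    ≡⟨ cong ℚ.∣_∣ (solve 3 (λ p q r → p :- r := (p :- q) :+ (q :- r)) refl (a m) (b j) (c n)) ⟩
  ℚ.∣ (a m ℚ.- b j) ℚ.+ (b j ℚ.- c n) ∣
    ≤⟨ ℚ.∣p+q∣≤∣p∣+∣q∣ (a m ℚ.- b j) (b j ℚ.- c n) ⟩
  ℚ.∣ a m ℚ.- b j ∣ ℚ.+ ℚ.∣ b j ℚ.- c n ∣
    ≤⟨ ℚ.+-mono-≤ (ab m j) (bc j n) ⟩
  (2⁻ m ℚ.+ 2⁻ j) ℚ.+ (2⁻ j ℚ.+ 2⁻ n)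
    ≡⟨ solve 3 (λ p q r → (p :+ q) :+ (q :+ r) := (p :+ r) :+ (q :+ q)) refl (2⁻ m) (2⁻ j) (2⁻ n) ⟩
  (2⁻ m ℚ.+ 2⁻ n) ℚ.+ (2⁻ j ℚ.+ 2⁻ j)
    ≡⟨ cong (2⁻ m ℚ.+ 2⁻ n ℚ.+_) (half+half (2⁻ k)) ⟩
  (2⁻ m ℚ.+ 2⁻ n) ℚ.+ 2⁻ k ∎
  where
  open ℚ.≤-Reasoning
  open +-*-Solver

Close-cong : ∀ {a a′ b} → a ≗ a′ → Close a b → Close a′ b
Close-cong {b = b} a≗a′ (close ab) = close λ m n →
  subst (λ p → ℚ.∣ p ℚ.- b n ∣ ℚ.≤ 2⁻ m ℚ.+ 2⁻ n) (a≗a′ m) (ab m n)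

ν : ℕ → ℚ
ν k = let n , d = unpair k
          i , j = unpair n
      in (i ⊖ j) ℚ./ suc d

ν-surjective : ∀ p → ∃[ k ] ν k ≡ p
ν-surjective p = let i , j , eq = difference (↥ p) in pair (pair i j) (ℚ.denominator-1 p) , lemma i j eq
  where
  difference : ∀ z → ∃[ i ] ∃[ j ] i ⊖ j ≡ z
  difference (+ n)    = n , 0 , refl
  difference -[1+ n ] = 0 , suc n , refl

  lemma : ∀ i j → i ⊖ j ≡ ↥ p → ν (pair (pair i j) (ℚ.denominator-1 p)) ≡ p
  lemma i j eq
    rewrite unpair-pair (pair i j) (ℚ.denominator-1 p) | unpair-pair i j | eq = ℚ.↥p/↧p≡p p

record Real : Set where
  field
    approx  : ℕ → ℚ
    regular : Close approx approx

open Real using (approx; regular)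

ℝ : RepresentedSpace
ℝ = record
  { points     = record
    { Carrier       = Real
    ; _≈_           = λ x y → Close (approx x) (approx y)
    ; isEquivalence = record
      { refl  = λ {x} → regular x
      ; sym   = Close-sym
      ; trans = Close-trans
      }
    }
  ; _names_    = λ p x → Close (ν ∘ p) (approx x)
  ; resp       = λ p≗q x≈y p-x → Close-cong (cong ν ∘ p≗q) (Close-trans p-x x≈y)
  ; functional = λ p-x p-y → Close-trans (Close-sym p-x) p-y
  ; surjective = λ x → proj₁ ∘ ν-surjective ∘ approx x
                     , Close-cong (sym ∘ proj₂ ∘ ν-surjective ∘ approx x) (regular x)
  }

fromℚ : ℚ → Real
fromℚ p = record { approx = λ _ → p ; regular = close λ m n → begin
  ℚ.∣ p ℚ.- p ∣  ≡⟨ cong ℚ.∣_∣ (ℚ.+-inverseʳ p) ⟩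
  0ℚ             ≤⟨ ℚ.+-mono-≤ (ℚ.<⇒≤ (0<2⁻n m)) (ℚ.<⇒≤ (0<2⁻n n)) ⟩
  2⁻ m ℚ.+ 2⁻ n  ∎ }
  where open ℚ.≤-Reasoning

infix 4 _≤ℝ_
_≤ℝ_ : Real → Real → Set
x ≤ℝ y = ∀ m n → approx x m ℚ.≤ approx y n ℚ.+ (2⁻ m ℚ.+ 2⁻ n)

Subspace : (X : RepresentedSpace) → (Carrier X → Set) → RepresentedSpace
Subspace X P = record
  { points     = On.setoid X.points (proj₁ {B = P})
  ; _names_    = λ p (x , _) → p X.names x
  ; resp       = X.resp
  ; functional = X.functional
  ; surjective = λ (x , _) → X.surjective x
  }
  where module X = RepresentedSpace X

𝕀 : RepresentedSpace
𝕀 = Subspace ℝ λ x → fromℚ 0ℚ ≤ℝ x × x ≤ℝ fromℚ 1ℚ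

-- Finite powers: the i-th coordinate of the sequence p is p i, p (i + n),
-- p (i + 2n), …
_^ˢ_ : RepresentedSpace → ℕ → RepresentedSpace
X ^ˢ n = record
  { points     = Vector.≋-setoid X.points n
  ; _names_    = λ p x → ∀ i → coordinate n p i X.names x i
  ; resp       = λ p≗q x≈y p-x i → X.resp (λ k → p≗q (toℕ i + k * n)) (x≈y i) (p-x i)
  ; functional = λ p-x p-y i → X.functional (p-x i) (p-y i)
  ; surjective = λ x →
      let p , coordinates = interleave n (λ i → proj₁ (X.surjective (x i)))
      in p , λ i → X.resp (sym ∘ coordinates i) X.≈.refl (proj₂ (X.surjective (x i)))
  }
  where
  module X = RepresentedSpace X

  coordinate : ∀ n → Baire → Fin n → Baire
  coordinate n p i k = p (toℕ i + k * n)

  interleave : ∀ n (q : Fin n → Baire) → ∃[ p ] ∀ i → coordinate n p i ≗ q i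
  interleave zero        q = (λ _ → 0) , λ ()
  interleave n@(suc n-1) q = (λ k → q (k mod n) (k / n)) , λ i k → cong₂ q (mod≡ i k) (div≡ i k)
    where
    mod≡ : ∀ i k → (toℕ i + k * n) mod n ≡ i
    mod≡ i k = toℕ-injective (trans (toℕ-fromℕ< _)
      (trans ([m+kn]%n≡m%n (toℕ i) k n) (m<n⇒m%n≡m (toℕ<n i))))

    div≡ : ∀ i k → (toℕ i + k * n) / n ≡ k
    div≡ i k = trans (+-distrib-/-∣ʳ (toℕ i) (divides k refl))
      (cong₂ _+_ (m<n⇒m/n≡0 (toℕ<n i)) (m*n/n≡m k n))

infix 4 _⟶_
_⟶_ : (ℕ → ℚ) → Real → Set
a ⟶ x = ∀ n → ∃[ N ] ∀ m → N ≤ m → ℚ.∣ a m ℚ.- approx x m ∣ ℚ.≤ 2⁻ n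

-- z = t x + (1 - t) y, the right-hand side computed on approximations.
_≈[_]_⊹_ : (z t x y : Real) → Set
z ≈[ t ] x ⊹ y =
  (λ m → approx t m ℚ.* approx x m ℚ.+ (1ℚ ℚ.- approx t m) ℚ.* approx y m) ⟶ z

Convex : ∀ {n} → Carrier (𝒜 (𝕀 ^ˢ n)) → Set
Convex {n} A = ∀ x y z (t : Carrier 𝕀) → x ∈[ 𝕀 ^ˢ n ] A → y ∈[ 𝕀 ^ˢ n ] A →
  (∀ i → proj₁ (z i) ≈[ proj₁ t ] proj₁ (x i) ⊹ proj₁ (y i)) → z ∈[ 𝕀 ^ˢ n ] A

Convex-resp : ∀ {n} → Convex {n} Respects RepresentedSpace._≈_ (𝒜 (𝕀 ^ˢ n))
Convex-resp A≈A′ convex x y z t x∈A′ y∈A′ z≈ =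
  trans (sym (A≈A′ z)) (convex x y z t (trans (A≈A′ x) x∈A′) (trans (A≈A′ y) y∈A′) z≈)

XC : ∀ n → 𝒜 (𝕀 ^ˢ n) ⇉ 𝕀 ^ˢ n
XC n = restrict (C (𝕀 ^ˢ n)) (Convex {n}) (λ {A} {A′} → Convex-resp {n} {A} {A′})

-- A reduction to XC k is used only as a pair of continuous maps; it is refuted
-- by an adversary who fixes the instance of XC₁ ⋆ AoUC late.  The value of
-- x₀ + … + xₖ divides Cantor space into classes 0, …, k + 1.  The adversary's
-- instance asks for any x, until the choice is collapsed to a single x of some
-- class, and then for a real in an interval J that depends on the class of x;
-- the intervals can be shrunk at any time.  The reduction answers with a convex
-- set B ⊆ [0,1]ᵏ, each of whose points is translated back to a class and a real.
--
-- Since a collapse stays possible, B always has for each class c a point all of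
-- whose neighbours up to some distance, fixed by continuity at the start, can
-- only be translated to c.  If B is nearly a Lipschitz graph over d + 1
-- coordinates, then the points of B over each point of a finite grid in these
-- coordinates are so close together that they are translated to approximately
-- the same real, and the interval of a class c can be shrunk to avoid these
-- finitely many reals.  Now B avoids the grid in the neighbourhood of a point.
-- If B were long in each of the d + 1 directions, convexity would give it a
-- parallelepiped there that meets the grid, so B is nearly a graph over d of
-- the coordinates.  After k such steps, one class each, B is so small that its
-- points can no longer be translated to both classes 0 and 1.
module Submission where

open import Axiom.ExcludedMiddle using (ExcludedMiddle)
import Data.Nat.Properties as ℕ
open import Data.Product using (_×_; _,_; ∃; ∃-syntax; proj₁; proj₂)
import Data.Rational.Properties as ℚ
open import Data.Rational.Solver using (module +-*-Solver)
open +-*-Solver using (solve; _:+_; _:*_; _:-_; :-_; _:=_; con)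
open import Data.Sum using (_⊎_; inj₁; inj₂)
open import Function using (_∘_)
open import Level using (0ℓ)
open import Relation.Binary.PropositionalEquality hiding (J)
open import Relation.Nullary using (¬_; Dec; yes; no; contradiction)

-- The obstacle is the order of choices. How thin the solutions must be for a grid point to force
-- its answers depends on the precision of the answers, which depends on the number of grid points;
-- so grid and precision are fixed before the thinness is available. Hence a level calls the level
-- above it in mid-play, at a scale found this way, and that call must leave alone the interval
-- whose width has already been used. This is why each step owns a class. Answers belong to names,
-- not to points: one solution may be translated to several classes. Signed-digit paths as names
-- form a finitely branching tree, so that compactness makes all moduli uniform, and their intervals
-- overlap, so that nearby points have paths with a common prefix. The geometry takes place among
-- rational points near solutions, which is enough because every answer in play is decided by a
-- finite prefix. In the parallelepiped over n coordinates, edges of length Aη have directions with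
-- error η. With A = 2n the edge matrix is dominated by its diagonal, and Newton steps halve the
-- error; the Lipschitz constant pays this factor at every step.

-- Linear estimates over ℚ and limits of regular sequences

module Rationals where

  open import Data.Nat as ℕ using (ℕ; suc)
  open import Data.Rational hiding (_/_)
  open import Defs using (2⁻_; 0<2⁻n; archimedean; limit-≤)

  2ℚ : ℚ
  2ℚ = 1ℚ + 1ℚ

  -- The shape in which a linear consequence X ≤ Y of hypotheses proves p ≤ q:
  -- the remaining equation is left to the ring solver.
  linear : ∀ {p q X Y} → X ≤ Y → p + Y ≡ q + X → p ≤ q
  linear {p} {q} {X} {Y} X≤Y eq = ℚ.≮⇒≥ λ q<p →
    ℚ.<-irrefl (sym eq) (ℚ.+-mono-<-≤ q<p X≤Y)

  infixr 6 _⊕_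
  _⊕_ : ∀ {p q r s} → p ≤ q → r ≤ s → p + r ≤ q + s
  _⊕_ = ℚ.+-mono-≤

  scale-≤ : ∀ {c p q} → 0ℚ ≤ c → p ≤ q → c * p ≤ c * q
  scale-≤ {c} 0≤c = ℚ.*-monoˡ-≤-nonNeg c {{nonNegative 0≤c}}

  0≤2⁻ : ∀ n → 0ℚ ≤ 2⁻ n
  0≤2⁻ n = ℚ.<⇒≤ (0<2⁻n n)

  0≤* : ∀ {p q} → 0ℚ ≤ p → 0ℚ ≤ q → 0ℚ ≤ p * q
  0≤* {p} 0≤p 0≤q = ℚ.≤-trans (ℚ.≤-reflexive (sym (ℚ.*-zeroʳ p))) (scale-≤ 0≤p 0≤q)

  0<* : ∀ {p q} → 0ℚ < p → 0ℚ < q → 0ℚ < p * q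
  0<* {p} {q} 0<p 0<q =
    ℚ.positive⁻¹ (p * q) {{ℚ.pos*pos⇒pos p {{positive 0<p}} q {{positive 0<q}}}}

  0≤1 : 0ℚ ≤ 1ℚ
  0≤1 = 0≤2⁻ 0

  0≤½ : 0ℚ ≤ ½
  0≤½ = 0≤2⁻ 1

  2⁻-step : ∀ n → 2⁻ suc n ≤ 2⁻ n
  2⁻-step n = linear (scale-≤ 0≤½ (0≤2⁻ n))
    (solve 1 (λ x → con ½ :* x :+ con ½ :* x := x :+ con ½ :* con 0ℚ) refl (2⁻ n))

  2⁻-anti : ∀ {m n} → m ℕ.≤ n → 2⁻ n ≤ 2⁻ m
  2⁻-anti {m} m≤n with ℕ.≤⇒≤′ m≤n
  ... | ℕ.≤′-refl     = ℚ.≤-refl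
  ... | ℕ.≤′-step {n} m≤n = ℚ.≤-trans (2⁻-step n) (2⁻-anti {m} {n} (ℕ.≤′⇒≤ m≤n))

  2⁻≤1 : ∀ n → 2⁻ n ≤ 1ℚ
  2⁻≤1 n = 2⁻-anti {0} {n} ℕ.z≤n

  -- Two linear inequalities in place of an absolute value, so that `linear` and the ring solver
  -- apply directly.
  record Near (ρ a b : ℚ) : Set where
    constructor near
    field
      below : a ≤ b + ρ
      above : b ≤ a + ρ

  open Near public

  near-sym : ∀ {ρ a b} → Near ρ a b → Near ρ b a
  near-sym (near l u) = near u l

  near-refl : ∀ {ρ a} → 0ℚ ≤ ρ → Near ρ a a
  near-refl {ρ} {a} 0≤ρ = near a≤a+ρ a≤a+ρ
    where
    a≤a+ρ : a ≤ a + ρ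
    a≤a+ρ = linear 0≤ρ (solve 2 (λ a ρ → a :+ ρ := a :+ ρ :+ con 0ℚ) refl a ρ)

  near-≡ : ∀ {ρ a b} → 0ℚ ≤ ρ → a ≡ b → Near ρ a b
  near-≡ 0≤ρ refl = near-refl 0≤ρ

  near-trans : ∀ {ρ σ a b c} → Near ρ a b → Near σ b c → Near (ρ + σ) a c
  near-trans {ρ} {σ} {a} {b} {c} (near l u) (near l′ u′) = near
    (linear (l ⊕ l′) (solve 5 (λ ρ σ a b c → a :+ (b :+ ρ :+ (c :+ σ)) := c :+ (ρ :+ σ) :+ (a :+ b)) refl ρ σ a b c))
    (linear (u ⊕ u′) (solve 5 (λ ρ σ a b c → c :+ (a :+ ρ :+ (b :+ σ)) := a :+ (ρ :+ σ) :+ (b :+ c)) refl ρ σ a b c))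

  near-mono : ∀ {ρ σ a b} → ρ ≤ σ → Near ρ a b → Near σ a b
  near-mono {a = a} {b} ρ≤σ (near l u) =
    near (ℚ.≤-trans l (ℚ.+-monoʳ-≤ b ρ≤σ)) (ℚ.≤-trans u (ℚ.+-monoʳ-≤ a ρ≤σ))

  near-+ : ∀ {ρ σ a b c d} → Near ρ a b → Near σ c d → Near (ρ + σ) (a + c) (b + d)
  near-+ {ρ} {σ} {a} {b} {c} {d} (near l u) (near l′ u′) = near
    (ℚ.≤-trans (l ⊕ l′) (ℚ.≤-reflexive (swap b ρ d σ)))
    (ℚ.≤-trans (u ⊕ u′) (ℚ.≤-reflexive (swap a ρ c σ)))
    where
    swap : ∀ p q r s → p + q + (r + s) ≡ p + r + (q + s)
    swap = solve 4 (λ p q r s → p :+ q :+ (r :+ s) := p :+ r :+ (q :+ s)) refl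

  near-* : ∀ {ρ a b} c → 0ℚ ≤ c → Near ρ a b → Near (c * ρ) (c * a) (c * b)
  near-* {ρ} {a} {b} c 0≤c (near l u) = near
    (ℚ.≤-trans (scale-≤ 0≤c l) (ℚ.≤-reflexive (ℚ.*-distribˡ-+ c b ρ)))
    (ℚ.≤-trans (scale-≤ 0≤c u) (ℚ.≤-reflexive (ℚ.*-distribˡ-+ c a ρ)))

  near-resp : ∀ {ρ σ a b c d} → ρ ≡ σ → a ≡ c → b ≡ d → Near ρ a b → Near σ c d
  near-resp refl refl refl n = n

  comb : ℚ → ℚ → ℚ → ℚ
  comb t a b = t * a + (1ℚ - t) * b

  0≤1- : ∀ {t} → t ≤ 1ℚ → 0ℚ ≤ 1ℚ - t
  0≤1- {t} t≤1 = linear t≤1 (solve 1 (λ t → con 0ℚ :+ con 1ℚ := con 1ℚ :- t :+ t) refl t)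

  near-comb : ∀ {ρ σ a b c d t} → 0ℚ ≤ t → t ≤ 1ℚ → Near ρ a b → Near σ c d →
              Near (comb t ρ σ) (comb t a c) (comb t b d)
  near-comb {t = t} 0≤t t≤1 ab cd = near-+ (near-* t 0≤t ab) (near-* (1ℚ - t) (0≤1- t≤1) cd)

  comb-same : ∀ t ρ → comb t ρ ρ ≡ ρ
  comb-same = solve 2 (λ t ρ → t :* ρ :+ (con 1ℚ :- t) :* ρ := ρ) refl

  near-comb-same : ∀ {ρ a b c d t} → 0ℚ ≤ t → t ≤ 1ℚ → Near ρ a b → Near ρ c d →
                   Near ρ (comb t a c) (comb t b d)
  near-comb-same {ρ} {t = t} 0≤t t≤1 ab cd =
    subst (λ ρ → Near ρ _ _) (comb-same t ρ) (near-comb 0≤t t≤1 ab cd)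

  ∣∣≤⇒Near : ∀ {ρ a b} → ∣ a - b ∣ ≤ ρ → Near ρ a b
  ∣∣≤⇒Near {ρ} {a} {b} ≤ρ = near
    (linear (≤∣∣ (a - b) ⊕ ≤ρ) (solve 4 (λ a b v ρ → a :+ (v :+ ρ) := b :+ ρ :+ (a :- b :+ v)) refl a b ∣ a - b ∣ ρ))
    (linear (-≤∣∣ (a - b) ⊕ ≤ρ) (solve 4 (λ a b v ρ → b :+ (v :+ ρ) := a :+ ρ :+ (:- (a :- b) :+ v))
      refl a b ∣ a - b ∣ ρ))
    where
    ≤∣∣ : ∀ p → p ≤ ∣ p ∣
    ≤∣∣ p with ℚ.≤-total 0ℚ p
    ... | inj₁ 0≤p = ℚ.≤-reflexive (sym (ℚ.0≤p⇒∣p∣≡p 0≤p))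
    ... | inj₂ p≤0 = ℚ.≤-trans p≤0 (ℚ.0≤∣p∣ p)

    -≤∣∣ : ∀ p → - p ≤ ∣ p ∣
    -≤∣∣ p = subst (- p ≤_) (ℚ.∣-p∣≡∣p∣ p) (≤∣∣ (- p))

  Near⇒∣∣≤ : ∀ {ρ a b} → Near ρ a b → ∣ a - b ∣ ≤ ρ
  Near⇒∣∣≤ {ρ} {a} {b} (near l u) with ℚ.∣p∣≡p∨∣p∣≡-p (a - b)
  ... | inj₁ eq = subst (_≤ ρ) (sym eq) (linear l
    (solve 3 (λ a b ρ → a :- b :+ (b :+ ρ) := ρ :+ a) refl a b ρ))
  ... | inj₂ eq = subst (_≤ ρ) (sym eq) (linear u
    (solve 3 (λ a b ρ → :- (a :- b) :+ (a :+ ρ) := ρ :+ b) refl a b ρ))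

  ≤-limit : ∀ {p q} → (∀ n → p ≤ q + 2⁻ n) → p ≤ q
  ≤-limit = limit-≤ _ _

  near-limit : ∀ {ρ a b} → (∀ n → Near (ρ + 2⁻ n) a b) → Near ρ a b
  near-limit {ρ} {a} {b} n = near
    (≤-limit λ m → ℚ.≤-trans (below (n m)) (ℚ.≤-reflexive (sym (ℚ.+-assoc b ρ (2⁻ m)))))
    (≤-limit λ m → ℚ.≤-trans (above (n m)) (ℚ.≤-reflexive (sym (ℚ.+-assoc a ρ (2⁻ m)))))

  divide : ∀ {a V} → 0ℚ < a → 0ℚ ≤ V → ∃[ θ ] 0ℚ ≤ θ × θ * a ≡ V
  divide {a} {V} 0<a 0≤V = V * a⁻¹
    , 0≤* 0≤V (ℚ.<⇒≤ (ℚ.positive⁻¹ a⁻¹ {{ℚ.1/pos⇒pos a {{positive 0<a}}}}))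
    , (begin
      V * a⁻¹ * a    ≡⟨ ℚ.*-assoc V a⁻¹ a ⟩
      V * (a⁻¹ * a)  ≡⟨ cong (V *_) (ℚ.*-inverseˡ a {{a≢0}}) ⟩
      V * 1ℚ         ≡⟨ ℚ.*-identityʳ V ⟩
      V              ∎)
    where
    open ≡-Reasoning
    a≢0 = >-nonZero 0<a
    a⁻¹ = (1/ a) {{a≢0}}

  cancel-≤ : ∀ {a p q} → 0ℚ < a → p * a ≤ q * a → p ≤ q
  cancel-≤ {a} 0<a = ℚ.*-cancelʳ-≤-pos a {{positive 0<a}}

  scaled-archimedean : ∀ {X Y} → 0ℚ ≤ X → 0ℚ < Y → ∃[ n ] 2⁻ n * X ≤ Y
  scaled-archimedean {X} {Y} 0≤X 0<Y =
    -- Dividing by `1 + X` rather than by `X` covers the case that `X` is zero.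
    let 0<1+X     = ℚ.<-≤-trans (0<2⁻n 0) (linear 0≤X
                      (solve 1 (λ x → con 1ℚ :+ x := con 1ℚ :+ x :+ con 0ℚ) refl X))
        θ , 0≤θ , θ*≡Y = divide 0<1+X (ℚ.<⇒≤ 0<Y)
        0<θ = ℚ.≰⇒> λ θ≤0 → ℚ.<-irrefl refl (ℚ.<-≤-trans 0<Y (ℚ.≤-trans (ℚ.≤-reflexive (sym θ*≡Y))
                (ℚ.≤-trans (ℚ.*-monoʳ-≤-nonNeg (1ℚ + X) {{nonNegative (ℚ.<⇒≤ 0<1+X)}} θ≤0)
                           (ℚ.≤-reflexive (ℚ.*-zeroˡ (1ℚ + X))))))
        n , 2⁻n≤θ = archimedean θ 0<θ
    in n , linear (ℚ.*-monoʳ-≤-nonNeg X {{nonNegative 0≤X}} 2⁻n≤θ ⊕ 0≤θ)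
         (trans (solve 3 (λ x t X → x :* X :+ (t :* X :+ t) := t :* (con 1ℚ :+ X) :+ (x :* X :+ con 0ℚ)) refl
           (2⁻ n) θ X)
                (cong (_+ (2⁻ n * X + 0ℚ)) θ*≡Y))

  ¬≤⇒≥ : ∀ {p q} → ¬ p ≤ q → q ≤ p
  ¬≤⇒≥ p≰q = ℚ.<⇒≤ (ℚ.≰⇒> p≰q)

  Regular : (ℕ → ℚ) → Set
  Regular a = ∀ m n → Near (2⁻ m + 2⁻ n) (a m) (a n)

  -- The limit of the regular sequence a is within ρ of c.
  record Within (ρ : ℚ) (a : ℕ → ℚ) (c : ℚ) : Set where
    constructor within
    field
      near-at : ∀ n → Near (ρ + 2⁻ n) (a n) c

  open Within public

  within-trans : ∀ {ρ σ a b c} → Within ρ a b → Near σ b c → Within (ρ + σ) a c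
  within-trans {ρ} {σ} (within ab) bc = within λ n →
    near-resp (swap ρ σ (2⁻ n)) refl refl (near-trans (ab n) bc)
    where
    swap : ∀ p q r → p + r + q ≡ p + q + r
    swap = solve 3 (λ p q r → p :+ r :+ q := p :+ q :+ r) refl

  within-mono : ∀ {ρ σ a b} → ρ ≤ σ → Within ρ a b → Within σ a b
  within-mono ρ≤σ (within ab) = within λ n → near-mono (ℚ.+-monoˡ-≤ (2⁻ n) ρ≤σ) (ab n)

  within-near : ∀ {ρ σ a b c} → Within ρ a b → Within σ a c → Near (ρ + σ) b c
  within-near {ρ} {σ} (within ab) (within ac) = near-limit λ n →
    near-resp (eq ρ σ (2⁻ n)) refl refl (near-trans (near-sym (ab (suc n))) (ac (suc n)))
    where
    eq : ∀ p q r → p + ½ * r + (q + ½ * r) ≡ p + q + r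
    eq = solve 3 (λ p q r → p :+ con ½ :* r :+ (q :+ con ½ :* r) := p :+ q :+ r) refl

-- Sequences over finite alphabets and the fan theorem

module Fan where

  open import Data.List using (List; []; _∷_; cartesianProductWith)
  open import Data.List.Membership.Propositional using (_∈_)
  open import Data.List.Membership.Propositional.Properties using (∈-cartesianProductWith⁺)
  open import Data.List.Relation.Unary.Any using (here; there)
  open import Data.Nat using (ℕ; zero; suc; _≤_; _<_; _⊔_; s≤s; s<s)
  open import Data.Vec using (Vec; []; _∷_)

  infix 4 _≈[_]_
  _≈[_]_ : {D : Set} → (ℕ → D) → ℕ → (ℕ → D) → Set
  α ≈[ n ] β = ∀ m → m < n → α m ≡ β m

  ≈-refl : ∀ {D : Set} {α : ℕ → D} n → α ≈[ n ] α
  ≈-refl n m m<n = refl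

  ≈-sym : ∀ {D : Set} {α β : ℕ → D} {n} → α ≈[ n ] β → β ≈[ n ] α
  ≈-sym α≈β m m<n = sym (α≈β m m<n)

  ≈-trans : ∀ {D : Set} {α β γ : ℕ → D} {n} → α ≈[ n ] β → β ≈[ n ] γ → α ≈[ n ] γ
  ≈-trans α≈β β≈γ m m<n = trans (α≈β m m<n) (β≈γ m m<n)

  ≈-anti : ∀ {D : Set} {α β : ℕ → D} {m n} → m ≤ n → α ≈[ n ] β → α ≈[ m ] β
  ≈-anti m≤n α≈β i i<m = α≈β i (ℕ.<-≤-trans i<m m≤n)

  infixr 5 _◂_ _++ˢ_
  _◂_ : {D : Set} → D → (ℕ → D) → ℕ → D
  (d ◂ α) zero    = d
  (d ◂ α) (suc n) = α n

  ◂-cong : ∀ {D : Set} {d : D} {α β n} → α ≈[ n ] β → (d ◂ α) ≈[ suc n ] (d ◂ β)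
  ◂-cong α≈β zero    _         = refl
  ◂-cong α≈β (suc m) (s<s m<n) = α≈β m m<n

  ◂-head-tail : ∀ {D : Set} (α : ℕ → D) n → (α zero ◂ (α ∘ suc)) ≈[ n ] α
  ◂-head-tail α n zero    _ = refl
  ◂-head-tail α n (suc m) _ = refl

  _++ˢ_ : ∀ {D : Set} {n} → Vec D n → (ℕ → D) → ℕ → D
  []       ++ˢ α = α
  (d ∷ ds) ++ˢ α = d ◂ (ds ++ˢ α)

  prefix : {D : Set} → (n : ℕ) → (ℕ → D) → Vec D n
  prefix zero    α = []
  prefix (suc n) α = α zero ∷ prefix n (α ∘ suc)

  prefix-++ˢ : ∀ {D : Set} n (α β : ℕ → D) → (prefix n α ++ˢ β) ≈[ n ] α
  prefix-++ˢ (suc n) α β zero    _         = refl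
  prefix-++ˢ (suc n) α β (suc m) (s<s m<n) = prefix-++ˢ n (α ∘ suc) β m m<n

  record Finite (D : Set) : Set where
    field
      elements : List D
      complete : ∀ d → d ∈ elements

  open Finite public

  finite-× : ∀ {A B C : Set} (f : A → B → C) (g : C → A × B) →
             (∀ c → f (proj₁ (g c)) (proj₂ (g c)) ≡ c) → Finite A → Finite B → Finite C
  finite-× f g f∘g≡id FA FB = record
    { elements = cartesianProductWith f (elements FA) (elements FB)
    ; complete = λ c → subst (_∈ _) (f∘g≡id c)
        (∈-cartesianProductWith⁺ f (complete FA (proj₁ (g c))) (complete FB (proj₂ (g c))))
    }

  finite-pair : ∀ {A B : Set} → Finite A → Finite B → Finite (A × B)
  finite-pair = finite-× _,_ (λ p → p) (λ _ → refl)

  finite-vec : ∀ {D : Set} → Finite D → ∀ n → Finite (Vec D n)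
  finite-vec FD zero    = record { elements = [] ∷ [] ; complete = λ { [] → here refl } }
  finite-vec FD (suc n) =
    finite-× _∷_ (λ { (d ∷ ds) → d , ds }) (λ { (d ∷ ds) → refl }) FD (finite-vec FD n)

  common-bound : ∀ {D : Set} → Finite D → (Q : ℕ → D → Set) →
                 (∀ {m n d} → m ≤ n → Q m d → Q n d) →
                 (∀ d → ∃[ n ] Q n d) → ∃[ n ] ∀ d → Q n d
  common-bound FD Q mono q = let n , Qn = go (elements FD) in n , λ d → Qn d (complete FD d)
    where
    go : ∀ ds → ∃[ n ] ∀ d → d ∈ ds → Q n d
    go []       = 0 , λ d ()
    go (d ∷ ds) = let m , Qm = q d
                      n , Qn = go ds
                  in m ⊔ n , λ { _ (here refl) → mono (ℕ.m≤m⊔n m n) Qm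
                               ; e (there e∈)  → mono (ℕ.m≤n⊔m m n) (Qn e e∈) }

  module Classical (em : ExcludedMiddle 0ℓ) where

    ¬∀⇒∃¬ : ∀ {A : Set} {P : A → Set} → ¬ (∀ x → P x) → ∃[ x ] ¬ P x
    ¬∀⇒∃¬ {A} {P} ¬∀ with em {∃[ x ] ¬ P x}
    ... | yes ∃¬ = ∃¬
    ... | no ¬∃¬ = contradiction ∀P ¬∀
      where
      ∀P : ∀ x → P x
      ∀P x with em {P x}
      ... | yes Px = Px
      ... | no ¬Px = contradiction (x , ¬Px) ¬∃¬

    by-contradiction : ∀ {A : Set} → ¬ ¬ A → A
    by-contradiction {A} ¬¬A with em {A}
    ... | yes a = a
    ... | no ¬A = contradiction ¬A ¬¬A

    module _ {D : Set} (FD : Finite D) where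

      private
        Uniform : (ℕ → (ℕ → D) → Set) → Set
        Uniform P = ∃[ n ] ∀ α → P n α

        Monotone Local : (ℕ → (ℕ → D) → Set) → Set
        Monotone P = ∀ {m n α} → m ≤ n → P m α → P n α
        Local P    = ∀ {n α β} → α ≈[ n ] β → P n α → P n β

        after : D → (ℕ → (ℕ → D) → Set) → ℕ → (ℕ → D) → Set
        after d P n α = P (suc n) (d ◂ α)

        -- Were `P` uniform below every child, the maximum of these finitely many bounds would make
        -- it uniform at the root.
        some-child : ∀ P → Monotone P → Local P → ¬ Uniform P → ∃[ d ] ¬ Uniform (after d P)
        some-child P mono local ¬unif = ¬∀⇒∃¬ λ all →
          let n , Pn = common-bound FD (λ n d → ∀ α → after d P n α)
                         (λ m≤n Pm α → mono (s≤s m≤n) (Pm α)) all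
          in ¬unif (suc n , λ α → local (◂-head-tail α (suc n)) (Pn (α zero) (α ∘ suc)))

        after-mono : ∀ {P d} → Monotone P → Monotone (after d P)
        after-mono mono m≤n = mono (s≤s m≤n)

        after-local : ∀ {P d} → Local P → Local (after d P)
        after-local local α≈β = local (◂-cong α≈β)

        branch : ∀ P → Monotone P → Local P → ¬ Uniform P → ℕ → D
        branch P mono local ¬unif zero    = proj₁ (some-child P mono local ¬unif)
        branch P mono local ¬unif (suc n) =
          let d , ¬unif′ = some-child P mono local ¬unif
          in branch (after d P) (after-mono {P} {d} mono) (after-local {P} {d} local) ¬unif′ n

        branch-avoids : ∀ n P (mono : Monotone P) (local : Local P) (¬unif : ¬ Uniform P) →
                        ¬ P n (branch P mono local ¬unif)
        -- By locality `P 0` ignores the path, so a single path satisfying it already gives the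
        -- uniform bound 0.
        branch-avoids zero    P mono local ¬unif P0 =
          ¬unif (0 , λ α → local (λ _ ()) P0)
        branch-avoids (suc n) P mono local ¬unif Psn =
          let d , ¬unif′ = some-child P mono local ¬unif
          in branch-avoids n (after d P) (after-mono {P} {d} mono) (after-local {P} {d} local) ¬unif′
               (local (≈-sym (◂-head-tail _ (suc n))) Psn)

      -- Non-uniformity is passed on to a child at every level, and the branch so obtained never
      -- meets the bar.
      fan : (P : ℕ → (ℕ → D) → Set) → (∀ {m n α} → m ≤ n → P m α → P n α) →
            (∀ {n α β} → α ≈[ n ] β → P n α → P n β) →
            (∀ α → ∃[ n ] P n α) → ∃[ n ] ∀ α → P n α
      fan P mono local bar = by-contradiction λ ¬unif →
        let n , Pn = bar (branch P mono local ¬unif)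
        in branch-avoids n P mono local ¬unif Pn

-- Signed-digit expansions of points of the cube

module DigitPaths where

  open import Data.Fin using (Fin)
  open import Data.List using ([]; _∷_)
  open import Data.List.Relation.Unary.Any using (here; there)
  open import Data.Nat as ℕ using (ℕ; zero; suc)
  open import Data.Rational hiding (_/_)
  open import Data.Vec using (Vec; lookup; tabulate)
  open import Data.Vec.Properties using (lookup∘tabulate; tabulate∘lookup; tabulate-cong)
  open import Defs using (2⁻_; half+half)
  open Rationals
  open Fan

  -- The redundancy is essential: a prefix of length n with centre c can be continued to every real
  -- within 2⁻ⁿ of c, so the intervals of neighbouring prefixes overlap.
  data Digit : Set where
    minus none plus : Digit

  val : Digit → ℚ
  val minus = - 1ℚ
  val none  = 0ℚ
  val plus  = 1ℚ

  finite-digit : Finite Digit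
  finite-digit = record
    { elements = minus ∷ none ∷ plus ∷ []
    ; complete = λ { minus → here refl ; none → there (here refl) ; plus → there (there (here refl)) }
    }

  -- Partial sums of c + Σ val (δ i) 2⁻⁽ᵐ⁺ⁱ⁺¹⁾.
  centerFrom : ℚ → ℕ → (ℕ → Digit) → ℕ → ℚ
  centerFrom c m δ zero    = c
  centerFrom c m δ (suc n) = centerFrom (c + val (δ zero) * 2⁻ suc m) (suc m) (δ ∘ suc) n

  center : (ℕ → Digit) → ℕ → ℚ
  center = centerFrom ½ 0

  centerFrom-cong : ∀ {c m δ ε} n → δ ≈[ n ] ε → centerFrom c m δ n ≡ centerFrom c m ε n
  centerFrom-cong zero    δ≈ε = refl
  centerFrom-cong {c} {m} {δ} {ε} (suc n) δ≈ε
    rewrite δ≈ε 0 ℕ.z<s = centerFrom-cong n (λ i i<n → δ≈ε (suc i) (ℕ.s<s i<n))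

  center-cong : ∀ {δ ε} n → δ ≈[ n ] ε → center δ n ≡ center ε n
  center-cong n = centerFrom-cong n

  -- Here ρ is the geometric sum 2⁻⁽ᵐ⁺¹⁾ + ... + 2⁻⁽ᵐ⁺ⁿ⁾, specified without subtraction.
  centerFrom-near : ∀ c m δ n → ∃[ ρ ] Near ρ c (centerFrom c m δ n) × ρ + 2⁻ (m ℕ.+ n) ≡ 2⁻ m
  centerFrom-near c m δ zero rewrite ℕ.+-identityʳ m = 0ℚ , near-refl ℚ.≤-refl , ℚ.+-identityˡ (2⁻ m)
  centerFrom-near c m δ (suc n) rewrite ℕ.+-suc m n =
    let ρ , nr , eq = centerFrom-near (c + val (δ 0) * 2⁻ suc m) (suc m) (δ ∘ suc) n
    in 2⁻ suc m + ρ , near-trans (step (δ 0)) nr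
     , trans (ℚ.+-assoc (2⁻ suc m) ρ _) (trans (cong (2⁻ suc m +_) eq) (half+half (2⁻ m)))
    where
    h = 2⁻ suc m
    step : ∀ d → Near h c (c + val d * h)
    step minus = near
      (ℚ.≤-reflexive (solve 2 (λ c h → c := c :+ con (- 1ℚ) :* h :+ h) refl c h))
      (linear (0≤2⁻ (suc m) ⊕ 0≤2⁻ (suc m))
        (solve 2 (λ c h → c :+ con (- 1ℚ) :* h :+ (h :+ h) := c :+ h :+ (con 0ℚ :+ con 0ℚ)) refl c h))
    step none  = near-≡ (0≤2⁻ (suc m)) (solve 2 (λ c h → c := c :+ con 0ℚ :* h) refl c h)
    step plus  = near
      (linear (0≤2⁻ (suc m) ⊕ 0≤2⁻ (suc m))
        (solve 2 (λ c h → c :+ (h :+ h) := c :+ con 1ℚ :* h :+ h :+ (con 0ℚ :+ con 0ℚ)) refl c h))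
      (ℚ.≤-reflexive (solve 2 (λ c h → c :+ con 1ℚ :* h := c :+ h) refl c h))

  drop : ∀ {D : Set} → ℕ → (ℕ → D) → ℕ → D
  drop zero    δ = δ
  drop (suc n) δ = drop n (δ ∘ suc)

  centerFrom-drop : ∀ c m δ n n′ → centerFrom c m δ (n ℕ.+ n′) ≡
                    centerFrom (centerFrom c m δ n) (m ℕ.+ n) (drop n δ) n′
  centerFrom-drop c m δ zero    n′ rewrite ℕ.+-identityʳ m = refl
  centerFrom-drop c m δ (suc n) n′ rewrite ℕ.+-suc m n = centerFrom-drop _ (suc m) (δ ∘ suc) n n′

  center-near : ∀ δ {m n} → m ℕ.≤ n → Near (2⁻ m) (center δ m) (center δ n)
  center-near δ {m} {n} m≤n with ℕ.m≤n⇒∃[o]m+o≡n m≤n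
  ... | o , refl =
    let ρ , nr , eq = centerFrom-near (center δ m) m (drop m δ) o
    in subst (Near (2⁻ m) (center δ m)) (sym (centerFrom-drop ½ 0 δ m o))
         (near-mono (linear (0≤2⁻ (m ℕ.+ o))
           (trans (cong (ρ +_) (refl {x = 2⁻ (m ℕ.+ o)})) (trans eq (sym (ℚ.+-identityʳ (2⁻ m)))))) nr)

  center-regular : ∀ δ → Regular (center δ)
  center-regular δ m n with ℕ.≤-total m n
  ... | inj₁ m≤n = near-mono (linear (0≤2⁻ n)
    (solve 2 (λ x y → x :+ y := x :+ y :+ con 0ℚ) refl (2⁻ m) (2⁻ n))) (center-near δ m≤n)
  ... | inj₂ n≤m = near-mono (linear (0≤2⁻ m)
    (solve 2 (λ x y → y :+ x := x :+ y :+ con 0ℚ) refl (2⁻ m) (2⁻ n))) (near-sym (center-near δ n≤m))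

  center-within : ∀ δ n → Within (2⁻ n) (center δ) (center δ n)
  center-within δ n = within λ m → near-resp (ℚ.+-comm (2⁻ m) (2⁻ n)) refl refl (center-regular δ m n)

  -- For regular sequences a comparison at equal indices already determines the limits.
  SameLimit : (a b : ℕ → ℚ) → Set
  SameLimit a b = ∀ n → Near (2⁻ n + 2⁻ n) (a n) (b n)

  same-sym : ∀ {a b} → SameLimit a b → SameLimit b a
  same-sym ab n = near-sym (ab n)

  within-same : ∀ {ρ a b c} → Regular a → SameLimit a b → Within ρ b c → Within ρ a c
  within-same {ρ} {a} {b} {c} reg ab (within bc) = within λ m → near-limit λ n →
    let i = suc (suc n)
    in near-resp (eq ρ (2⁻ m) (2⁻ n)) refl refl
         (near-trans (reg m i) (near-trans (ab i) (bc i)))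
    where
    eq : ∀ ρ x y → (x + ½ * (½ * y)) + ((½ * (½ * y) + ½ * (½ * y)) + (ρ + ½ * (½ * y))) ≡ ρ + x + y
    eq = solve 3 (λ ρ x y → let q = con ½ :* (con ½ :* y) in
           (x :+ q) :+ ((q :+ q) :+ (ρ :+ q)) := ρ :+ x :+ y) refl

  centerFrom-++ : ∀ c m {n} δ (τ : ℕ → Digit) n′ →
    centerFrom c m (prefix n δ ++ˢ τ) (n ℕ.+ n′) ≡ centerFrom (centerFrom c m δ n) (m ℕ.+ n) τ n′
  centerFrom-++ c m {zero}  δ τ n′ rewrite ℕ.+-identityʳ m = refl
  centerFrom-++ c m {suc n} δ τ n′ rewrite ℕ.+-suc m n = centerFrom-++ _ (suc m) (δ ∘ suc) τ n′

  limit-unique : ∀ {a} ε n → (∀ m → n ℕ.< m → Within (2⁻ m) a (center ε m)) → SameLimit a (center ε)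
  limit-unique {a} ε n w m = near-limit λ j →
    let i = suc n ℕ.⊔ (suc j ℕ.⊔ m)
    in estimate j i (2⁻-anti {suc j} {i} (ℕ.≤-trans (ℕ.m≤m⊔n (suc j) m) (ℕ.m≤n⊔m (suc n) (suc j ℕ.⊔ m))))
         (near-at (w i (ℕ.m≤m⊔n (suc n) (suc j ℕ.⊔ m))) m)
         (center-near ε {m} {i} (ℕ.≤-trans (ℕ.m≤n⊔m (suc j) m) (ℕ.m≤n⊔m (suc n) (suc j ℕ.⊔ m))))
    where
    estimate : ∀ j i → 2⁻ i ≤ 2⁻ suc j → Near (2⁻ i + 2⁻ m) (a m) (center ε i) →
               Near (2⁻ m) (center ε m) (center ε i) → Near (2⁻ m + 2⁻ m + 2⁻ j) (a m) (center ε m)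
    estimate j i i≤ ai mi = near-mono
      (linear (i≤ ⊕ scale-≤ 0≤½ (0≤2⁻ j))
        (solve 3 (λ x y z → y :+ x :+ x :+ (con ½ :* z :+ con ½ :* z) := x :+ x :+ z :+ (y :+ con ½ :* con 0ℚ))
          refl (2⁻ m) (2⁻ i) (2⁻ j)))
      (near-trans ai (near-sym mi))

  Path : ℕ → Set
  Path k = ℕ → Vec Digit k

  coord : ∀ {k} → Path k → Fin k → ℕ → Digit
  coord α i n = lookup (α n) i

  point : ∀ {k} → Path k → ℕ → Fin k → ℚ
  point α n i = center (coord α i) n

  coord-cong : ∀ {k} {α β : Path k} {n} i → α ≈[ n ] β → coord α i ≈[ n ] coord β i
  coord-cong i α≈β m m<n = cong (λ ds → lookup ds i) (α≈β m m<n)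

  point-cong : ∀ {k} {α β : Path k} n → α ≈[ n ] β → ∀ i → point α n i ≡ point β n i
  point-cong n α≈β i = center-cong n (coord-cong i α≈β)

  zip : ∀ {k} → (Fin k → ℕ → Digit) → Path k
  zip δ n = tabulate λ i → δ i n

  coord-zip : ∀ {k} (δ : Fin k → ℕ → Digit) i n → coord (zip δ) i n ≡ δ i n
  coord-zip δ i n = lookup∘tabulate (λ j → δ j n) i

  module Refinement (em : ExcludedMiddle 0ℓ) where
    open Classical em

    private
      -- One index where the inequality fails puts the limit below `b`, and regularity carries this
      -- to all indices.
      not-above : ∀ {a b} → Regular a → ¬ (∀ n → b ≤ a n + 2⁻ n) → ∀ m → a m ≤ b + 2⁻ m
      not-above {a} {b} reg ¬≥ m =
        let n , b≰ = ¬∀⇒∃¬ ¬≥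
        in linear (¬≤⇒≥ b≰ ⊕ below (reg m n))
             (solve 5 (λ am an b x y → am :+ (b :+ (an :+ (x :+ y))) := b :+ x :+ (an :+ y :+ am))
                refl (a m) (a n) b (2⁻ m) (2⁻ n))

      not-below : ∀ {a b} → Regular a → ¬ (∀ n → a n ≤ b + 2⁻ n) → ∀ m → b ≤ a m + 2⁻ m
      not-below {a} {b} reg ¬≤ m =
        let n , ≰b = ¬∀⇒∃¬ ¬≤
        in linear (¬≤⇒≥ ≰b ⊕ above (reg m n))
             (solve 5 (λ am an b x y → b :+ (an :+ (am :+ (x :+ y))) := am :+ x :+ (b :+ y :+ an))
                refl (a m) (a n) b (2⁻ m) (2⁻ n))

    -- The limit is compared with c + h/2 and c - h/2. After a move by h past one of these, the
    -- error is at most h/2 on the near side and ρ - h on the far side; without a move it is at most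
    -- h/2. The two hypotheses bound both by ρ′.
    refine : ∀ {a ρ ρ′ h c} → Regular a → Within ρ a c → ρ ≤ ρ′ + h → ½ * h ≤ ρ′ →
             ∃[ d ] Within ρ′ a (c + val d * h)
    refine {a} {ρ} {ρ′} {h} {c} reg w ρ≤ h≤
      with em {∀ n → c + ½ * h ≤ a n + 2⁻ n} | em {∀ n → a n ≤ c - ½ * h + 2⁻ n}
    ... | yes up | _ = plus , within λ n → near
      (linear (below (near-at w n) ⊕ ρ≤)
        (solve 6 (λ a c h ρ ρ′ x → a :+ (c :+ (ρ :+ x) :+ (ρ′ :+ h)) := c :+ con 1ℚ :* h :+ (ρ′ :+ x) :+ (a :+ ρ))
          refl (a n) c h ρ ρ′ (2⁻ n)))
      (linear (up n ⊕ h≤)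
        (solve 5 (λ a c h ρ′ x → c :+ con 1ℚ :* h :+ (a :+ x :+ ρ′) :=
          a :+ (ρ′ :+ x) :+ (c :+ con ½ :* h :+ con ½ :* h))
          refl (a n) c h ρ′ (2⁻ n)))
    ... | no _ | yes down = minus , within λ n → near
      (linear (down n ⊕ h≤)
        (solve 5 (λ a c h ρ′ x → a :+ (c :- con ½ :* h :+ x :+ ρ′) :=
          c :+ con (- 1ℚ) :* h :+ (ρ′ :+ x) :+ (a :+ con ½ :* h))
          refl (a n) c h ρ′ (2⁻ n)))
      (linear (above (near-at w n) ⊕ ρ≤)
        (solve 6 (λ a c h ρ ρ′ x → c :+ con (- 1ℚ) :* h :+ (a :+ (ρ :+ x) :+ (ρ′ :+ h)) :=
          a :+ (ρ′ :+ x) :+ (c :+ ρ))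
          refl (a n) c h ρ ρ′ (2⁻ n)))
    ... | no ¬up | no ¬down = none , within λ n → near
      (linear (not-above {b = c + ½ * h} reg ¬up n ⊕ h≤)
        (solve 5 (λ a c h ρ′ x → a :+ (c :+ con ½ :* h :+ x :+ ρ′) :=
          c :+ con 0ℚ :* h :+ (ρ′ :+ x) :+ (a :+ con ½ :* h))
          refl (a n) c h ρ′ (2⁻ n)))
      (linear (not-below {b = c - ½ * h} reg ¬down n ⊕ h≤)
        (solve 5 (λ a c h ρ′ x → c :+ con 0ℚ :* h :+ (a :+ x :+ ρ′) :=
          a :+ (ρ′ :+ x) :+ (c :- con ½ :* h :+ con ½ :* h))
          refl (a n) c h ρ′ (2⁻ n)))

    module _ {κ : ℚ} (½≤κ : ½ ≤ κ) (κ≤1 : κ ≤ 1ℚ) {a : ℕ → ℚ} (reg : Regular a) where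

      private
        Start : ℕ → ℚ → Set
        Start m c = ∃[ ρ ] Within ρ a c × ρ ≤ κ * 2⁻ suc m + 2⁻ suc m

        next : ∀ {m c} → Start m c → ∃[ d ] Within (κ * 2⁻ suc m) a (c + val d * 2⁻ suc m)
        next {m} (ρ , w , ρ≤) = refine reg w ρ≤
          (ℚ.*-monoʳ-≤-nonNeg (2⁻ suc m) {{nonNegative (0≤2⁻ (suc m))}} ½≤κ)

        start : ∀ m {c} → Within (κ * 2⁻ m) a c → Start m c
        start m w = κ * 2⁻ m , w , linear (scale-≤ (0≤2⁻ (suc m)) κ≤1)
          (solve 2 (λ κ x → κ :* x :+ con ½ :* x :* con 1ℚ := κ :* (con ½ :* x) :+ con ½ :* x :+ con ½ :* x :* κ)
            refl κ (2⁻ m))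

        tail : ∀ m {c} → Start m c → ℕ → Digit
        tail m s zero    = proj₁ (next {m} s)
        tail m s (suc n) = tail (suc m) (start (suc m) (proj₂ (next {m} s))) n

        tail-within : ∀ m {c} (s : Start m c) n →
                      Within (κ * 2⁻ (m ℕ.+ suc n)) a (centerFrom c m (tail m s) (suc n))
        tail-within m {c} s zero = subst (λ i → Within (κ * 2⁻ i) a (c + val (proj₁ (next {m} s)) * 2⁻ suc m))
          (ℕ.+-comm 1 m) (proj₂ (next {m} s))
        tail-within m {c} s (suc n) = subst (λ i → Within (κ * 2⁻ i) a (centerFrom c m (tail m s) (suc (suc n))))
          (sym (ℕ.+-suc m (suc n))) (tail-within (suc m) (start (suc m) (proj₂ (next {m} s))) n)

      -- The parameter κ trades reach for margin. With κ = 1 the path may start anywhere within 2⁻ⁿ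
      -- of the centre. With κ = ½, the least value that steps of this size allow, the start must be
      -- within ¾ · 2⁻ⁿ, but all later centres are met within half of their radius.
      follow : ∀ n δ {ρ} → Within ρ a (center δ n) → ρ ≤ κ * 2⁻ suc n + 2⁻ suc n →
               ∃[ ε ] ε ≈[ n ] δ × SameLimit a (center ε) ×
                      (∀ m → n ℕ.< m → Within (κ * 2⁻ m) a (center ε m))
      follow n δ w ρ≤ = ε , prefix-++ˢ n δ _ , same , later
        where
        s : Start n (center δ n)
        s = _ , w , ρ≤

        ε : ℕ → Digit
        ε = prefix n δ ++ˢ tail n s

        later : ∀ m → n ℕ.< m → Within (κ * 2⁻ m) a (center ε m)
        later m n<m with ℕ.m≤n⇒∃[o]m+o≡n n<m
        ... | o , refl = subst (λ m → Within (κ * 2⁻ m) a (center ε m)) (ℕ.+-suc n o)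
          (subst (Within (κ * 2⁻ (n ℕ.+ suc o)) a) (sym (centerFrom-++ ½ 0 {n} δ (tail n s) (suc o)))
            (tail-within n s o))

        same : SameLimit a (center ε)
        same = limit-unique ε n λ m n<m → within-mono (ℚ.≤-trans
          (ℚ.*-monoʳ-≤-nonNeg (2⁻ m) {{nonNegative (0≤2⁻ m)}} κ≤1) (ℚ.≤-reflexive (ℚ.*-identityˡ (2⁻ m))))
            (later m n<m)

    followAll : ∀ {κ ρ} → ½ ≤ κ → κ ≤ 1ℚ → ∀ {k} (a : Fin k → ℕ → ℚ) → (∀ i → Regular (a i)) →
                ∀ n (α : Path k) → (∀ i → Within ρ (a i) (point α n i)) → ρ ≤ κ * 2⁻ suc n + 2⁻ suc n →
                ∃[ β ] β ≈[ n ] α × (∀ i → SameLimit (a i) (λ m → point β m i)) ×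
                       (∀ m → n ℕ.< m → ∀ i → Within (κ * 2⁻ m) (a i) (point β m i))
    followAll {κ} {ρ} ½≤κ κ≤1 {k} a reg n α w ρ≤ = zip δ , agree
      , (λ i m → subst (Near _ (a i m)) (center-cong m λ j _ → sym (coord-zip δ i j))
          (proj₁ (proj₂ (proj₂ (f i))) m))
      , (λ m n<m i → subst (Within (κ * 2⁻ m) (a i)) (center-cong m λ j _ → sym (coord-zip δ i j))
                       (proj₂ (proj₂ (proj₂ (f i))) m n<m))
      where
      f : ∀ i → ∃[ ε ] ε ≈[ n ] coord α i × SameLimit (a i) (center ε) ×
                      (∀ m → n ℕ.< m → Within (κ * 2⁻ m) (a i) (center ε m))
      f i = follow ½≤κ κ≤1 (reg i) n (coord α i) (w i) ρ≤

      δ : Fin k → ℕ → Digit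
      δ i = proj₁ (f i)

      agree : zip δ ≈[ n ] α
      agree m m<n = trans (tabulate-cong λ i → proj₁ (proj₂ (f i)) m m<n) (tabulate∘lookup (α m))

-- Parallelepipeds in convex sets and Newton's iteration

module Boxes where

  open import Algebra.Bundles using (CommutativeRing)
  open import Data.Bool using (if_then_else_)
  open import Data.Fin using (Fin; zero; suc; _≟_)
  open import Data.Nat as ℕ using (ℕ; zero; suc)
  open import Data.Rational hiding (_/_; _≟_)
  open import Relation.Nullary using (does)
  open import Relation.Nullary.Decidable using (dec-true; dec-false)
  open import Algebra.Properties.Semiring.Sum (CommutativeRing.semiring ℚ.+-*-commutativeRing)
    using (sum; *-distribˡ-sum; sum-cong-≗; ∑-distrib-+)
  open import Defs using (2⁻_)
  open Rationals

  card : ℕ → ℚ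
  card n = sum {n} (λ _ → 1ℚ)

  0≤card : ∀ n → 0ℚ ≤ card n
  0≤card zero    = ℚ.≤-refl
  0≤card (suc n) = ℚ.≤-trans 0≤1 (linear (0≤card n)
    (solve 1 (λ c → con 1ℚ :+ c := con 1ℚ :+ c :+ con 0ℚ) refl (card n)))

  sum-const : ∀ n c → sum {n} (λ _ → c) ≡ c * card n
  sum-const n c = trans (sum-cong-≗ {n} λ _ → sym (ℚ.*-identityʳ c)) (sym (*-distribˡ-sum c (λ (_ : Fin n) → 1ℚ)))

  near-sum : ∀ {n ρ} {f g : Fin n → ℚ} → (∀ a → Near (ρ a) (f a) (g a)) → Near (sum ρ) (sum f) (sum g)
  near-sum {zero}  fg = near-refl ℚ.≤-refl
  near-sum {suc n} fg = near-+ (fg zero) (near-sum (fg ∘ suc))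

  near-product : ∀ {Q η q v w} → 0ℚ ≤ η → Near Q q 0ℚ → Near η v w → Near (Q * η) (q * v) (q * w)
  near-product {Q} {η} {q} {v} {w} 0≤η q≈0 vw with ℚ.≤-total 0ℚ q
  ... | inj₁ 0≤q = near-mono
    (ℚ.*-monoʳ-≤-nonNeg η {{nonNegative 0≤η}} (ℚ.≤-trans (below q≈0) (ℚ.≤-reflexive (ℚ.+-identityˡ Q))))
    (near-* q 0≤q vw)
  ... | inj₂ q≤0 = near-mono
    (ℚ.*-monoʳ-≤-nonNeg η {{nonNegative 0≤η}} { - q} {Q} (linear (above q≈0)
      (solve 2 (λ q Q → :- q :+ (q :+ Q) := Q :+ con 0ℚ) refl q Q)))
    (near (linear (above n) (flip q v w η)) (linear (below n) (flip q w v η)))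
    where
    n = near-* (- q) (linear q≤0 (solve 1 (λ q → con 0ℚ :+ con 0ℚ := :- q :+ q) refl q)) vw
    flip : ∀ q v w η → q * v + (- q * v + - q * η) ≡ q * w + - q * η + - q * w
    flip = solve 4 (λ q v w η → q :* v :+ (:- q :* v :+ :- q :* η) := q :* w :+ :- q :* η :+ :- q :* w) refl

  δ[_,_] : ∀ {n} → Fin n → Fin n → ℚ
  δ[ a , b ] = if does (a ≟ b) then 1ℚ else 0ℚ

  δ-same : ∀ {n} (a : Fin n) → δ[ a , a ] ≡ 1ℚ
  δ-same a = cong (if_then 1ℚ else 0ℚ) (dec-true (a ≟ a) refl)

  δ-different : ∀ {n} {a b : Fin n} → a ≢ b → δ[ a , b ] ≡ 0ℚ
  δ-different {a = a} {b} a≢b = cong (if_then 1ℚ else 0ℚ) (dec-false (a ≟ b) a≢b)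

  sum-δ : ∀ {n} (r : Fin n → ℚ) b → sum (λ a → r a * δ[ a , b ]) ≡ r b
  sum-δ {suc n} r zero = trans (cong₂ _+_ (ℚ.*-identityʳ (r zero)) zeros) (ℚ.+-identityʳ (r zero))
    where
    zeros : sum (λ a → r (suc a) * 0ℚ) ≡ 0ℚ
    zeros = trans (sum-cong-≗ {n} λ a → ℚ.*-zeroʳ (r (suc a))) (trans (sum-const n 0ℚ) (ℚ.*-zeroˡ (card n)))
  sum-δ {suc n} r (suc b) = trans (cong₂ _+_ (ℚ.*-zeroʳ (r zero)) (sum-δ (r ∘ suc) b)) (ℚ.+-identityˡ _)

  module _ {k : ℕ} (S : (Fin k → ℚ) → Set)
           (S-resp : ∀ {x y} → x ≗ y → S x → S y)
           (S-convex : ∀ {x y t} → 0ℚ ≤ t → t ≤ 1ℚ → S x → S y → S (λ i → comb t (x i) (y i)))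
           where

    -- The combination with weight λ′ at every `s a` and the remaining weight at `y`: a small λ′
    -- keeps it near `y`.
    spread : ∀ {n} → ℚ → (Fin k → ℚ) → (Fin n → Fin k → ℚ) → Fin k → ℚ
    spread λ′ y s i = y i + λ′ * sum (λ a → s a i - y i)

    -- The points are added one at a time. If the new one has weight λ, the combination of the
    -- others is multiplied by 1 - λ, so inside it their weights must be μ = λ / (1 - λ).
    spread∈S : ∀ n {y λ′} {s : Fin n → Fin k → ℚ} → S y → (∀ a → S (s a)) →
               0ℚ ≤ λ′ → card n * λ′ < 1ℚ → S (spread λ′ y s)
    spread∈S zero    {y} {λ′} Sy Ss 0≤λ nλ<1 =
      S-resp (λ i → sym (trans (cong (y i +_) (ℚ.*-zeroʳ λ′)) (ℚ.+-identityʳ (y i)))) Sy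
    spread∈S (suc n) {y} {λ′} {s} Sy Ss 0≤λ nλ<1 =
      S-resp (λ i → trans
          (solve 5 (λ l m s y z → l :* s :+ (con 1ℚ :- l) :* (y :+ m :* z) :=
            y :+ l :* (s :- y) :+ m :* (con 1ℚ :- l) :* z)
            refl λ′ μ (s zero i) (y i) (sum λ a → s (suc a) i - y i))
          (trans (cong (λ m → y i + λ′ * (s zero i - y i) + m * sum (λ a → s (suc a) i - y i)) μ*≡λ)
            (solve 4 (λ l s y z → y :+ l :* (s :- y) :+ l :* z := y :+ l :* (s :- y :+ z))
              refl λ′ (s zero i) (y i) (sum λ a → s (suc a) i - y i))))
        (S-convex 0≤λ (ℚ.<⇒≤ λ<1) (Ss zero)
          (spread∈S n {s = s ∘ suc} Sy (Ss ∘ suc) 0≤μ nμ<1))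
      where
      cλ = card n * λ′

      0≤cλ : 0ℚ ≤ cλ
      0≤cλ = 0≤* (0≤card n) 0≤λ

      λ<1 : λ′ < 1ℚ
      λ<1 = ℚ.≤-<-trans (linear 0≤cλ (solve 2 (λ c l → l :+ c :* l := (con 1ℚ :+ c) :* l :+ con 0ℚ) refl
        (card n) λ′)) nλ<1

      cλ<1-λ : cλ < 1ℚ - λ′
      cλ<1-λ = subst (_< 1ℚ - λ′) (solve 2 (λ c l → (con 1ℚ :+ c) :* l :- l := c :* l) refl (card n) λ′)
                 (ℚ.+-monoˡ-< (- λ′) nλ<1)

      0<1-λ : 0ℚ < 1ℚ - λ′
      0<1-λ = ℚ.≤-<-trans 0≤cλ cλ<1-λ

      μ = proj₁ (divide 0<1-λ 0≤λ)
      0≤μ = proj₁ (proj₂ (divide 0<1-λ 0≤λ))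
      μ*≡λ = proj₂ (proj₂ (divide 0<1-λ 0≤λ))

      nμ<1 : card n * μ < 1ℚ
      nμ<1 = ℚ.*-cancelʳ-<-nonNeg (1ℚ - λ′) {{nonNegative (ℚ.<⇒≤ 0<1-λ)}}
        (subst₂ _<_ (trans (cong (card n *_) (sym μ*≡λ)) (sym (ℚ.*-assoc (card n) μ (1ℚ - λ′))))
          (sym (ℚ.*-identityˡ (1ℚ - λ′))) cλ<1-λ)

    -- Newton's iteration, in a parallelepiped whose edges from x a to x a + v a
    -- nearly have the direction of the coordinates ι a: dominant makes each step halve the error.
    module _ {n} (ι : Fin n → Fin k) {y V η λ′ R} {x v : Fin n → Fin k → ℚ}
             (Sy : S y) (Sx : ∀ a → S (x a)) (Sxv : ∀ a → S (λ i → x a i + v a i))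
             (0<V : 0ℚ < V) (0≤η : 0ℚ ≤ η) (diagonal : ∀ a b → Near η (v a (ι b)) (V * δ[ a , b ]))
             (dominant : card n * η ≤ ½ * V) (0<λ : 0ℚ < λ′) (small : card n * λ′ < 1ℚ)
             (bounded : ∀ {x y} → S x → S y → ∀ i → Near R (x i) (y i))
             where

      private
        0≤V = ℚ.<⇒≤ 0<V
        0≤λ = ℚ.<⇒≤ 0<λ
        L   = λ′ * V

        0<L : 0ℚ < L
        0<L = 0<* 0<λ 0<V

        θ = proj₁ (divide 0<L 0≤1)
        θL≡1 : θ * L ≡ 1ℚ
        θL≡1 = proj₂ (proj₂ (divide 0<L 0≤1))
        0≤θ : 0ℚ ≤ θ
        0≤θ = proj₁ (proj₂ (divide 0<L 0≤1))

        vertex : (Fin n → ℚ) → Fin n → Fin k → ℚ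
        vertex t a i = comb (t a) (x a i + v a i) (x a i)

        at : (Fin n → ℚ) → Fin k → ℚ
        at t = spread λ′ y (vertex t)

        Unit : ℚ → Set
        Unit t = 0ℚ ≤ t × t ≤ 1ℚ

        vertex∈S : ∀ t → (∀ a → Unit (t a)) → ∀ a → S (vertex t a)
        vertex∈S t unit a = S-convex (proj₁ (unit a)) (proj₂ (unit a)) (Sxv a) (Sx a)

        at∈S : ∀ t → (∀ a → Unit (t a)) → S (at t)
        at∈S t unit = spread∈S n Sy (vertex∈S t unit) 0≤λ small

        at-near : ∀ t → (∀ a → Unit (t a)) → ∀ i → Near (λ′ * (R * card n)) (at t i) (y i)
        at-near t unit i = near-resp (trans (ℚ.+-identityˡ (λ′ * sum {n} λ _ → R)) (cong (λ′ *_) (sum-const n R)))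
          refl
          (trans (cong (λ z → y i + λ′ * z) (trans (sum-const n 0ℚ) (ℚ.*-zeroˡ (card n))))
                 (trans (cong (y i +_) (ℚ.*-zeroʳ λ′)) (ℚ.+-identityʳ (y i))))
          (near-+ (near-refl {a = y i} ℚ.≤-refl)
            (near-* λ′ 0≤λ (near-sum λ a → difference (bounded (vertex∈S t unit a) Sy i))))
          where
          difference : ∀ {p q} → Near R p q → Near R (p - q) 0ℚ
          difference {p} {q} (near l u) = near
            (linear l (solve 3 (λ p q R → p :- q :+ (q :+ R) := con 0ℚ :+ R :+ p) refl p q R))
            (linear u (solve 3 (λ p q R → con 0ℚ :+ (p :+ R) := p :- q :+ R :+ q) refl p q R))

        at-+ : ∀ (t q : Fin n → ℚ) i → at (λ a → t a + q a) i ≡ at t i + λ′ * sum (λ a → q a * v a i)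
        at-+ t q i = trans (cong (λ z → y i + λ′ * z) (trans
            (sum-cong-≗ {n} λ a → solve 5 (λ t q x v y → (t :+ q) :* (x :+ v) :+ (con 1ℚ :- (t :+ q)) :* x :- y :=
                                            t :* (x :+ v) :+ (con 1ℚ :- t) :* x :- y :+ q :* v)
                                    refl (t a) (q a) (x a i) (v a i) (y i))
            (∑-distrib-+ {n} (λ a → vertex t a i - y i) (λ a → q a * v a i))))
          (solve 4 (λ y l s r → y :+ l :* (s :+ r) := y :+ l :* s :+ l :* r)
            refl (y i) λ′ (sum λ a → vertex t a i - y i) (sum λ a → q a * v a i))

        quarter = ½ * ½

        -- The correction `q` treats the matrix of the edges as `V` times the identity. For `q` of
        -- size e the neglected entries contribute at most λ′ · n · e · η, which `dominant` bounds
        -- by half of L · e.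
        improve : ∀ t (g : Fin n → ℚ) {e} → 0ℚ ≤ e → (∀ a → Near (L * e) (at t (ι a)) (g a)) →
                  let q = λ a → θ * (g a - at t (ι a)) in
                  (∀ a → Near e (q a) 0ℚ) × (∀ a → Near (L * (½ * e)) (at (λ a → t a + q a) (ι a)) (g a))
        improve t g {e} 0≤e tg = q≈0 , λ b → near-resp refl (sym (at-+ t q (ι b))) (target b)
            (near-mono (error b) (near-+ (near-refl {a = at t (ι b)} ℚ.≤-refl) (near-* λ′ 0≤λ (change b))))
          where
          q : Fin n → ℚ
          q a = θ * (g a - at t (ι a))

          q≈0 : ∀ a → Near e (q a) 0ℚ
          q≈0 a = near-resp (trans (sym (ℚ.*-assoc θ L e)) (trans (cong (_* e) θL≡1) (ℚ.*-identityˡ e))) refl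
            (ℚ.*-zeroʳ θ)
            (near-* θ 0≤θ (let near l u = tg a in near
              (linear u (solve 3 (λ p g r → g :- p :+ (p :+ r) := con 0ℚ :+ r :+ g) refl (at t (ι a)) (g a) (L * e)))
              (linear l (solve 3 (λ p g r → con 0ℚ :+ (g :+ r) := g :- p :+ r :+ p) refl (at t (ι a)) (g a)
                (L * e)))))

          change : ∀ b → Near (sum {n} λ _ → e * η) (sum λ a → q a * v a (ι b)) (sum λ a → q a * (V * δ[ a , b ]))
          change b = near-sum λ a → near-product 0≤η (q≈0 a) (diagonal a b)

          error : ∀ b → 0ℚ + λ′ * sum {n} (λ _ → e * η) ≤ L * (½ * e)
          error b = subst (λ s → 0ℚ + λ′ * s ≤ L * (½ * e)) (sym (sum-const n (e * η)))
            (linear (scale-≤ (0≤* 0≤λ 0≤e) dominant)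
              (solve 5 (λ l e η c V → con 0ℚ :+ l :* (e :* η :* c) :+ l :* e :* (con ½ :* V) :=
                                     l :* V :* (con ½ :* e) :+ l :* e :* (c :* η)) refl λ′ e η (card n) V))

          target : ∀ b → at t (ι b) + λ′ * sum (λ a → q a * (V * δ[ a , b ])) ≡ g b
          target b = begin
            at t (ι b) + λ′ * sum (λ a → q a * (V * δ[ a , b ]))
              ≡⟨ cong (λ s → at t (ι b) + λ′ * s) (trans (sum-cong-≗ {n} λ a → sym (ℚ.*-assoc (q a) V δ[ a , b ]))
                   (sum-δ (λ a → q a * V) b)) ⟩
            at t (ι b) + λ′ * (θ * (g b - at t (ι b)) * V)
              ≡⟨ solve 5 (λ p l θ g V → p :+ l :* (θ :* (g :- p) :* V) := p :+ θ :* (l :* V) :* (g :- p)) refl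
                (at t (ι b)) λ′ θ (g b) V ⟩
            at t (ι b) + θ * L * (g b - at t (ι b))
              ≡⟨ cong (λ z → at t (ι b) + z * (g b - at t (ι b))) θL≡1 ⟩
            at t (ι b) + 1ℚ * (g b - at t (ι b))
              ≡⟨ solve 2 (λ p g → p :+ con 1ℚ :* (g :- p) := g) refl (at t (ι b)) (g b) ⟩
            g b ∎
            where open ≡-Reasoning

        centred⇒unit : ∀ {e t} → 0ℚ ≤ e → Near (½ - ½ * e) t ½ → Unit t
        centred⇒unit {e} {t} 0≤e (near l u) =
            linear (u ⊕ scale-≤ 0≤½ 0≤e)
              (solve 2 (λ e t → con 0ℚ :+ (t :+ (con ½ :- con ½ :* e) :+ con ½ :* e) :=
                t :+ (con ½ :+ con ½ :* con 0ℚ)) refl e t)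
          , linear (l ⊕ scale-≤ 0≤½ 0≤e)
              (solve 2 (λ e t → t :+ (con ½ :+ (con ½ :- con ½ :* e) :+ con ½ :* e) :=
                con 1ℚ :+ (t :+ con ½ :* con 0ℚ)) refl e t)

        -- The m-th correction has size at most ¼ · 2⁻ᵐ. All of them together stay below ½, so
        -- parameters that start at ½ never leave [0,1]; this dictates the initial tolerance of L /
        -- 4.
        iterate : ∀ (g : Fin n → ℚ) → (∀ a → Near (L * quarter) (at (λ _ → ½) (ι a)) (g a)) → ∀ m →
                  ∃[ t ] (∀ a → Near (½ - ½ * 2⁻ m) (t a) ½) × (∀ a → Near (L * (quarter * 2⁻ m)) (at t (ι a)) (g a))
        iterate g near-g zero    = (λ _ → ½) , (λ a → near-refl ℚ.≤-refl) , near-g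
        iterate g near-g (suc m) =
          let t , t≈½ , tg = iterate g near-g m
              q≈0 , tqg    = improve t g (0≤* (0≤* 0≤½ 0≤½) (0≤2⁻ m)) tg
          in _ , (λ a → near-resp (solve 1 (λ e → con ½ :- con ½ :* e :+ con ½ :* con ½ :* e :=
               con ½ :- con ½ :* (con ½ :* e)) refl (2⁻ m))
                          refl (ℚ.+-identityʳ ½) (near-+ (t≈½ a) (q≈0 a)))
               , λ a → near-resp (solve 2 (λ L e → L :* (con ½ :* (con ½ :* con ½ :* e)) :=
                   L :* (con ½ :* con ½ :* (con ½ :* e))) refl L (2⁻ m))
                         refl refl (tqg a)

      -- The centre `c` does not depend on `g`, so the grid point can be picked near it afterwards.
      -- Precision of every order `m` suffices, so no linear system has to be solved exactly.
      meets-grid : ∃[ c ] S c × ∀ (g : Fin n → ℚ) → (∀ a → Near (L * quarter) (c (ι a)) (g a)) → ∀ m →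
                   ∃[ z ] S z × (∀ i → Near (λ′ * (R * card n)) (z i) (y i)) ×
                          (∀ a → Near (L * (quarter * 2⁻ m)) (z (ι a)) (g a))
      meets-grid = at (λ _ → ½)
        , at∈S (λ _ → ½) (λ _ → 0≤½ , 2⁻≤1 1)
        , λ g near-g m →
            let t , t≈½ , tg = iterate g near-g m
                unit = λ a → centred⇒unit (0≤2⁻ m) (t≈½ a)
            in at t , at∈S t unit , at-near t unit , tg

-- Avoiding finitely many values; the rules of the game

module Games where

  open import Data.Fin using (zero; suc)
  import Data.Fin as Fin
  open import Data.List using ([]; _∷_; length)
  open import Data.List.Membership.Propositional using (_∈_)
  open import Data.List.Relation.Unary.Any using (here; there)
  open import Data.Nat as ℕ using (ℕ; zero; suc; _⊔_)
  open import Data.Rational hiding (_/_; _⊔_; _≟_)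
  open import Defs using (2⁻_; 0<2⁻n; archimedean)
  open Rationals
  open Fan
  open DigitPaths
  open Boxes

  -- `e` depends only on the number of points and the width, since the precision of the answers is
  -- fixed before the answers are known. For one point, the outer quarter on the other side of the
  -- middle has distance at least w/4 > 2⁻ᵉ from it.
  avoid : ∀ n {w} → 0ℚ < w → ∃[ e ] ∀ a b → a + w ≤ b → ∀ zs → length zs ≡ n →
          ∃[ a′ ] ∃[ b′ ] a ≤ a′ × a′ < b′ × b′ ≤ b ×
          (∀ {z} → z ∈ zs → ¬ (a′ ≤ z + 2⁻ e × z ≤ b′ + 2⁻ e))
  avoid zero    {w} 0<w = 0 , λ { a b a+w≤b [] refl → a , b , ℚ.≤-refl
    , ℚ.<-≤-trans (subst (_< a + w) (ℚ.+-identityʳ a) (ℚ.+-monoʳ-< a 0<w)) a+w≤b , ℚ.≤-refl , λ () }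
  avoid (suc n) {w} 0<w = e , λ { a b a+w≤b (z ∷ zs) eq → choose a b a+w≤b z zs (ℕ.suc-injective eq) }
    where
    q = ½ * ½ * w

    0<q : 0ℚ < q
    0<q = 0<* (0<* (0<2⁻n 1) (0<2⁻n 1)) 0<w

    IH = avoid n 0<q
    e′ = proj₁ IH
    e₁ = proj₁ (archimedean q 0<q)
    e  = suc e₁ ⊔ e′

    2⁻e<q : 2⁻ e < q
    2⁻e<q = ℚ.≤-<-trans (2⁻-anti {suc e₁} {e} (ℕ.m≤m⊔n (suc e₁) e′))
      (ℚ.<-≤-trans (subst₂ _<_ (ℚ.+-identityʳ (2⁻ suc e₁)) (Defs.half+half (2⁻ e₁))
                     (ℚ.+-monoʳ-< (2⁻ suc e₁) (0<2⁻n (suc e₁))))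
        (proj₂ (archimedean q 0<q)))

    2⁻e≤2⁻e′ : 2⁻ e ≤ 2⁻ e′
    2⁻e≤2⁻e′ = 2⁻-anti {e′} {e} (ℕ.m≤n⊔m (suc e₁) e′)

    widen : ∀ {a′ z} b′ → a′ ≤ z + 2⁻ e × z ≤ b′ + 2⁻ e → a′ ≤ z + 2⁻ e′ × z ≤ b′ + 2⁻ e′
    widen {a′} {z} b′ (l , u) = ℚ.≤-trans l (ℚ.+-monoʳ-≤ z 2⁻e≤2⁻e′) , ℚ.≤-trans u (ℚ.+-monoʳ-≤ b′ 2⁻e≤2⁻e′)

    choose : ∀ a b → a + w ≤ b → ∀ z zs → length zs ≡ n →
             ∃[ a′ ] ∃[ b′ ] a ≤ a′ × a′ < b′ × b′ ≤ b ×
             (∀ {z′} → z′ ∈ z ∷ zs → ¬ (a′ ≤ z′ + 2⁻ e × z′ ≤ b′ + 2⁻ e))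
    choose a b a+w≤b z zs len with ℚ.≤-total z (a + ½ * w)
    ... | inj₁ z≤ =
      let a′ , b′ , a≤ , a<b , ≤b , avoids = proj₂ IH (b - q) b
            (ℚ.≤-reflexive (solve 2 (λ b q → b :- q :+ q := b) refl b q)) zs len
      in a′ , b′
       , ℚ.≤-trans (linear (a+w≤b ⊕ scale-≤ (ℚ.<⇒≤ (0<2⁻n 1)) (ℚ.<⇒≤ 0<w) ⊕ ℚ.<⇒≤ 0<q)
           (solve 3 (λ a b w → a :+ (b :+ (con ½ :* w :+ con ½ :* con ½ :* w)) :=
             b :- con ½ :* con ½ :* w :+ (a :+ w :+ (con ½ :* con 0ℚ :+ con 0ℚ))) refl a b w)) a≤
       , a<b , ≤b
       , λ { (here refl) (l , _) → ℚ.<-irrefl refl (ℚ.<-≤-trans 2⁻e<q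
               (linear (a≤ ⊕ l ⊕ z≤ ⊕ a+w≤b)
                 (solve 6 (λ a b w z t a′ → con ½ :* con ½ :* w :+ (a′ :+ (z :+ t :+ (a :+ con ½ :* w :+ b))) :=
                     t :+ (b :- con ½ :* con ½ :* w :+ (a′ :+ (z :+ (a :+ w))))) refl a b w z (2⁻ e) a′)))
           ; (there z∈) lu → avoids z∈ (widen b′ lu) }
    ... | inj₂ ≤z =
      let a′ , b′ , a≤ , a<b , ≤b , avoids = proj₂ IH a (a + q) ℚ.≤-refl zs len
      in a′ , b′ , a≤ , a<b
       , ℚ.≤-trans ≤b (linear (a+w≤b ⊕ scale-≤ (ℚ.<⇒≤ (0<2⁻n 1)) (ℚ.<⇒≤ 0<w) ⊕ ℚ.<⇒≤ 0<q)
           (solve 3 (λ a b w → a :+ con ½ :* con ½ :* w :+ (b :+ (con ½ :* w :+ con ½ :* con ½ :* w)) :=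
             b :+ (a :+ w :+ (con ½ :* con 0ℚ :+ con 0ℚ))) refl a b w))
       , λ { (here refl) (_ , u) → ℚ.<-irrefl refl (ℚ.<-≤-trans 2⁻e<q
               (linear (≤b ⊕ u ⊕ ≤z)
                 (solve 5 (λ a w z t b′ → con ½ :* con ½ :* w :+ (a :+ con ½ :* con ½ :* w :+ (b′ :+ t :+ z)) :=
                     t :+ (b′ :+ (z :+ (a :+ con ½ :* w)))) refl a w z (2⁻ e) b′)))
           ; (there z∈) lu → avoids z∈ (widen b′ lu) }

  -- The diagonalisation as a game on the solutions of XC k.  An instance offers
  -- a convex closed set, here as the set of digit paths of its elements; each
  -- solution is answered by a class and a real, given by approximations ζ.
  -- In a play a class c only admits reals in the interval from lo P c to hi P c.
  record Game (k : ℕ) : Set₁ where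
    infix 4 _∼[_]_
    field
      Inst Play : Set
      inst      : Play → Inst
      _∼[_]_    : Inst → ℕ → Inst → Set
      ∼-refl    : ∀ {I} n → I ∼[ n ] I
      ∼-trans   : ∀ {I J K n} → I ∼[ n ] J → J ∼[ n ] K → I ∼[ n ] K
      ∼-anti    : ∀ {I J m n} → m ℕ.≤ n → I ∼[ n ] J → I ∼[ m ] J
      In        : Inst → Path k → Set
      nonempty  : ∀ I → ∃[ α ] In I α
      bounded   : ∀ {I α} → In I α → ∀ i → Within ½ (λ n → point α n i) ½
      convex    : ∀ {I α β γ t} → In I α → In I β → 0ℚ ≤ t → t ≤ 1ℚ →
                  (∀ i → SameLimit (λ n → comb t (point α n i) (point β n i)) (λ n → point γ n i)) → In I γ
      closed    : ∀ {I α} → ¬ In I α → ∃[ n ] ∀ J β → I ∼[ n ] J → α ≈[ n ] β → ¬ In J β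
      class     : ∀ {I α} → In I α → ℕ
      ζ         : ∀ {I α} → In I α → ℕ → ℚ
      answers-continuous : ∀ {I α} (p : In I α) e →
                  ∃[ n ] ∀ J β → I ∼[ n ] J → α ≈[ n ] β → (q : In J β) → class q ≡ class p × ζ q e ≡ ζ p e
      lo hi     : Play → ℕ → ℚ
      lo<hi     : ∀ P c → lo P c < hi P c
      ζ-bounds  : ∀ P {α} (p : In (inst P) α) e →
                  lo P (class p) ≤ ζ p e + 2⁻ e × ζ p e ≤ hi P (class p) + 2⁻ e
      initial   : Play
      shrink    : ∀ P n c {a b} → lo P c ≤ a → a < b → b ≤ hi P c →
                  ∃[ Q ] inst P ∼[ n ] inst Q × lo Q c ≡ a × hi Q c ≡ b ×
                         (∀ {c′} → c′ ≢ c → lo Q c′ ≡ lo P c′ × hi Q c′ ≡ hi P c′)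
      collapse  : ∀ P n {c} → c ℕ.≤ suc k → ∃[ J ] inst P ∼[ n ] J × (∀ {α} (p : In J α) → class p ≡ c)

-- The adversary's strategy

module Strategy where

  open import Data.Fin using (Fin; zero; suc; punchIn; punchOut; _≟_)
  open import Data.Fin.Properties using (punchIn-punchOut)
  open import Data.Empty using (⊥; ⊥-elim)
  open import Data.List using (length; map)
  open import Data.List.Membership.Propositional using (_∈_)
  open import Data.List.Membership.Propositional.Properties using (∈-map⁺)
  open import Data.List.Properties using (length-map)
  open import Data.Nat as ℕ using (ℕ; zero; suc; _⊔_)
  open import Data.Rational hiding (_/_; _⊔_; _≟_)
  open import Data.Vec using (Vec; replicate)
  open import Defs using (2⁻_; 0<2⁻n; archimedean)
  open Rationals
  open Fan
  open DigitPaths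
  open Boxes
  open Games

  module _ (em : ExcludedMiddle 0ℓ) {k : ℕ} (game : Game k) where
    open Game game
    open Classical em
    open Refinement em

    some-path : Path k
    some-path = zip λ _ _ → none

    finite-digits : ∀ m → Finite (Vec Digit m)
    finite-digits = finite-vec finite-digit

    const-regular : ∀ c → Regular (λ _ → c)
    const-regular c m n = near-refl (ℚ.≤-trans (0≤2⁻ m) (linear (0≤2⁻ n)
      (solve 2 (λ x y → x :+ y := x :+ y :+ con 0ℚ) refl (2⁻ m) (2⁻ n))))

    const-within : ∀ {ρ c d} → Near ρ c d → Within ρ (λ _ → c) d
    const-within {ρ} cd = within λ n → near-mono (linear (0≤2⁻ n)
      (solve 2 (λ x y → x :+ y := x :+ y :+ con 0ℚ) refl ρ (2⁻ n))) cd

    within-const : ∀ {ρ c d} → Within ρ (λ _ → c) d → Near ρ c d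
    within-const (within n) = near-limit n

    -- Convexity with t = 1 exchanges a path for another path of the same point.
    In-same : ∀ {I α β} → In I α → (∀ i → SameLimit (λ n → point α n i) (λ n → point β n i)) → In I β
    In-same {α = α} p same = convex p p 0≤1 ℚ.≤-refl λ i n →
      near-resp refl (sym (comb-same 1ℚ (point α n i))) refl (same i n)

    -- Upper semicontinuity by compactness: each path that is no solution is refuted by finitely
    -- many digits together with a finite part of the instance, so a late change of the instance
    -- cannot create solutions far from the old ones.
    late : ∀ I m → ∃[ n ] ∀ J → I ∼[ n ] J → ∀ {α} → In J α → ∃[ β ] β ≈[ m ] α × In I β
    late I m =
      let n , f = fan (finite-digits k)
                   (λ n α → ∀ J β → I ∼[ n ] J → α ≈[ n ] β → In J β → ∃[ γ ] γ ≈[ m ] β × In I γ)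
                   (λ m≤n f J β I∼J α≈β → f J β (∼-anti m≤n I∼J) (≈-anti m≤n α≈β))
                   (λ α≈β f J γ I∼J β≈γ → f J γ I∼J (≈-trans α≈β β≈γ))
                   bar
      in n , λ J I∼J {α} → f α J α I∼J (≈-refl n)
      where
      bar : ∀ α → ∃[ n ] ∀ J β → I ∼[ n ] J → α ≈[ n ] β → In J β → ∃[ γ ] γ ≈[ m ] β × In I γ
      bar α with em {In I α}
      ... | yes p = m , λ J β _ α≈β _ → α , α≈β , p
      ... | no ¬p = let n , f = closed ¬p in n , λ J β I∼J α≈β q → ⊥-elim (f J β I∼J α≈β q)

    -- At a solution the answers are continuous; at any other path `closed` leaves no solution
    -- nearby to answer, so default values are correct vacuously.
    answers-uniform : ∀ I e → ∃[ n ] ∀ α → ∃[ c ] ∃[ z ] ∀ J β → I ∼[ n ] J → α ≈[ n ] β →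
                      (q : In J β) → class q ≡ c × ζ q e ≡ z
    answers-uniform I e = fan (finite-digits k)
      (λ n α → ∃[ c ] ∃[ z ] ∀ J β → I ∼[ n ] J → α ≈[ n ] β → (q : In J β) → class q ≡ c × ζ q e ≡ z)
      (λ m≤n (c , z , f) → c , z , λ J β I∼J α≈β → f J β (∼-anti m≤n I∼J) (≈-anti m≤n α≈β))
      (λ α≈β (c , z , f) → c , z , λ J γ I∼J β≈γ → f J γ I∼J (≈-trans α≈β β≈γ))
      bar
      where
      bar : ∀ α → ∃[ n ] ∃[ c ] ∃[ z ] ∀ J β → I ∼[ n ] J → α ≈[ n ] β → (q : In J β) → class q ≡ c × ζ q e ≡ z
      bar α with em {In I α}
      ... | yes p = let n , f = answers-continuous p e in n , class p , ζ p e , f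
      ... | no ¬p = let n , f = closed ¬p in n , 0 , 0ℚ , λ J β I∼J α≈β q → ⊥-elim (f J β I∼J α≈β q)

    -- Thickening the solution set makes rational points available and preserves convexity, so that
    -- all geometry can be done in ℚ.
    record S (l : ℕ) (I : Inst) (x : Fin k → ℚ) : Set where
      constructor by
      field
        path  : Path k
        in-I  : In I path
        close : ∀ i → Within (2⁻ l) (λ n → point path n i) (x i)

    S-resp : ∀ {l I x y} → x ≗ y → S l I x → S l I y
    S-resp {l} x≗y (by α p w) = by α p λ i → subst (Within (2⁻ l) (λ n → point α n i)) (x≗y i) (w i)

    S-mono : ∀ {l m I x} → l ℕ.≤ m → S m I x → S l I x
    S-mono {l} {m} l≤m (by α p w) = by α p λ i → within-mono (2⁻-anti {l} {m} l≤m) (w i)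

    S-convex : ∀ {l I x y t} → 0ℚ ≤ t → t ≤ 1ℚ → S l I x → S l I y → S l I (λ i → comb t (x i) (y i))
    S-convex {l} {I} {x} {y} {t} 0≤t t≤1 (by α p v) (by β q w) =
      let γ , _ , same , _ = followAll {½} {½} ℚ.≤-refl (2⁻≤1 1) T T-regular 0 some-path T-bounded
            (linear (0≤2⁻ 2) refl)
      in by γ (convex p q 0≤t t≤1 same)
           λ i → within-same (center-regular (coord γ i)) (same-sym (same i)) (within λ n →
               near-comb-same 0≤t t≤1 (near-at (v i) n) (near-at (w i) n))
      where
      T : Fin k → ℕ → ℚ
      T i n = comb t (point α n i) (point β n i)

      T-regular : ∀ i → Regular (T i)
      T-regular i m n = near-comb-same 0≤t t≤1 (center-regular (coord α i) m n) (center-regular (coord β i) m n)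

      T-bounded : ∀ i → Within ½ (T i) ½
      T-bounded i = within λ n → near-resp refl refl (comb-same t ½)
        (near-comb-same 0≤t t≤1 (near-at (bounded p i) n) (near-at (bounded q i) n))

    S-late : ∀ {l I J} → (∀ {α} → In J α → ∃[ β ] β ≈[ suc (suc l) ] α × In I β) →
             ∀ {x} → S (suc l) J x → S l I x
    S-late {l} back {x} (by α p w) =
      let m = suc (suc l)
          β , β≈α , q = back p
      in by β q λ i → within-mono (ℚ.≤-reflexive
           (solve 1 (λ e → con ½ :* (con ½ :* e) :+ (con ½ :* (con ½ :* e) :+ con ½ :* e) := e) refl (2⁻ l)))
         (within-trans (subst (Within (2⁻ m) (λ n → point β n i)) (point-cong m β≈α i) (center-within (coord β i) m))
                       (within-near (center-within (coord α i) m) (w i)))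

    S-near-½ : ∀ {l I x} → S l I x → ∀ i → Near (2⁻ l + ½) (x i) ½
    S-near-½ (by α p w) i = within-near (w i) (bounded p i)

    -- Down to the scale η, the solutions form a graph over the d coordinates ι with
    -- Lipschitz constant C.
    Thin : ℕ → ℚ → ℚ → Inst → Set
    Thin d C η I = ∃ λ (ι : Fin d → Fin k) → ∃[ l ] ∀ x y → S l I x → S l I y → ∀ ρ → η ≤ ρ →
      (∀ (a : Fin d) → Near ρ (x (ι a)) (y (ι a))) → ∀ (i : Fin k) → Near (C * ρ) (x i) (y i)

    Same-interval : Play → Play → ℕ → Set
    Same-interval P Q c = lo Q c ≡ lo P c × hi Q c ≡ hi P c

    -- All plays, agreement lengths and scales are allowed, since a caller learns the ones it needs
    -- only during its own play. The classes below `d` are reserved for the remaining steps.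
    Reducible : ℕ → ℚ → Set
    Reducible d C = ∀ P s {η} → 0ℚ < η →
      ∃[ Q ] inst P ∼[ s ] inst Q × (∀ {c} → c ℕ.< d → Same-interval P Q c) × Thin d C η (inst Q)

    reducible-top : Reducible k 1ℚ
    reducible-top P s 0<η = P , ∼-refl s , (λ _ → refl , refl) , (λ a → a) , 0
      , λ _ _ _ _ ρ _ xy i → near-resp (sym (ℚ.*-identityˡ ρ)) refl refl (xy i)

    -- A pair of points may violate thinness at any scale ρ ≥ η. Shrinking it so that its long side
    -- becomes Aη brings the edges for all coordinates to one common length.
    shorten : ∀ {A η ρ D} → 0ℚ < A → 0ℚ < η → η ≤ ρ → A * ρ ≤ D →
              ∃[ θ ] 0ℚ ≤ θ × θ ≤ 1ℚ × θ * D ≡ A * η × θ * ρ ≤ η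
    shorten {A} {η} {ρ} {D} 0<A 0<η η≤ρ Aρ≤D
      with divide (ℚ.<-≤-trans (0<* 0<A (ℚ.<-≤-trans 0<η η≤ρ)) Aρ≤D) (0≤* (ℚ.<⇒≤ 0<A) (ℚ.<⇒≤ 0<η))
    ... | θ , 0≤θ , θD≡Aη = θ , 0≤θ , θ≤1 , θD≡Aη , θρ≤η
      where
      θ≤1 : θ ≤ 1ℚ
      θ≤1 = cancel-≤ (ℚ.<-≤-trans (0<* 0<A (ℚ.<-≤-trans 0<η η≤ρ)) Aρ≤D)
        (ℚ.≤-trans (ℚ.≤-reflexive θD≡Aη)
          (ℚ.≤-trans (ℚ.≤-trans (scale-≤ (ℚ.<⇒≤ 0<A) η≤ρ) Aρ≤D) (ℚ.≤-reflexive (sym (ℚ.*-identityˡ D)))))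

      θρ≤η : θ * ρ ≤ η
      θρ≤η = cancel-≤ 0<A (linear {θ * ρ * A} {η * A} (scale-≤ 0≤θ Aρ≤D)
        (trans (cong (θ * ρ * A +_) θD≡Aη)
               (solve 4 (λ t r A e → t :* r :* A :+ A :* e := e :* A :+ t :* (A :* r)) refl θ ρ A η)))

    near-shrink : ∀ {θ ρ η p q} → 0ℚ ≤ θ → θ * ρ ≤ η → Near ρ p q → Near η (θ * (q - p)) 0ℚ
    near-shrink {θ} {ρ} {η} {p} {q} 0≤θ θρ≤η (near l u) = near-mono θρ≤η
      (subst (Near (θ * ρ) (θ * (q - p))) (ℚ.*-zeroʳ θ) (near-* θ 0≤θ (near
        (linear u (solve 3 (λ p q R → q :- p :+ (p :+ R) := con 0ℚ :+ R :+ q) refl p q ρ))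
        (linear l (solve 3 (λ p q R → con 0ℚ :+ (q :+ R) := q :- p :+ R :+ p) refl p q ρ)))))

    record Segment {n} (ι : Fin n → Fin k) (l : ℕ) (I : Inst) (A η : ℚ) (a : Fin n) : Set where
      field
        start step : Fin k → ℚ
        start∈S : S l I start
        end∈S   : S l I (λ i → start i + step i)
        diagonal : ∀ b → Near η (step (ι b)) (A * η * δ[ a , b ])

    -- If no coordinate can be dropped, the solutions contain, for each coordinate,
    -- a long segment that nearly has its direction.
    segment : ∀ {d C η l I A} (ι : Fin (suc d) → Fin k) → 0ℚ < η → 1ℚ ≤ A →
              (∀ x y → S l I x → S l I y → ∀ ρ → η ≤ ρ →
                 (∀ a → Near ρ (x (ι a)) (y (ι a))) → ∀ i → Near (C * ρ) (x i) (y i)) →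
              ¬ Thin d (A * C) η I → ∀ a → Segment ι l I A η a
    segment {d} {C} {η} {l} {I} {A} ι 0<η 1≤A thin ¬thin a with em {Bad}
      where
      Bad : Set
      Bad = ∃[ x ] ∃[ y ] ∃[ ρ ] S l I x × S l I y × η ≤ ρ
            × (∀ c → Near ρ (x (ι (punchIn a c))) (y (ι (punchIn a c)))) × ∃[ i ] ¬ Near (A * C * ρ) (x i) (y i)
    ... | no ¬bad = contradiction
      (ι ∘ punchIn a , l , λ x y Sx Sy ρ η≤ρ xy i → by-contradiction λ ¬near →
        ¬bad (x , y , ρ , Sx , Sy , η≤ρ , xy , i , ¬near)) ¬thin
    ... | yes (x , y , ρ , Sx , Sy , η≤ρ , xy , i , ¬near) = result
      where
      0<ρ : 0ℚ < ρ
      0<ρ = ℚ.<-≤-trans 0<η η≤ρ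

      0<A : 0ℚ < A
      0<A = ℚ.<-≤-trans (0<2⁻n 0) 1≤A

      ρ≤Aρ : ρ ≤ A * ρ
      ρ≤Aρ = ℚ.≤-trans (ℚ.≤-reflexive (sym (ℚ.*-identityˡ ρ)))
               (ℚ.*-monoʳ-≤-nonNeg ρ {{nonNegative (ℚ.<⇒≤ 0<ρ)}} {1ℚ} {A} 1≤A)

      -- If the pair were also within Aρ in the coordinate `ι a`, thinness at scale Aρ would make it
      -- CAρ-close in every coordinate.
      far : ¬ Near (A * ρ) (x (ι a)) (y (ι a))
      far near-a = ¬near (near-resp (solve 3 (λ A C ρ → C :* (A :* ρ) := A :* C :* ρ) refl A C ρ) refl refl
        (thin x y Sx Sy (A * ρ) (ℚ.≤-trans η≤ρ ρ≤Aρ) all i))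
        where
        all : ∀ b → Near (A * ρ) (x (ι b)) (y (ι b))
        all b with a ≟ b
        ... | yes refl = near-a
        ... | no a≢b   = near-mono ρ≤Aρ
          (subst (λ b → Near ρ (x (ι b)) (y (ι b))) (punchIn-punchOut a≢b) (xy (punchOut a≢b)))

      scaled : ∀ x y → S l I x → S l I y → (∀ c → Near ρ (x (ι (punchIn a c))) (y (ι (punchIn a c)))) →
               ∃[ θ ] 0ℚ ≤ θ × θ ≤ 1ℚ × θ * (y (ι a) - x (ι a)) ≡ A * η × θ * ρ ≤ η → Segment ι l I A η a
      scaled x y Sx Sy xy (θ , 0≤θ , θ≤1 , θD≡Aη , θρ≤η) = record
        { start    = x
        ; step     = λ i → θ * (y i - x i)
        ; start∈S  = Sx
        ; end∈S    = S-resp {l} {I} {λ i → comb θ (y i) (x i)}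
            (λ i → solve 3 (λ t x y → t :* y :+ (con 1ℚ :- t) :* x := x :+ t :* (y :- x)) refl θ (x i) (y i))
            (S-convex 0≤θ θ≤1 Sy Sx)
        ; diagonal = diagonal
        }
        where
        diagonal : ∀ b → Near η (θ * (y (ι b) - x (ι b))) (A * η * δ[ a , b ])
        diagonal b = diagonal-cases (a ≟ b)
          where
          diagonal-cases : Dec (a ≡ b) → Near η (θ * (y (ι b) - x (ι b))) (A * η * δ[ a , b ])
          diagonal-cases (yes refl) = near-≡ (ℚ.<⇒≤ 0<η)
            (trans θD≡Aη (sym (trans (cong (A * η *_) (δ-same a)) (ℚ.*-identityʳ (A * η)))))
          diagonal-cases (no a≢b) = near-resp refl refl
            (sym (trans (cong (A * η *_) (δ-different a≢b)) (ℚ.*-zeroʳ (A * η))))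
            (near-shrink 0≤θ θρ≤η
              (subst (λ b → Near ρ (x (ι b)) (y (ι b))) (punchIn-punchOut a≢b) (xy (punchOut a≢b))))

      oriented : ∀ x y → S l I x → S l I y → (∀ c → Near ρ (x (ι (punchIn a c))) (y (ι (punchIn a c)))) →
                 x (ι a) + A * ρ ≤ y (ι a) → Segment ι l I A η a
      oriented x y Sx Sy xy gap = scaled x y Sx Sy xy (shorten 0<A 0<η η≤ρ
        (linear gap (solve 3 (λ x y r → r :+ y := y :- x :+ (x :+ r)) refl (x (ι a)) (y (ι a)) (A * ρ))))

      result : Segment ι l I A η a
      result with ℚ.≤-total (x (ι a) + A * ρ) (y (ι a))
      ... | inj₁ gap = oriented x y Sx Sy xy gap
      ... | inj₂ y≤ with ℚ.≤-total (y (ι a) + A * ρ) (x (ι a))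
      ...   | inj₁ gap = oriented y x Sy Sx (λ c → near-sym (xy c)) gap
      ...   | inj₂ x≤  = contradiction (near x≤ y≤) far

    followRational : ∀ {ρ} (x : Fin k → ℚ) n (α : Path k) →
      (∀ i → Near ρ (x i) (point α n i)) → ρ ≤ ½ * 2⁻ suc n + 2⁻ suc n →
                     ∃[ β ] β ≈[ n ] α × ∀ m → n ℕ.< m → ∀ i → Near (½ * 2⁻ m) (x i) (point β m i)
    followRational x n α near-x ρ≤ =
      let β , β≈α , _ , close = followAll {½} ℚ.≤-refl (2⁻≤1 1) (λ i _ → x i) (λ i → const-regular (x i)) n α
                                  (λ i → const-within {c = x i} (near-x i)) ρ≤
      in β , β≈α , λ m n<m i → within-const {c = x i} (close m n<m i)

    -- Centres of digit prefixes serve as grid points: they are indexed by a finite type, and the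
    -- empty prefix already reaches everything within 1 of ½.
    grid : ∀ {m} (x : Fin m → ℚ) n → (∀ a → Near 1ℚ (x a) ½) →
           ∃[ ds ] ∀ (a : Fin m) → Near (2⁻ suc n) (x a) (point (ds ++ˢ λ _ → replicate m none) (suc n) a)
    grid {m} x n near-½ =
      let β , _ , _ , close = followAll {1ℚ} {1ℚ} (2⁻≤1 1) ℚ.≤-refl (λ a _ → x a) (λ a → const-regular (x a)) 0
            (λ _ → replicate m none)
                                (λ a → const-within {c = x a} (near-½ a)) ℚ.≤-refl
      in prefix (suc n) β , λ a → near-resp (ℚ.*-identityˡ (2⁻ suc n)) refl
           (point-cong (suc n) (≈-sym (prefix-++ˢ (suc n) β _)) a)
           (within-const {c = x a} (close (suc n) ℕ.z<s a))

    -- A solution with margin: a digit path whose prefixes of length n > 0 come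
    -- within half of the radius 2⁻ⁿ in which the prefix can be continued.
    Centred : Path k → Set
    Centred α = ∀ n → 0 ℕ.< n → ∀ i → Within (½ * 2⁻ n) (λ m → point α m i) (point α n i)

    centre : ∀ {I α} → In I α → ∃[ β ] In I β × Centred β
    centre {I} {α} p =
      let β , _ , same , close = followAll {½} ℚ.≤-refl (2⁻≤1 1) (λ i m → point α m i)
            (λ i → center-regular (coord α i))
                                   0 some-path (bounded p) (linear (0≤2⁻ 2) refl)
      in β , In-same p same
       , λ n 0<n i → within-same (center-regular (coord β i)) (same-sym (same i)) (close n 0<n i)

    -- Gives the same point a name to which the answers known for the prefix of `β` apply.
    reroute : ∀ {I α} n β → In I α → (∀ i → Within (2⁻ n) (λ m → point α m i) (point β n i)) →
              ∃[ γ ] γ ≈[ n ] β × In I γ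
    reroute {I} {α} n β p w =
      let γ , γ≈β , same , _ = followAll {1ℚ} (2⁻≤1 1) ℚ.≤-refl (λ i m → point α m i)
            (λ i → center-regular (coord α i))
                                 n β w (ℚ.≤-reflexive (solve 1 (λ e → e := con 1ℚ :* (con ½ :* e) :+ con ½ :* e)
                                   refl (2⁻ n)))
      in γ , γ≈β , In-same p same

    -- Since answers depend on names, each grid point `g` is combined with each prefix `u` of length
    -- l₀, which decides the class. The last bound, ¾ · 2⁻ˡ⁰, is what `follow` accepts for κ = ½.
    record Candidate {n} (ι : Fin n → Fin k) (l : ℕ) (I : Inst) (η : ℚ) (l₀ : ℕ)
                     (g : Fin n → ℚ) (u : Path k) (x : Fin k → ℚ) : Set where
      constructor candidate
      field
        solution  : S l I x
        near-grid : ∀ a → Near η (x (ι a)) (g a)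
        near-path : ∀ i → Near (½ * 2⁻ suc l₀ + 2⁻ suc l₀) (x i) (point u l₀ i)

    module _ {n} (ι : Fin n → Fin k) (l : ℕ) (I I₁ : Inst) (η : ℚ) {l₀ l₁ : ℕ} (l₀<l₁ : l₀ ℕ.< l₁) (e : ℕ) where

      record Listed (g : Fin n → ℚ) (u : Path k) (z : ℚ) : Set where
        constructor listed
        field
          witness   : Fin k → ℚ
          is-cand   : Candidate ι l I₁ η l₀ g u witness
          path      : Path k
          path≈     : path ≈[ l₀ ] u
          near-path : ∀ i → Near (½ * 2⁻ l₁) (witness i) (point path l₁ i)
          answer    : ∀ J β → I ∼[ l₁ ] J → path ≈[ l₁ ] β → (q : In J β) → ζ q e ≡ z

      list : (∀ α → ∃[ z ] ∀ J β → I ∼[ l₁ ] J → α ≈[ l₁ ] β → (q : In J β) → ζ q e ≡ z) →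
             ∀ g u → ∃[ z ] ((∃[ x ] Candidate ι l I₁ η l₀ g u x) → Listed g u z)
      list uniform g u with em {∃[ x ] Candidate ι l I₁ η l₀ g u x}
      -- Without a candidate there is no answer to avoid, and any value will do.
      ... | no ¬some = 0ℚ , λ some → ⊥-elim (¬some some)
      ... | yes (x , c) =
        let α , α≈u , close = followRational x l₀ u (Candidate.near-path c) ℚ.≤-refl
            z , answer      = uniform α
        in z , λ _ → listed x c α α≈u (close l₁ l₀<l₁) answer

      -- All solutions over a grid point are so close together that they have a
      -- path with the same prefix, hence the same approximate answer.
      forced : ∀ {C} → 0ℚ ≤ C →
               (∀ x y → S l I₁ x → S l I₁ y → ∀ ρ → η ≤ ρ →
                 (∀ a → Near ρ (x (ι a)) (y (ι a))) → ∀ i → Near (C * ρ) (x i) (y i)) →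
               0ℚ ≤ η → C * (η + η) ≤ 2⁻ suc (suc l₁) → ∀ {I₂} → I ∼[ l₁ ] I₂ →
               ∀ {g u z x} → Listed g u z → Candidate ι l I₁ η l₀ g u x → S (suc (suc l₁)) I₂ x →
               ∃[ β ] β ≈[ l₀ ] u × ∃ λ (q : In I₂ β) → ζ q e ≡ z
      forced {C} 0≤C thin 0≤η fine {I₂} I∼I₂ {g} {u} {z} {x} (listed w cw α α≈u near-α answer) cx (by γ p close) =
        let β , β≈α , q = reroute l₁ α p (λ i → within-mono radius
                            (within-trans (within-trans (close i)
                              (near-mono fine (thin x w (Candidate.solution cx) (Candidate.solution cw)
                                (η + η) η≤η+η x≈w i))) (near-α i)))
        in β , ≈-trans (≈-anti (ℕ.<⇒≤ l₀<l₁) β≈α) α≈u , q , answer I₂ β I∼I₂ (≈-sym β≈α) q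
        where
        -- The listed path uses only half of its radius; the distance of `x` from its solution and
        -- the diameter over the grid point take a quarter each.
        radius : 2⁻ suc (suc l₁) + 2⁻ suc (suc l₁) + ½ * 2⁻ l₁ ≤ 2⁻ l₁
        radius = ℚ.≤-reflexive (solve 1 (λ e → con ½ :* (con ½ :* e) :+ con ½ :* (con ½ :* e) :+ con ½ :* e := e)
          refl (2⁻ l₁))

        η≤η+η : η ≤ η + η
        η≤η+η = linear 0≤η (solve 1 (λ e → e :+ e := e :+ e :+ con 0ℚ) refl η)

        x≈w : ∀ a → Near (η + η) (x (ι a)) (w (ι a))
        x≈w a = near-trans (Candidate.near-grid cx a) (near-sym (Candidate.near-grid cw a))

    S-diameter : ∀ {l I x y} → 0 ℕ.< l → S l I x → S l I y → ∀ i → Near (1ℚ + 1ℚ) (x i) (y i)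
    S-diameter {l} 0<l Sx Sy i = near-mono (linear (l≤½ ⊕ l≤½)
        (solve 1 (λ e → e :+ con ½ :+ (e :+ con ½) :+ (con ½ :+ con ½) := con 1ℚ :+ con 1ℚ :+ (e :+ e)) refl (2⁻ l)))
      (near-trans (S-near-½ Sx i) (near-sym (S-near-½ Sy i)))
      where
      l≤½ : 2⁻ l ≤ ½
      l≤½ = 2⁻-anti {1} {l} 0<l

    grid-point : ∀ {m} ng → Vec (Vec Digit m) (suc ng) → Fin m → ℚ
    grid-point {m} ng ds = point (ds ++ˢ λ _ → replicate m none) (suc ng)

    -- `I` is the instance for which the moduli l₀ of the class and l₁ of the answers are fixed,
    -- `I₁` the one already thin over one more coordinate, `P₂` the play after the interval of `c`
    -- has been shrunk. The weight 2⁻ʰ makes the parallelepiped so small that it stays around a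
    -- point whose prefix forces class `c`.
    thin-step : ∀ {n C A η ηf e c l l₀ l₁ h ng} (ι : Fin (suc n) → Fin k) (I I₁ : Inst) (P₂ : Play)
      (z : Vec (Vec Digit (suc n)) (suc ng) → Vec (Vec Digit k) l₀ → ℚ) →
      0ℚ ≤ C → A ≡ 2ℚ * card (suc n) → 1ℚ ≤ A → 0ℚ < η → 0ℚ < ηf → ηf ≤ η → c ℕ.≤ suc k → 0 ℕ.< l₀ →
        (l₀<l₁ : l₀ ℕ.< l₁) →
      2⁻ h * ((1ℚ + 1ℚ) * card (suc n)) ≤ 2⁻ (3 ℕ.+ l₀) →
      2⁻ suc ng ≤ 2⁻ h * (A * η) * (½ * ½) →
      C * (ηf + ηf) ≤ 2⁻ suc (suc l₁) →
      (∀ α → ∃[ c ] ∀ J β → I ∼[ l₀ ] J → α ≈[ l₀ ] β → (q : In J β) → class q ≡ c) →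
      (∀ x y → S l I₁ x → S l I₁ y → ∀ ρ → ηf ≤ ρ →
         (∀ a → Near ρ (x (ι a)) (y (ι a))) → ∀ i → Near (C * ρ) (x i) (y i)) →
      I ∼[ l₁ ] inst P₂ →
      (∀ {α} → In (inst P₂) α → ∃[ β ] β ≈[ suc (suc l) ] α × In I₁ β) →
      (∀ g u → (∃[ x ] Candidate ι l I₁ ηf l₀ (grid-point ng g) (u ++ˢ some-path) x) →
               Listed ι l I I₁ ηf l₀<l₁ e (grid-point ng g) (u ++ˢ some-path) (z g u)) →
      (∀ g u → ¬ (lo P₂ c ≤ z g u + 2⁻ e × z g u ≤ hi P₂ c + 2⁻ e)) →
      Thin n (A * C) η (inst P₂)
    thin-step {n} {C} {A} {η} {ηf} {e} {c} {l} {l₀} {l₁} {h} {ng} ι I I₁ P₂ z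
      0≤C A≡ 1≤A 0<η 0<ηf ηf≤η c≤k+1 0<l₀ l₀<l₁ small mesh fine classes thin I∼P₂ back listed-z avoids =
      by-contradiction λ ¬thin → impossible ¬thin
      where
      I₂ = inst P₂
      -- Exceeds the precisions l + 1, l₁ + 2 and l₀ + 3 used below.
      l′ = suc l ℕ.+ suc (suc l₁)

      l<l′ : suc l ℕ.≤ l′
      l<l′ = ℕ.m≤m+n (suc l) (suc (suc l₁))

      l₁+2≤l′ : suc (suc l₁) ℕ.≤ l′
      l₁+2≤l′ = ℕ.m≤n+m (suc (suc l₁)) (suc l)

      l₀+3≤l′ : 3 ℕ.+ l₀ ℕ.≤ l′
      l₀+3≤l′ = ℕ.≤-trans (ℕ.s≤s (ℕ.s≤s l₀<l₁)) l₁+2≤l′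

      earlier : ∀ {x} → S l′ I₂ x → S l I₁ x
      earlier Sx = S-late back (S-mono l<l′ Sx)

      thin₂ : ∀ x y → S l′ I₂ x → S l′ I₂ y → ∀ ρ → η ≤ ρ →
              (∀ a → Near ρ (x (ι a)) (y (ι a))) → ∀ i → Near (C * ρ) (x i) (y i)
      thin₂ x y Sx Sy ρ η≤ρ = thin x y (earlier Sx) (earlier Sy) ρ (ℚ.≤-trans ηf≤η η≤ρ)

      -- The collapse is only threatened. Being late, it has a solution near solutions of `I₂`; its
      -- class is `c` and was decided by l₀ digits, so every solution of `I₂` with this prefix has
      -- class `c` as well.
      collapsed : ∃[ α ] Centred α × S l′ I₂ (point α l′) × (∀ β → α ≈[ l₀ ] β → (q : In I₂ β) → class q ≡ c)
      collapsed =
        let m , near-I₂        = late I₂ l′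
            J , I₂∼J , class-c = collapse P₂ (m ⊔ l₁) c≤k+1
            α₀ , p₀            = nonempty J
            α , p , centred    = centre p₀
            β , β≈α , q        = near-I₂ J (∼-anti (ℕ.m≤m⊔n m l₁) I₂∼J) p
            c₀ , class-c₀      = classes α
            I∼J                = ∼-anti (ℕ.<⇒≤ l₀<l₁) (∼-trans I∼P₂ (∼-anti (ℕ.m≤n⊔m m l₁) I₂∼J))
            c₀≡c               = trans (sym (class-c₀ J α I∼J (≈-refl l₀) p)) (class-c p)
        in α , centred
         , by β q (λ i → subst (Within (2⁻ l′) (λ n → point β n i)) (point-cong l′ β≈α i)
             (center-within (coord β i) l′))
         , λ γ α≈γ r → trans (class-c₀ I₂ γ (∼-anti (ℕ.<⇒≤ l₀<l₁) I∼P₂) α≈γ r) c₀≡c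

      impossible : ¬ Thin n (A * C) η I₂ → ⊥
      impossible ¬thin = avoids g u (subst (λ c → lo P₂ c ≤ z g u + 2⁻ e) class≡c
        (subst (lo P₂ (class q) ≤_) (cong (_+ 2⁻ e) ζ≡z) (proj₁ (ζ-bounds P₂ q e)))
                                   , subst (λ c → z g u ≤ hi P₂ c + 2⁻ e) class≡c
                                       (subst (_≤ hi P₂ (class q) + 2⁻ e) ζ≡z (proj₂ (ζ-bounds P₂ q e))))
        where
        seg : ∀ a → Segment ι l′ I₂ A η a
        seg = segment ι 0<η 1≤A thin₂ ¬thin

        α = proj₁ collapsed
        y = point α l′
        0<l′ : 0 ℕ.< l′
        0<l′ = ℕ.z<s

        0<A : 0ℚ < A
        0<A = ℚ.<-≤-trans (0<2⁻n 0) 1≤A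

        -- The factor 2 · (n + 1) in `A` is made for this inequality.
        dominant : card (suc n) * η ≤ ½ * (A * η)
        dominant = ℚ.≤-reflexive (trans (solve 2 (λ c e → c :* e := con ½ :* (con 2ℚ :* c :* e)) refl
          (card (suc n)) η)
                                        (cong (λ A → ½ * (A * η)) (sym A≡)))

        few : card (suc n) * 2⁻ h < 1ℚ
        few = ℚ.≤-<-trans (linear (small ⊕ scale-≤ (0≤card (suc n)) (0≤2⁻ h))
                (solve 3 (λ c h x → c :* h :+ (x :+ c :* h) :=
                  x :+ (h :* ((con 1ℚ :+ con 1ℚ) :* c) :+ c :* con 0ℚ)) refl (card (suc n)) (2⁻ h) (2⁻ (3 ℕ.+ l₀))))
              (ℚ.≤-<-trans (2⁻-anti {1} {3 ℕ.+ l₀} (ℕ.s≤s ℕ.z≤n)) (ℚ.<-≤-trans ½<1 ℚ.≤-refl))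
          where
          ½<1 : ½ < 1ℚ
          ½<1 = subst₂ _<_ (ℚ.+-identityʳ ½) refl (ℚ.+-monoʳ-< ½ (0<2⁻n 1))

        meets = meets-grid (S l′ I₂) S-resp S-convex ι (proj₁ (proj₂ (proj₂ collapsed)))
                  (λ a → Segment.start∈S (seg a)) (λ a → Segment.end∈S (seg a)) (0<* 0<A 0<η) (ℚ.<⇒≤ 0<η)
                  (λ a → Segment.diagonal (seg a)) dominant (0<2⁻n h) few (S-diameter 0<l′)
        cpt = proj₁ meets

        gridded : ∃[ ds ] ∀ (a : Fin (suc n)) → Near (2⁻ suc ng) (cpt (ι a)) (grid-point ng ds a)
        gridded = grid (λ a → cpt (ι a)) ng (λ a →
          near-mono (ℚ.≤-trans (ℚ.+-monoˡ-≤ ½ (2⁻-anti {1} {l′} 0<l′)) ℚ.≤-refl)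
                    (S-near-½ (proj₁ (proj₂ meets)) (ι a)))
        g = proj₁ gridded
        u = prefix l₀ α

        fine-enough : ∃[ m ] 2⁻ m * (2⁻ h * (A * η) * (½ * ½)) ≤ ηf
        fine-enough = scaled-archimedean (0≤* (0≤* (0≤2⁻ h) (0≤* (ℚ.<⇒≤ 0<A) (ℚ.<⇒≤ 0<η))) (0≤* 0≤½ 0≤½)) 0<ηf
        m = proj₁ fine-enough

        hit = proj₂ (proj₂ meets) (grid-point ng g) (λ a → near-mono mesh (proj₂ gridded a)) m
        x = proj₁ hit
        Sx : S l′ I₂ x
        Sx = proj₁ (proj₂ hit)

        x-near-y : ∀ i → Near (2⁻ (3 ℕ.+ l₀)) (x i) (y i)
        x-near-y i = near-mono small (proj₁ (proj₂ (proj₂ hit)) i)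

        y-near-u : ∀ i → Near (2⁻ (3 ℕ.+ l₀) + ½ * 2⁻ l₀) (y i) (point α l₀ i)
        y-near-u i = near-mono (ℚ.+-monoˡ-≤ (½ * 2⁻ l₀) (2⁻-anti {3 ℕ.+ l₀} {l′} l₀+3≤l′))
          (within-near (center-within (coord α i) l′) (proj₁ (proj₂ collapsed) l₀ 0<l₀ i))

        -- In units of 2⁻ˡ⁰, the distances ⅛ from `x` to `y`, ⅛ from `y` to the limit of `α` and ½
        -- from there to the centre of `u` exhaust the permitted ¾.
        cand : Candidate ι l I₁ ηf l₀ (grid-point ng g) (u ++ˢ some-path) x
        cand = candidate (earlier Sx)
          (λ a → near-mono (ℚ.≤-trans (ℚ.≤-reflexive
            (solve 2 (λ L m → L :* (con ½ :* con ½ :* m) := m :* (L :* (con ½ :* con ½))) refl (2⁻ h * (A * η))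
              (2⁻ m)))
                              (proj₂ fine-enough)) (proj₂ (proj₂ (proj₂ hit)) a))
          (λ i → near-resp (solve 1 (λ e → con ½ :* (con ½ :* (con ½ :* e)) :+
            (con ½ :* (con ½ :* (con ½ :* e)) :+ con ½ :* e) := con ½ :* (con ½ :* e) :+ con ½ :* e) refl (2⁻ l₀))
                   refl (sym (point-cong l₀ (prefix-++ˢ l₀ α some-path) i)) (near-trans (x-near-y i) (y-near-u i)))

        forced-z = forced ι l I I₁ ηf l₀<l₁ e 0≤C thin (ℚ.<⇒≤ 0<ηf) fine I∼P₂ (listed-z g u (x , cand)) cand
          (S-mono l₁+2≤l′ Sx)
        β = proj₁ forced-z
        q = proj₁ (proj₂ (proj₂ forced-z))
        ζ≡z : ζ q e ≡ z g u
        ζ≡z = proj₂ (proj₂ (proj₂ forced-z))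

        class≡c : class q ≡ c
        class≡c = proj₂ (proj₂ (proj₂ collapsed)) β
          (≈-sym (≈-trans (proj₁ (proj₂ forced-z)) (prefix-++ˢ l₀ α some-path))) q

    -- The chain of dependencies: `η` and l₀ determine the grid; its size and the width of the
    -- interval of class `d` determine `e`; this determines l₁, and l₁ with η the scale 2⁻ᶠ at which
    -- the level above is called.
    reduce : ∀ {d C} → d ℕ.≤ suc k → 1ℚ ≤ C → Reducible (suc d) C → Reducible d (2ℚ * card (suc d) * C)
    reduce {d} {C} d≤k+1 1≤C reducible P s {η} 0<η = from-P₁ (reducible P (s ⊔ l₁) (0<2⁻n f))
      where
      n = suc d
      A = 2ℚ * card n

      1≤A : 1ℚ ≤ A
      1≤A = linear (0≤card d ⊕ 0≤card d ⊕ 0≤1)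
        (solve 1 (λ c → con 1ℚ :+ (c :+ (c :+ con 1ℚ)) :=
          con 2ℚ :* (con 1ℚ :+ c) :+ (con 0ℚ :+ (con 0ℚ :+ con 0ℚ))) refl (card d))

      0<A : 0ℚ < A
      0<A = ℚ.<-≤-trans (0<2⁻n 0) 1≤A

      0≤C : 0ℚ ≤ C
      0≤C = ℚ.≤-trans 0≤1 1≤C

      0≤2 : 0ℚ ≤ 2ℚ
      0≤2 = linear (0≤1 ⊕ 0≤1) refl

      uniform₀ = answers-uniform (inst P) 0
      -- Positive, because a centred path has its margin from the first digit on.
      l₀ = suc (proj₁ uniform₀)

      h-small = scaled-archimedean (0≤* 0≤2 (0≤card n)) (0<2⁻n (3 ℕ.+ l₀))
      h = proj₁ h-small

      grid-mesh = archimedean (2⁻ h * (A * η) * (½ * ½))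
        (0<* (0<* (0<2⁻n h) (0<* 0<A 0<η)) (0<* (0<2⁻n 1) (0<2⁻n 1)))
      ng = proj₁ grid-mesh

      pairs : Finite (Vec (Vec Digit n) (suc ng) × Vec (Vec Digit k) l₀)
      pairs = finite-pair (finite-vec (finite-digits n) (suc ng)) (finite-vec (finite-digits k) l₀)

      0<width : 0ℚ < hi P d - lo P d
      0<width = subst (_< hi P d - lo P d) (ℚ.+-inverseʳ (lo P d)) (ℚ.+-monoˡ-< (- lo P d) (lo<hi P d))

      avoiding = avoid (length (elements pairs)) 0<width
      e = proj₁ avoiding

      uniform₁ = answers-uniform (inst P) e
      l₁ = suc (l₀ ⊔ proj₁ uniform₁)

      l₀<l₁ : l₀ ℕ.< l₁
      l₀<l₁ = ℕ.s≤s (ℕ.m≤m⊔n l₀ (proj₁ uniform₁))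

      fine₁ = scaled-archimedean (0≤* 0≤2 0≤C) (0<2⁻n (suc (suc l₁)))
      fine₂ = archimedean η 0<η
      f = proj₁ fine₁ ⊔ proj₁ fine₂

      fine : C * (2⁻ f + 2⁻ f) ≤ 2⁻ suc (suc l₁)
      fine = ℚ.≤-trans (ℚ.≤-reflexive (solve 2 (λ C x → C :* (x :+ x) := con 2ℚ :* C :* x) refl C (2⁻ f)))
        (ℚ.≤-trans (scale-≤ (0≤* 0≤2 0≤C) (2⁻-anti {proj₁ fine₁} {f} (ℕ.m≤m⊔n (proj₁ fine₁) (proj₁ fine₂))))
          (ℚ.≤-trans (ℚ.≤-reflexive (ℚ.*-comm (2ℚ * C) (2⁻ proj₁ fine₁))) (proj₂ fine₁)))

      f≤η : 2⁻ f ≤ η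
      f≤η = ℚ.≤-trans (2⁻-anti {proj₁ fine₂} {f} (ℕ.m≤n⊔m (proj₁ fine₁) (proj₁ fine₂))) (proj₂ fine₂)

      classes : ∀ α → ∃[ c ] ∀ J β → inst P ∼[ l₀ ] J → α ≈[ l₀ ] β → (q : In J β) → class q ≡ c
      classes α =
        let c , _ , const = proj₂ uniform₀ α
        in c , λ J β P∼J α≈β q → proj₁ (const J β (∼-anti (ℕ.n≤1+n _) P∼J) (≈-anti (ℕ.n≤1+n _) α≈β) q)

      values : ∀ α → ∃[ z ] ∀ J β → inst P ∼[ l₁ ] J → α ≈[ l₁ ] β → (q : In J β) → ζ q e ≡ z
      values α =
        let _ , z , const = proj₂ uniform₁ α
            ≤l₁           = ℕ.≤-trans (ℕ.m≤n⊔m l₀ (proj₁ uniform₁)) (ℕ.n≤1+n _)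
        in z , λ J β P∼J α≈β q → proj₂ (const J β (∼-anti ≤l₁ P∼J) (≈-anti ≤l₁ α≈β) q)

      from-P₁ : ∃[ P₁ ] inst P ∼[ s ⊔ l₁ ] inst P₁ ×
        (∀ {c} → c ℕ.< suc d → Same-interval P P₁ c) × Thin (suc d) C (2⁻ f) (inst P₁) →
                ∃[ Q ] inst P ∼[ s ] inst Q × (∀ {c} → c ℕ.< d → Same-interval P Q c) × Thin d (A * C) η (inst Q)
      from-P₁ (P₁ , P∼P₁ , same , ι , l , thin) =
        P₂ , ∼-anti (ℕ.m≤m⊔n s l₁) P∼P₂
        , (λ c<d → trans (proj₁ (others (ℕ.<⇒≢ c<d))) (proj₁ (same (ℕ.m≤n⇒m≤1+n c<d)))
                 , trans (proj₂ (others (ℕ.<⇒≢ c<d))) (proj₂ (same (ℕ.m≤n⇒m≤1+n c<d))))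
        , thin-step {h = h} {ng = ng} ι (inst P) (inst P₁) P₂ z 0≤C refl 1≤A 0<η (0<2⁻n f) f≤η d≤k+1 ℕ.z<s l₀<l₁
            (proj₂ h-small) (ℚ.≤-trans (2⁻-step ng) (proj₂ grid-mesh)) fine classes thin
            (∼-anti (ℕ.m≤n⊔m s l₁) P∼P₂)
            (λ p → near-P₁ (inst P₂) (∼-anti (ℕ.m≤n⊔m (s ⊔ l₁) late-P₁) P₁∼P₂) p)
            (λ g u → proj₂ (listing g u))
            avoids
        where
        listing = λ (g : Vec (Vec Digit n) (suc ng)) (u : Vec (Vec Digit k) l₀) →
          list ι l (inst P) (inst P₁) (2⁻ f) l₀<l₁ e values (grid-point ng g) (u ++ˢ some-path)

        z : Vec (Vec Digit n) (suc ng) → Vec (Vec Digit k) l₀ → ℚ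
        z g u = proj₁ (listing g u)

        zs = map (λ (g , u) → z g u) (elements pairs)

        interval : ∃[ a ] ∃[ b ] lo P d ≤ a × a < b × b ≤ hi P d × (∀ {z} → z ∈ zs → ¬ (a ≤ z + 2⁻ e × z ≤ b + 2⁻ e))
        interval = proj₂ avoiding (lo P d) (hi P d)
          (ℚ.≤-reflexive (solve 2 (λ a b → a :+ (b :- a) := b) refl (lo P d) (hi P d)))
          zs (length-map _ (elements pairs))
        a = proj₁ interval
        b = proj₁ (proj₂ interval)

        -- Shrinking beyond this stage keeps the solutions so close to those of `P₁` that its
        -- thinness still governs them.
        lateness = late (inst P₁) (suc (suc l))
        late-P₁ = proj₁ lateness
        near-P₁ = proj₂ lateness

        -- The level above has not touched class `d`, so the subinterval found in the interval of
        -- `P` is admissible in `P₁`.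
        shrunk = shrink P₁ ((s ⊔ l₁) ⊔ late-P₁) d
          (subst (_≤ a) (sym (proj₁ (same ℕ.≤-refl))) (proj₁ (proj₂ (proj₂ interval))))
          (proj₁ (proj₂ (proj₂ (proj₂ interval))))
          (subst (b ≤_) (sym (proj₂ (same ℕ.≤-refl))) (proj₁ (proj₂ (proj₂ (proj₂ (proj₂ interval))))))
        P₂ = proj₁ shrunk
        P₁∼P₂ = proj₁ (proj₂ shrunk)
        others : ∀ {c} → c ≢ d → lo P₂ c ≡ lo P₁ c × hi P₂ c ≡ hi P₁ c
        others = proj₂ (proj₂ (proj₂ (proj₂ shrunk)))

        P∼P₂ : inst P ∼[ s ⊔ l₁ ] inst P₂
        P∼P₂ = ∼-trans P∼P₁ (∼-anti (ℕ.m≤m⊔n (s ⊔ l₁) late-P₁) P₁∼P₂)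

        avoids : ∀ g u → ¬ (lo P₂ d ≤ z g u + 2⁻ e × z g u ≤ hi P₂ d + 2⁻ e)
        avoids g u (≤z , z≤) = proj₂ (proj₂ (proj₂ (proj₂ (proj₂ interval))))
          (∈-map⁺ (λ (g , u) → z g u) (complete pairs (g , u)))
          ( subst (_≤ z g u + 2⁻ e) (proj₁ (proj₂ (proj₂ shrunk))) ≤z
          , subst (λ b → z g u ≤ b + 2⁻ e) (proj₁ (proj₂ (proj₂ (proj₂ shrunk)))) z≤)

    reducible-all : ∀ d → d ℕ.≤ suc k → ∀ {C} → 1ℚ ≤ C → Reducible d C → ∃[ C′ ] 1ℚ ≤ C′ × Reducible 0 C′
    reducible-all zero    _     {C} 1≤C r = C , 1≤C , r
    reducible-all (suc d) d<k+1 {C} 1≤C r =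
      reducible-all d (ℕ.<⇒≤ d<k+1) (1≤AC) (reduce (ℕ.<⇒≤ d<k+1) 1≤C r)
      where
      1≤AC : 1ℚ ≤ 2ℚ * card (suc d) * C
      1≤AC = linear (scale-≤ (0≤card d) (ℚ.≤-trans 0≤1 1≤C) ⊕ scale-≤ (0≤card d) (ℚ.≤-trans 0≤1 1≤C) ⊕ 1≤C ⊕ 1≤C
        ⊕ 0≤1)
        (solve 2 (λ c C → con 1ℚ :+ (c :* C :+ (c :* C :+ (C :+ (C :+ con 1ℚ)))) :=
                          con 2ℚ :* (con 1ℚ :+ c) :* C :+
                            (c :* con 0ℚ :+ (c :* con 0ℚ :+ (con 1ℚ :+ (con 1ℚ :+ con 0ℚ))))) refl (card d) C)

    -- Over no coordinates the premise of thinness is vacuous, so all solutions are close together.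
    -- A solution of the collapse to class 1 then comes into the radius of a prefix of a centred
    -- solution of the collapse to class 0, and this prefix decides the class.
    no-game : ⊥
    no-game = from-P₁ (reducible initial l₀ (0<2⁻n f))
      where
      C = proj₁ (reducible-all k (ℕ.n≤1+n k) ℚ.≤-refl reducible-top)
      1≤C : 1ℚ ≤ C
      1≤C = proj₁ (proj₂ (reducible-all k (ℕ.n≤1+n k) ℚ.≤-refl reducible-top))
      reducible : Reducible 0 C
      reducible = proj₂ (proj₂ (reducible-all k (ℕ.n≤1+n k) ℚ.≤-refl reducible-top))

      uniform₀ = answers-uniform (inst initial) 0
      l₀ = suc (proj₁ uniform₀)
      fineness = scaled-archimedean (ℚ.≤-trans 0≤1 1≤C) (0<2⁻n (suc (suc l₀)))
      f = proj₁ fineness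

      from-P₁ : ∃[ P ] inst initial ∼[ l₀ ] inst P ×
        (∀ {c} → c ℕ.< 0 → Same-interval initial P c) × Thin 0 C (2⁻ f) (inst P) → ⊥
      from-P₁ (P , i∼P , _ , ι , l , thin) = contradiction (trans (sym class-1) rerouted-class) λ ()
        where
        l′ = l ℕ.+ (3 ℕ.+ l₀)
        m = proj₁ (late (inst P) l′)

        close-to-P : ∀ J → inst P ∼[ m ] J → ∀ {α} → In J α → S l (inst P) (point α l′)
        close-to-P J P∼J {α} p =
          let β , β≈α , q = proj₂ (late (inst P) l′) J P∼J p
          in S-mono (ℕ.m≤m+n l (3 ℕ.+ l₀))
               (by β q λ i → subst (Within (2⁻ l′) (λ n → point β n i)) (point-cong l′ β≈α i)
                 (center-within (coord β i) l′))

        J₀ = collapse P (m ⊔ l₀) {0} ℕ.z≤n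
        J₁ = collapse P (m ⊔ l₀) {1} (ℕ.s≤s ℕ.z≤n)
        solution₀ = centre (proj₂ (nonempty (proj₁ J₀)))
        solution₁ = nonempty (proj₁ J₁)
        α = proj₁ solution₀
        β = proj₁ solution₁

        same-point : ∀ i → Near (2⁻ suc (suc l₀)) (point β l′ i) (point α l′ i)
        same-point i = near-mono (ℚ.≤-trans (ℚ.≤-reflexive (ℚ.*-comm C (2⁻ f))) (proj₂ fineness))
          (thin (point β l′) (point α l′) (close-to-P (proj₁ J₁) (∼-anti (ℕ.m≤m⊔n m l₀) (proj₁ (proj₂ J₁)))
            (proj₂ solution₁))
            (close-to-P (proj₁ J₀) (∼-anti (ℕ.m≤m⊔n m l₀) (proj₁ (proj₂ J₀))) (proj₁ (proj₂ solution₀)))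
            (2⁻ f) ℚ.≤-refl (λ ()) i)

        l′-fine : 2⁻ l′ ≤ 2⁻ (3 ℕ.+ l₀)
        l′-fine = 2⁻-anti {3 ℕ.+ l₀} {l′} (ℕ.m≤n+m (3 ℕ.+ l₀) l)

        near-α : ∀ i → Within (2⁻ l₀) (λ n → point β n i) (point α l₀ i)
        near-α i = within-mono (linear (l′-fine ⊕ l′-fine)
            (solve 2 (λ x e → let t = con ½ :* (con ½ :* (con ½ :* e)) in
              x :+ con ½ :* (con ½ :* e) :+ (x :+ con ½ :* e) :+ (t :+ t) := e :+ (x :+ x)) refl (2⁻ l′) (2⁻ l₀)))
          (within-trans (within-trans (center-within (coord β i) l′) (same-point i))
            (within-near (center-within (coord α i) l′) (proj₂ (proj₂ solution₀) l₀ ℕ.z<s i)))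

        rerouted = reroute l₀ α (proj₂ solution₁) near-α
        γ = proj₁ rerouted
        q = proj₂ (proj₂ rerouted)

        class-of : ∀ J → inst P ∼[ m ⊔ l₀ ] J → ∀ δ → α ≈[ l₀ ] δ → (q : In J δ) → class q ≡ proj₁ (proj₂ uniform₀ α)
        class-of J P∼J δ α≈δ q = proj₁ (proj₂ (proj₂ (proj₂ uniform₀ α)) J δ
          (∼-anti (ℕ.n≤1+n _) (∼-trans i∼P (∼-anti (ℕ.m≤n⊔m m l₀) P∼J))) (≈-anti (ℕ.n≤1+n _) α≈δ) q)

        class-1 : class q ≡ 1
        class-1 = proj₂ (proj₂ J₁) q

        rerouted-class : class q ≡ 0
        rerouted-class = trans (class-of (proj₁ J₁) (proj₁ (proj₂ J₁)) γ (≈-sym (proj₁ (proj₂ rerouted))) q)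
          (trans (sym (class-of (proj₁ J₀) (proj₁ (proj₂ J₀)) α (≈-refl l₀) (proj₁ (proj₂ solution₀))))
                 (proj₂ (proj₂ J₀) (proj₁ (proj₂ solution₀))))

-- Continuity of computable functions; programs for the reductions

module Programs where

  open import Data.Fin using (zero; suc)
  open import Data.Nat using (ℕ; zero; suc; _+_; _<_; _⊔_; s≤s; z<s)
  open import Data.Vec using (Vec; []; _∷_; head)
  open import Data.Vec.Relation.Binary.Pointwise.Inductive using (Pointwise; []; _∷_)
  open import Defs
  open Fan

  open PartialFunction using (Graph)

  -- The use principle: a halting computation has consulted only a finite part of its oracle.
  Use : Baire → (Baire → Set) → Set
  Use p Q = ∃[ m ] ∀ p′ → p ≈[ m ] p′ → Q p′

  use-map : ∀ {p Q R} → (∀ {p′} → Q p′ → R p′) → Use p Q → Use p R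
  use-map f (m , u) = m , λ p′ p≈p′ → f (u p′ p≈p′)

  use-both : ∀ {p Q R} → Use p Q → Use p R → Use p (λ p′ → Q p′ × R p′)
  use-both (m , u) (n , v) = m ⊔ n , λ p′ p≈p′ →
    u p′ (≈-anti (ℕ.m≤m⊔n m n) p≈p′) , v p′ (≈-anti (ℕ.m≤n⊔m m n) p≈p′)

  use-below : ∀ {p} {Q : ℕ → Baire → Set} m → (∀ i → i < m → Use p (Q i)) → Use p (λ p′ → ∀ i → i < m → Q i p′)
  use-below zero    u = 0 , λ _ _ _ ()
  use-below {Q = Q} (suc m) u =
    use-map (λ { (Qm , Q<m) i i<1+m → case i Qm Q<m (ℕ.m≤n⇒m<n∨m≡n (ℕ.≤-pred i<1+m)) })
      (use-both (u m ℕ.≤-refl) (use-below m λ i i<m → u i (ℕ.m≤n⇒m≤1+n i<m)))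
    where
    open import Data.Sum using (_⊎_; inj₁; inj₂)
    case : ∀ {p′} i → Q m p′ → (∀ j → j < m → Q j p′) → i < m ⊎ i ≡ m → Q i p′
    case i Qm Q<m (inj₁ i<m)  = Q<m i i<m
    case i Qm Q<m (inj₂ refl) = Qm

  ⊢-use : ∀ {p n} {e : Program n} {xs y} → p ⊢ e · xs ⇓ y → Use p (_⊢ e · xs ⇓ y)
  ⊢-uses : ∀ {p m n} {gs : Vec (Program n) m} {xs ys} → Pointwise (λ g y → p ⊢ g · xs ⇓ y) gs ys →
           Use p (λ p′ → Pointwise (λ g y → p′ ⊢ g · xs ⇓ y) gs ys)
  ⊢-use zeroᵖ      = 0 , λ _ _ → zeroᵖ
  ⊢-use sucᵖ       = 0 , λ _ _ → sucᵖ
  ⊢-use {p} (oracle {x}) = suc x , λ p′ p≈p′ → subst (p′ ⊢ oracle · x ∷ [] ⇓_) (sym (p≈p′ x ℕ.≤-refl)) oracle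
  ⊢-use (proj i)   = 0 , λ _ _ → proj i
  ⊢-use (comp ds d) = use-map (λ (ds , d) → comp ds d) (use-both (⊢-uses ds) (⊢-use d))
  ⊢-use (prec-z d) = use-map prec-z (⊢-use d)
  ⊢-use (prec-s d d′) = use-map (λ (d , d′) → prec-s d d′) (use-both (⊢-use d) (⊢-use d′))
  ⊢-use (μ {m = m} ds d) = use-map (λ (ds , d) → μ ds d)
    (use-both (use-below m λ i i<m → use-map (λ d → proj₁ (ds i i<m) , d) (⊢-use (proj₂ (ds i i<m)))) (⊢-use d))
  ⊢-uses []       = 0 , λ _ _ → []
  ⊢-uses (d ∷ ds) = use-map (λ (d , ds) → d ∷ ds) (use-both (⊢-use d) (⊢-uses ds))

  ⊢-functional : ∀ {p n} {e : Program n} {xs y z} → p ⊢ e · xs ⇓ y → p ⊢ e · xs ⇓ z → y ≡ z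
  ⊢-functionals : ∀ {p m n} {gs : Vec (Program n) m} {xs ys zs} → Pointwise (λ g y → p ⊢ g · xs ⇓ y) gs ys →
                  Pointwise (λ g y → p ⊢ g · xs ⇓ y) gs zs → ys ≡ zs
  ⊢-functional zeroᵖ zeroᵖ = refl
  ⊢-functional sucᵖ sucᵖ = refl
  ⊢-functional oracle oracle = refl
  ⊢-functional (proj i) (proj .i) = refl
  ⊢-functional (comp ds d) (comp ds′ d′) with refl ← ⊢-functionals ds ds′ = ⊢-functional d d′
  ⊢-functional (prec-z d) (prec-z d′) = ⊢-functional d d′
  ⊢-functional (prec-s d e) (prec-s d′ e′) with refl ← ⊢-functional d d′ = ⊢-functional e e′
  ⊢-functional (μ {m = m} ds d) (μ {m = m′} ds′ d′) = ℕ.≤-antisym (ℕ.≮⇒≥ (below ds d′)) (ℕ.≮⇒≥ (below ds′ d))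
    where
    below : ∀ {p n} {f : Program (suc n)} {xs m m′} → (∀ i → i < m → ∃[ y ] p ⊢ f · i ∷ xs ⇓ suc y) →
            p ⊢ f · m′ ∷ xs ⇓ 0 → m′ < m → _
    below ds d m′<m with () ← ⊢-functional (proj₂ (ds _ m′<m)) d
  ⊢-functionals [] [] = refl
  ⊢-functionals (d ∷ ds) (d′ ∷ ds′) = cong₂ _∷_ (⊢-functional d d′) (⊢-functionals ds ds′)

  -- The program repeats its first N computations on every oracle with the same finite part. Its
  -- results there agree with F only where F is defined, hence the condition on `q′`.
  continuous : ∀ {F} → Computable F → ∀ {p q} → Graph F p q → ∀ N →
               Use p (λ p′ → ∀ q′ → Graph F p′ q′ → q ≈[ N ] q′)
  continuous (e , computes) Fpq N = use-map
    (λ ds q′ Fp′q′ i i<N → ⊢-functional (ds i i<N) (computes Fp′q′ i))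
    (use-below N λ i i<N → ⊢-use (computes Fpq i))

  fromFunction : (f : Baire → Baire) → (∀ {p p′} → p ≗ p′ → f p ≗ f p′) → PartialFunction
  fromFunction f f-cong = record
    { Graph      = λ p q → q ≗ f p
    ; resp       = λ p≗p′ q≗q′ q≗fp n → trans (sym (q≗q′ n)) (trans (q≗fp n) (f-cong p≗p′ n))
    ; functional = λ q≗fp q′≗fp n → trans (q≗fp n) (sym (q′≗fp n))
    }

  infix 4 _computes_
  _computes_ : ∀ {n} → Program n → (Baire → Vec ℕ n → ℕ) → Set
  e computes f = ∀ p xs → p ⊢ e · xs ⇓ f p xs

  fromFunction-computable : ∀ {f : Baire → Baire} {f-cong : ∀ {p p′} → p ≗ p′ → f p ≗ f p′} (e : Program 1) →
    e computes (λ p ns → f p (head ns)) →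
                            Computable (fromFunction f (λ {p} {p′} → f-cong {p} {p′}))
  fromFunction-computable e d = e , λ {p} q≗fp n → subst (p ⊢ e · n ∷ [] ⇓_) (sym (q≗fp n)) (d p (n ∷ []))

  double : ℕ → ℕ
  double zero    = zero
  double (suc n) = suc (suc (double n))

  doubleᵖ : Program 1
  doubleᵖ = prec zeroᵖ (comp sucᵖ (comp sucᵖ (proj (suc zero) ∷ []) ∷ []))

  doubleᵖ-computes : doubleᵖ computes λ { p (n ∷ []) → double n }
  doubleᵖ-computes p (zero  ∷ []) = prec-z zeroᵖ
  doubleᵖ-computes p (suc n ∷ []) =
    prec-s (doubleᵖ-computes p (n ∷ [])) (comp (comp (proj _ ∷ []) sucᵖ ∷ []) sucᵖ)

  addᵖ : Program 2
  addᵖ = prec (proj zero) (comp sucᵖ (proj (suc zero) ∷ []))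

  addᵖ-computes : addᵖ computes λ { p (m ∷ n ∷ []) → m + n }
  addᵖ-computes p (zero  ∷ n ∷ []) = prec-z (proj _)
  addᵖ-computes p (suc m ∷ n ∷ []) = prec-s (addᵖ-computes p (m ∷ n ∷ [])) (comp (proj _ ∷ []) sucᵖ)

  triangleᵖ : Program 1
  triangleᵖ = prec zeroᵖ (comp addᵖ (comp sucᵖ (proj zero ∷ []) ∷ proj (suc zero) ∷ []))

  triangleᵖ-computes : triangleᵖ computes λ { p (n ∷ []) → triangle n }
  triangleᵖ-computes p (zero  ∷ []) = prec-z zeroᵖ
  triangleᵖ-computes p (suc n ∷ []) =
    prec-s (triangleᵖ-computes p (n ∷ [])) (comp (comp (proj _ ∷ []) sucᵖ ∷ proj _ ∷ []) (addᵖ-computes p _))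

  pairᵖ : Program 2
  pairᵖ = comp addᵖ (proj (suc zero) ∷ comp triangleᵖ (addᵖ ∷ []) ∷ [])

  pairᵖ-computes : pairᵖ computes λ { p (m ∷ n ∷ []) → pair m n }
  pairᵖ-computes p (m ∷ n ∷ []) =
    comp (proj _ ∷ comp (addᵖ-computes p _ ∷ []) (triangleᵖ-computes p _) ∷ []) (addᵖ-computes p _)

  constᵖ : ∀ {n} → ℕ → Program n
  constᵖ zero    = zeroᵖ
  constᵖ (suc c) = comp sucᵖ (constᵖ c ∷ [])

  constᵖ-computes : ∀ {n} c → constᵖ {n} c computes λ _ _ → c
  constᵖ-computes zero    p xs = zeroᵖ
  constᵖ-computes (suc c) p xs = comp (constᵖ-computes c p xs ∷ []) sucᵖ

  even odd : Baire → Baire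
  even p n = p (double n)
  odd  p n = p (suc (double n))

  even-⟨,⟩ : ∀ p q → even ⟨ p , q ⟩ ≗ p
  odd-⟨,⟩ : ∀ p q → odd ⟨ p , q ⟩ ≗ q
  even-⟨,⟩ p q zero    = refl
  even-⟨,⟩ p q (suc n) = even-⟨,⟩ (p ∘ suc) (q ∘ suc) n
  odd-⟨,⟩ p q zero    = refl
  odd-⟨,⟩ p q (suc n) = odd-⟨,⟩ (p ∘ suc) (q ∘ suc) n

  ⟨,⟩-≈ : ∀ {p p′ q q′} n → p ≈[ n ] p′ → q ≈[ n ] q′ → ⟨ p , q ⟩ ≈[ n ] ⟨ p′ , q′ ⟩
  ⟨,⟩-≈ (suc n) p≈p′ q≈q′ zero    _          = p≈p′ 0 z<s
  ⟨,⟩-≈ (suc n) p≈p′ q≈q′ (suc m) (s≤s m<n) =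
    ⟨,⟩-≈ n (≈-anti (ℕ.n≤1+n n) q≈q′) (λ i i<n → p≈p′ (suc i) (s≤s i<n)) m m<n

  evenᵖ : Program 1
  evenᵖ = comp oracle (doubleᵖ ∷ [])

  evenᵖ-computes : evenᵖ computes λ p ns → even p (head ns)
  evenᵖ-computes p (n ∷ []) = comp (doubleᵖ-computes p (n ∷ []) ∷ []) oracle

  prefixSum : ℕ → Baire → ℕ
  prefixSum zero    p = 0
  prefixSum (suc n) p = prefixSum n p + p n

  prefixSum-cong : ∀ n {p q} → p ≈[ n ] q → prefixSum n p ≡ prefixSum n q
  prefixSum-cong zero    p≈q = refl
  prefixSum-cong (suc n) p≈q = cong₂ _+_ (prefixSum-cong n (≈-anti (ℕ.n≤1+n n) p≈q)) (p≈q n ℕ.≤-refl)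

  -- From q = ⟨ ⟨ α , β ⟩ , r ⟩, the c-th section of β where c = r₀ + … + rₙ₋₁.
  selected : ℕ → Baire → Baire
  selected n q i = q (double (suc (double (pair i (prefixSum n (odd q))))))

  selected-cong : ∀ n {p q} → p ≗ q → selected n p ≗ selected n q
  selected-cong n {p} {q} p≗q i = trans
    (cong (λ c → p (double (suc (double (pair i c))))) (prefixSum-cong n λ m _ → p≗q (suc (double m))))
    (p≗q _)

  prefixSumᵖ : ℕ → Program 1
  prefixSumᵖ zero    = zeroᵖ
  prefixSumᵖ (suc n) = comp addᵖ (prefixSumᵖ n ∷ comp oracle (constᵖ (suc (double n)) ∷ []) ∷ [])

  prefixSumᵖ-computes : ∀ n → prefixSumᵖ n computes λ p _ → prefixSum n (odd p)
  prefixSumᵖ-computes zero    p xs = zeroᵖ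
  prefixSumᵖ-computes (suc n) p xs = comp
    (prefixSumᵖ-computes n p xs ∷ comp (constᵖ-computes (suc (double n)) p xs ∷ []) oracle ∷ [])
    (addᵖ-computes p _)

  selectedᵖ : ℕ → Program 1
  selectedᵖ n = comp oracle (comp doubleᵖ (comp sucᵖ (comp doubleᵖ
    (comp pairᵖ (proj zero ∷ prefixSumᵖ n ∷ []) ∷ []) ∷ []) ∷ []) ∷ [])

  selectedᵖ-computes : ∀ n → selectedᵖ n computes λ p is → selected n p (head is)
  selectedᵖ-computes n p (i ∷ []) =
    comp (comp (comp (comp (comp (proj zero ∷ prefixSumᵖ-computes n p (i ∷ []) ∷ []) (pairᵖ-computes p _) ∷ [])
      (doubleᵖ-computes p _) ∷ []) sucᵖ ∷ []) (doubleᵖ-computes p _) ∷ []) oracle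

-- The two factors of the composition; closed sets from associates

module Reductions where

  open import Data.Bool using (Bool; true; false; if_then_else_)
  open import Data.Nat using (ℕ)
  open import Data.Vec using ([]; _∷_; head)
  open import Function using (_∘_; _⇔_; mk⇔; Func)
  open import Relation.Binary using (_Respects_)
  open import Relation.Nullary using (¬_; yes; no; contradiction; does)
  open import Relation.Nullary.Decidable using (dec-true; dec-false)
  open import Defs
  open Programs

  𝔹 : RepresentedSpace
  𝔹 = record
    { points     = ℕ →-setoid ℕ
    ; _names_    = _≗_
    ; resp       = λ p≗q x≗y p≗x n → trans (sym (p≗q n)) (trans (p≗x n) (x≗y n))
    ; functional = λ p≗x p≗y n → trans (sym (p≗x n)) (p≗y n)
    ; surjective = λ x → x , λ _ → refl
    }

  rename : ∀ X {p q} x → p ≗ q → RepresentedSpace._names_ X p x → RepresentedSpace._names_ X q x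
  rename X x p≗q = RepresentedSpace.resp X p≗q (RepresentedSpace.≈.refl X {x})

  -- The problem f for the instance with name φ q, returning q along with a name of the solution.
  record Lifted {X Y} (φ : Baire → Baire) (f : X ⇉ Y) (q o : Baire) : Set where
    constructor lifted
    private
      module X = RepresentedSpace X
      module Y = RepresentedSpace Y
    field
      {input}     : X.Carrier
      {output}    : Y.Carrier
      {name}      : Baire
      names-input : φ q X.names input
      solves      : _⇉_._↦_ f input output
      names-output : name Y.names output
      paired      : o ≗ ⟨ q , name ⟩

  -- Handing the input on is what makes the composition expressive: the second factor sees only the
  -- output of the first, yet needs the instance to find its interval.
  lift : ∀ {X Y} (φ : Baire → Baire) → (∀ {p q} → p ≗ q → φ p ≗ φ q) → X ⇉ Y → 𝔹 ⇉ 𝔹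
  lift {X} φ φ-cong f = record
    { _↦_  = Lifted φ f
    ; resp = λ q≗q′ o≗o′ (lifted names-x fxy names-y o≗) →
        lifted (RepresentedSpace.resp X (φ-cong q≗q′) (RepresentedSpace.≈.refl X) names-x) fxy names-y
          (λ n → trans (sym (o≗o′ n)) (trans (o≗ n) (⟨,⟩-cong q≗q′ (λ _ → refl) n)))
    }

  lift-≤W : ∀ {X Y} {φ : Baire → Baire} (φ-cong : ∀ {p q} → p ≗ q → φ p ≗ φ q) {f : X ⇉ Y} (e : Program 1) →
            e computes (λ p ns → φ p (head ns)) → lift φ φ-cong f ≤W f
  lift-≤W {X} {φ = φ} φ-cong {f} e e-computes =
    fromFunction φ φ-cong , fromFunction (λ p → p) (λ p≗q → p≗q)
    , fromFunction-computable {φ} {φ-cong} e e-computes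
    , fromFunction-computable {λ p → p} {λ p≗q → p≗q} oracle (λ { p (n ∷ []) → oracle })
    , λ G G⊩f p x p≗x → λ { (_ , lifted {input = u} names-u fuv _ _) →
        let φp-names-u = RepresentedSpace.resp X (φ-cong (sym ∘ p≗x)) (RepresentedSpace.≈.refl X) names-u
            r , Gr , y , r-names-y , fuy = G⊩f (φ p) u φp-names-u (_ , fuv)
        in ⟨ p , r ⟩ , (φ p , r , (λ _ → refl) , Gr , λ _ → refl)
           , ⟨ p , r ⟩ , (λ _ → refl) , lifted names-u fuy r-names-y (⟨,⟩-cong p≗x λ _ → refl) }

  g₁ : 𝔹 ⇉ 𝔹
  g₁ = lift even (λ p≗q n → p≗q (double n)) AoUC

  f₁ : ℕ → 𝔹 ⇉ 𝔹
  f₁ n = lift (selected n) (selected-cong n) (XC 1)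

  g₁≤AoUC : g₁ ≤W AoUC
  g₁≤AoUC = lift-≤W {φ = even} (λ p≗q n → p≗q (double n)) evenᵖ evenᵖ-computes

  f₁≤XC₁ : ∀ n → f₁ n ≤W XC 1
  f₁≤XC₁ n = lift-≤W {φ = selected n} (selected-cong n) (selectedᵖ n) (selectedᵖ-computes n)

  module _ (em : ExcludedMiddle 0ℓ) (X : RepresentedSpace) where
    private module X = RepresentedSpace X

    -- Excluded middle supplies the characteristic function; the associate `α` only has to recognise
    -- the complement.
    closed-set : ∀ α (P : X.Carrier → Set) → P Respects X._≈_ →
      (∀ r x → r X.names x → ∃[ q ] α ∙ r ≈> q × (P x → ∀ n → q n ≡ 0) × (¬ P x → ∃[ n ] q n ≢ 0)) →
      ∃ λ (A : RepresentedSpace.Carrier (𝒜 X)) → RepresentedSpace._names_ (𝒜 X) α A × ∀ x → x ∈[ X ] A ⇔ P x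
    closed-set α P P-resp total = (χ , α , assoc) , assoc , λ x → mk⇔ (∈⇒P x) (P⇒∈ x)
      where
      f : X.Carrier → Bool
      f x = if does (em {P x}) then false else true

      f-yes : ∀ {x} → P x → f x ≡ false
      f-yes {x} Px = cong (if_then false else true) (dec-true em Px)

      f-no : ∀ {x} → ¬ P x → f x ≡ true
      f-no {x} ¬Px = cong (if_then false else true) (dec-false em ¬Px)

      f-cong : ∀ {x y} → x X.≈ y → f x ≡ f y
      f-cong {x} {y} x≈y with em {P x}
      ... | yes Px = sym (f-yes (P-resp x≈y Px))
      ... | no ¬Px = sym (f-no λ Py → ¬Px (P-resp (X.≈.sym x≈y) Py))

      χ : Func X.points (RepresentedSpace.points 𝕊)
      χ = record { to = f ; cong = f-cong }

      assoc : _IsAssociateOf_ X 𝕊 α χ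
      assoc r x names-x with total r x names-x | em {P x}
      ... | q , d , in-P , out-P | yes Px = q , d , in-P Px
      ... | q , d , in-P , out-P | no ¬Px = q , d , out-P ¬Px

      P⇒∈ : ∀ x → P x → f x ≡ false
      P⇒∈ x = f-yes

      ∈⇒P : ∀ x → f x ≡ false → P x
      ∈⇒P x fx with em {P x}
      ... | yes Px = Px
      ... | no ¬Px = contradiction fx λ ()

-- Intervals with rational ends as convex closed sets

module Intervals where

  open import Data.Nat as ℕ using (ℕ; suc; _⊔_)
  open import Data.Rational hiding (_⊔_; _/_)
  open import Relation.Nullary.Decidable using (_⊎-dec_)
  open import Defs
  open Rationals

  open Real using (approx; regular)

  Interval : Set
  Interval = ℚ × ℚ

  -- The n-th entry `v` of a name has error at most 2⁻ⁿ, so this is finite evidence that the real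
  -- lies outside.
  Outside : Interval → ℕ → ℚ → Set
  Outside (a , b) n v = v + 2⁻ n < a ⊎ b + 2⁻ n < v

  outside? : ∀ I n v → Dec (Outside I n v)
  outside? (a , b) n v = (v + 2⁻ n <? a) ⊎-dec (b + 2⁻ n <? v)

  InInterval : Interval → (ℕ → ℚ) → Set
  InInterval (a , b) z = ∀ m → a ≤ z m + 2⁻ m × z m ≤ b + 2⁻ m

  close⇒near : ∀ {a b} → Close a b → ∀ m n → Near (2⁻ m + 2⁻ n) (a m) (b n)
  close⇒near {a} {b} (close ab) m n = ∣∣≤⇒Near {a = a m} {b n} (ab m n)

  InInterval-same : ∀ {J z z′} → Close z z′ → InInterval J z → InInterval J z′
  InInterval-same {a , b} {z} {z′} zz′ inJ m =
      ≤-limit (λ n → linear (proj₁ (inJ (suc n)) ⊕ below (close⇒near zz′ (suc n) m))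
        (solve 5 (λ a z z′ x y → a :+ (z :+ con ½ :* x :+ (z′ :+ (con ½ :* x :+ y))) := z′ :+ y :+ x :+ (a :+ z))
          refl a (z (suc n)) (z′ m) (2⁻ n) (2⁻ m)))
    , ≤-limit (λ n → linear (proj₂ (inJ (suc n)) ⊕ above (close⇒near zz′ (suc n) m))
        (solve 5 (λ b z z′ x y → z′ :+ (b :+ con ½ :* x :+ (z :+ (con ½ :* x :+ y))) := b :+ y :+ x :+ (z :+ z′))
          refl b (z (suc n)) (z′ m) (2⁻ n) (2⁻ m)))

  name-bounds : ∀ {J v z} → Close v z → InInterval J z → ∀ n →
                proj₁ J ≤ v n + 2⁻ n × v n ≤ proj₂ J + 2⁻ n
  name-bounds {J} vz inJ = InInterval-same {J} (Close-sym vz) inJ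

  inside : ∀ {J K v z} n → proj₁ J ≤ proj₁ K → proj₂ K ≤ proj₂ J → Close v z → InInterval K z →
           ¬ Outside J n (v n)
  inside {J} {K} {v} {z} n J≤K K≤J vz inK (inj₁ v<J) = ℚ.<-irrefl refl
    (ℚ.<-≤-trans v<J (ℚ.≤-trans J≤K (proj₁ (name-bounds {K} vz inK n))))
  inside {J} {K} {v} {z} n J≤K K≤J vz inK (inj₂ J<v) = ℚ.<-irrefl refl
    (ℚ.<-≤-trans J<v (ℚ.≤-trans (proj₂ (name-bounds {K} vz inK n)) (ℚ.+-monoˡ-≤ (2⁻ n) K≤J)))

  strictly-finer : ∀ {p} → 0ℚ < p → ∀ T → ∃[ n ] T ℕ.≤ n × 2⁻ n + 2⁻ n < p
  strictly-finer {p} 0<p T = from (archimedean p 0<p)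
    where
    from : ∃[ e ] 2⁻ e ≤ p → ∃[ n ] T ℕ.≤ n × 2⁻ n + 2⁻ n < p
    from (e , 2⁻e≤p) = n , ℕ.m≤m⊔n T (suc (suc e)) , ℚ.≤-<-trans (n≤ ⊕ n≤)
        (ℚ.<-≤-trans (subst₂ _<_ (trans (ℚ.+-identityʳ (2⁻ suc e)) (sym (half+half (2⁻ suc e)))) (half+half (2⁻ e))
          (ℚ.+-monoʳ-< (2⁻ suc e) (0<2⁻n (suc e)))) 2⁻e≤p)
      where
      n = T ⊔ suc (suc e)
      n≤ : 2⁻ n ≤ 2⁻ suc (suc e)
      n≤ = 2⁻-anti {suc (suc e)} {n} (ℕ.m≤n⊔m T (suc (suc e)))

  positive-gap : ∀ {p q} → p < q → 0ℚ < q - p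
  positive-gap {p} {q} p<q = subst (_< q - p) (ℚ.+-inverseʳ p) (ℚ.+-monoˡ-< (- p) p<q)

  -- Evidence is wanted at a stage past `T`, since a play shows its final interval only from some
  -- stage on; the strict gap keeps it valid for all sufficiently fine approximations.
  outside-below : ∀ {J v z m} T → Close v z → z m + 2⁻ m < proj₁ J → ∃[ n ] T ℕ.≤ n × Outside J n (v n)
  outside-below {a , b} {v} {z} {m} T vz z<a =
    let n , T≤n , fine = strictly-finer (positive-gap z<a) T
    in n , T≤n , inj₁ (ℚ.≤-<-trans
         (linear (below (close⇒near vz n m))
           (solve 4 (λ v z x y → v :+ x :+ (z :+ (x :+ y)) := z :+ y :+ (x :+ x) :+ v) refl (v n) (z m) (2⁻ n)
             (2⁻ m)))
         (subst (z m + 2⁻ m + (2⁻ n + 2⁻ n) <_) (solve 2 (λ p a → p :+ (a :- p) := a) refl (z m + 2⁻ m) a)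
           (ℚ.+-monoʳ-< (z m + 2⁻ m) fine)))

  outside-above : ∀ {J v z m} T → Close v z → proj₂ J + 2⁻ m < z m → ∃[ n ] T ℕ.≤ n × Outside J n (v n)
  outside-above {a , b} {v} {z} {m} T vz b<z =
    let n , T≤n , fine = strictly-finer (positive-gap b<z) T
    in n , T≤n , inj₂ (ℚ.<-≤-trans
         (subst (_< z m - 2⁻ m - 2⁻ n) (solve 3 (λ b x y → b :+ y :+ (x :+ x) :- y :- x := b :+ x) refl b (2⁻ n)
           (2⁻ m))
           (ℚ.+-monoˡ-< (- 2⁻ n) (ℚ.+-monoˡ-< (- 2⁻ m)
             (subst (b + 2⁻ m + (2⁻ n + 2⁻ n) <_) (solve 2 (λ p a → p :+ (a :- p) := a) refl (b + 2⁻ m) (z m))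
               (ℚ.+-monoʳ-< (b + 2⁻ m) fine)))))
         (linear (above (close⇒near vz n m))
           (solve 4 (λ v z x y → z :- y :- x :+ (v :+ (x :+ y)) := v :+ z) refl (v n) (z m) (2⁻ n) (2⁻ m))))

  -- The approximations t of a real in [0,1] only satisfy −ε ≤ t ≤ 1 + ε.
  product-bound : ∀ {ε t u} → 0ℚ ≤ ε → ε ≤ 1ℚ → - ε ≤ t → t ≤ 1ℚ + ε → - ε ≤ u → u ≤ 2ℚ → - (2ℚ * ε) ≤ t * u
  product-bound {ε} {t} {u} 0≤ε ε≤1 ≤t t≤ ≤u u≤ with ℚ.≤-total 0ℚ t
  ... | inj₁ 0≤t = linear (scale-≤ 0≤t ≤u ⊕ scale-≤ 0≤ε t≤ ⊕ scale-≤ 0≤ε ε≤1)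
    (solve 3 (λ e t u → :- (con 2ℚ :* e) :+ (t :* u :+ (e :* (con 1ℚ :+ e) :+ e :* con 1ℚ)) :=
                        t :* u :+ (t :* :- e :+ (e :* t :+ e :* e))) refl ε t u)
  ... | inj₂ t≤0 = linear (scale-≤ 0≤-t u≤ ⊕ scale-≤ 0≤2 ≤t)
    (solve 3 (λ e t u → :- (con 2ℚ :* e) :+ (:- t :* con 2ℚ :+ con 2ℚ :* t) :=
      t :* u :+ (:- t :* u :+ con 2ℚ :* :- e)) refl ε t u)
    where
    0≤-t : 0ℚ ≤ - t
    0≤-t = linear t≤0 (solve 1 (λ t → con 0ℚ :+ con 0ℚ := :- t :+ t) refl t)
    0≤2 : 0ℚ ≤ 2ℚ
    0≤2 = linear (0≤1 ⊕ 0≤1) refl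

  unit-bounds : ∀ (t : RepresentedSpace.Carrier 𝕀) n →
                - 2⁻ n ≤ approx (proj₁ t) n × approx (proj₁ t) n ≤ 1ℚ + 2⁻ n
  unit-bounds (t , 0≤t , t≤1) n =
      ≤-limit (λ m → linear (0≤t m n)
        (solve 3 (λ t x y → :- x :+ (t :+ (y :+ x)) := t :+ y :+ con 0ℚ) refl (approx t n) (2⁻ n) (2⁻ m)))
    , ≤-limit (λ m → linear (t≤1 n m)
        (solve 3 (λ t x y → t :+ (con 1ℚ :+ (x :+ y)) := con 1ℚ :+ x :+ y :+ t) refl (approx t n) (2⁻ n) (2⁻ m)))

  private
    4ℚ : ℚ
    4ℚ = 2ℚ + 2ℚ

    -- With `a` subtracted from both points, two products remain, each of them at least -2ε.
    lower : ∀ {a ε t x y} → 0ℚ ≤ ε → ε ≤ 1ℚ → - ε ≤ t → t ≤ 1ℚ + ε → 0ℚ ≤ a →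
            a ≤ x + ε → x ≤ 1ℚ + ε → a ≤ y + ε → y ≤ 1ℚ + ε → a - 4ℚ * ε ≤ t * x + (1ℚ - t) * y
    lower {a} {ε} {t} {x} {y} 0≤ε ε≤1 ≤t t≤ 0≤a ≤x x≤ ≤y y≤ =
      linear (product-bound {u = x - a} 0≤ε ε≤1 ≤t t≤ (low {x} ≤x) (high {x} x≤)
              ⊕ product-bound {t = 1ℚ - t} {y - a} 0≤ε ε≤1
                  (linear t≤ (solve 2 (λ e t → :- e :+ (con 1ℚ :+ e) := con 1ℚ :- t :+ t) refl ε t))
                  (linear ≤t (solve 2 (λ e t → con 1ℚ :- t :+ t := con 1ℚ :+ e :+ :- e) refl ε t)) (low {y} ≤y)
                    (high {y} y≤))
        (solve 5 (λ a e t x y → a :- con 4ℚ :* e :+ (t :* (x :- a) :+ (con 1ℚ :- t) :* (y :- a)) :=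
                                t :* x :+ (con 1ℚ :- t) :* y :+ (:- (con 2ℚ :* e) :+ :- (con 2ℚ :* e)))
                                  refl a ε t x y)
      where
      low : ∀ {x} → a ≤ x + ε → - ε ≤ x - a
      low {x} ≤x = linear ≤x (solve 3 (λ a e x → :- e :+ (x :+ e) := x :- a :+ a) refl a ε x)
      high : ∀ {x} → x ≤ 1ℚ + ε → x - a ≤ 2ℚ
      high {x} x≤ = linear (x≤ ⊕ ε≤1 ⊕ 0≤a)
        (solve 3 (λ a e x → x :- a :+ (con 1ℚ :+ e :+ (con 1ℚ :+ a)) := con 2ℚ :+ (x :+ (e :+ con 0ℚ))) refl a ε x)

  -- The upper bound is the lower bound for the image under z ↦ 1 − z.
  InInterval-convex : ∀ {J} {x y z t : RepresentedSpace.Carrier 𝕀} → 0ℚ ≤ proj₁ J → proj₂ J ≤ 1ℚ →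
    InInterval J (approx (proj₁ x)) → InInterval J (approx (proj₁ y)) →
    proj₁ z ≈[ proj₁ t ] proj₁ x ⊹ proj₁ y → InInterval J (approx (proj₁ z))
  InInterval-convex {a , b} {x} {y} {z} {t} 0≤a b≤1 inx iny conv j =
      ≤-limit (λ n → let m , 6m≤ , near-z = close-combination n in
        linear (lower {a} {2⁻ m} {approx (proj₁ t) m} {approx (proj₁ x) m} {approx (proj₁ y) m}
                 (0≤2⁻ m) (2⁻≤1 m) (proj₁ (unit-bounds t m)) (proj₂ (unit-bounds t m)) 0≤a
                 (proj₁ (inx m)) (proj₂ (unit-bounds x m)) (proj₁ (iny m)) (proj₂ (unit-bounds y m))
                ⊕ below near-z ⊕ below (reg m j) ⊕ 6m≤)
          (solve 7 (λ a e c zm zj u v → a :+ (c :+ (zm :+ con ½ :* v :+ (zj :+ (e :+ u) :+ con ½ :* v))) :=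
                                        zj :+ u :+ v :+ (a :- con
                                          4ℚ :* e :+ (c :+ (zm :+ (con 2ℚ :+ con 2ℚ :+ con 1ℚ) :* e)))) refl
            a (2⁻ m) (combination m) (approx (proj₁ z) m) (approx (proj₁ z) j) (2⁻ j) (2⁻ n)))
    , ≤-limit (λ n → let m , 6m≤ , near-z = close-combination n in
        linear (lower {1ℚ - b} {2⁻ m} {approx (proj₁ t) m} {1ℚ - approx (proj₁ x) m} {1ℚ - approx (proj₁ y) m}
                 (0≤2⁻ m) (2⁻≤1 m) (proj₁ (unit-bounds t m)) (proj₂ (unit-bounds t m)) (0≤1- b≤1)
                 (flip m (proj₂ (inx m))) (flip₀ m (proj₁ (unit-bounds x m)))
                 (flip m (proj₂ (iny m))) (flip₀ m (proj₁ (unit-bounds y m)))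
                ⊕ above near-z ⊕ above (reg m j) ⊕ 6m≤)
          (solve 9 (λ b e t x y zm zj u v → zj :+
            (t :* (con 1ℚ :- x) :+ (con 1ℚ :- t) :* (con 1ℚ :- y) :+
              (t :* x :+ (con 1ℚ :- t) :* y :+ con ½ :* v :+ (zm :+ (e :+ u) :+ con ½ :* v))) :=
                                        b :+ u :+ v :+ (con 1ℚ :- b :- con
                                          4ℚ :* e :+ (zm :+ (zj :+ (con 2ℚ :+ con 2ℚ :+ con 1ℚ) :* e)))) refl
            b (2⁻ m) (approx (proj₁ t) m) (approx (proj₁ x) m) (approx (proj₁ y) m) (approx (proj₁ z) m)
              (approx (proj₁ z) j) (2⁻ j) (2⁻ n)))
    where
    combination : ℕ → ℚ
    combination m = approx (proj₁ t) m * approx (proj₁ x) m + (1ℚ - approx (proj₁ t) m) * approx (proj₁ y) m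

    reg : ∀ m n → Near (2⁻ m + 2⁻ n) (approx (proj₁ z) m) (approx (proj₁ z) n)
    reg = close⇒near (regular (proj₁ z))

    flip : ∀ {x} m → x ≤ b + 2⁻ m → 1ℚ - b ≤ 1ℚ - x + 2⁻ m
    flip {x} m x≤ = linear x≤ (solve 3 (λ b x e → con 1ℚ :- b :+ (b :+ e) := con 1ℚ :- x :+ e :+ x) refl b x (2⁻ m))
    flip₀ : ∀ {x} m → - 2⁻ m ≤ x → 1ℚ - x ≤ 1ℚ + 2⁻ m
    flip₀ {x} m ≤x = linear ≤x (solve 2 (λ x e → con 1ℚ :- x :+ x := con 1ℚ :+ e :+ :- e) refl x (2⁻ m))

    -- Five errors 2⁻ᵐ occur: four from `lower`, one from comparing two approximations of `z`. For m
    -- ≥ n + 4 they amount to at most 5/16 of 2⁻ⁿ.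
    close-combination : ∀ n → ∃[ m ] (2ℚ + 2ℚ + 1ℚ) * 2⁻ m ≤ ½ * 2⁻ n ×
      Near (½ * 2⁻ n) (combination m) (approx (proj₁ z) m)
    close-combination n = from (conv (suc n))
      where
      from : ∃[ N ] (∀ m → N ℕ.≤ m → ∣ combination m - approx (proj₁ z) m ∣ ≤ 2⁻ suc n) →
             ∃[ m ] (2ℚ + 2ℚ + 1ℚ) * 2⁻ m ≤ ½ * 2⁻ n × Near (½ * 2⁻ n) (combination m) (approx (proj₁ z) m)
      from (N , near-z) = m
        , ℚ.≤-trans (scale-≤ (ℚ.≤-trans 0≤1 (linear (0≤1 ⊕ 0≤1 ⊕ 0≤1 ⊕ 0≤1) refl))
            (2⁻-anti {4 ℕ.+ n} {m} (ℕ.m≤n⊔m N (4 ℕ.+ n))))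
            (linear (scale-≤ (0≤* (0≤* 0≤½ 0≤½) (0≤* 0≤½ 0≤½)) (0≤2⁻ n ⊕ 0≤2⁻ n ⊕ 0≤2⁻ n))
              (solve 1 (λ e → (con 2ℚ :+ con 2ℚ :+ con 1ℚ) :* (con ½ :* (con ½ :* (con ½ :* (con ½ :* e)))) :+ con
                ½ :* con ½ :* (con ½ :* con ½) :* (e :+ (e :+ e)) :=
                              con ½ :* e :+ con ½ :* con ½ :* (con ½ :* con ½) :* (con 0ℚ :+ (con 0ℚ :+ con 0ℚ)))
                                refl (2⁻ n)))
        , ∣∣≤⇒Near (near-z m (ℕ.m≤m⊔n N (4 ℕ.+ n)))
        where m = N ⊔ (4 ℕ.+ n)

-- The adversary's instances and their names

module Instances where

  open import Data.Bool using (Bool; true; false; if_then_else_)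
  open import Data.Fin using (zero; suc)
  open import Data.List using (List; []; _∷_; length; applyUpTo)
  open import Data.List.Properties using (length-applyUpTo)
  open import Data.Maybe using (Maybe; just; nothing)
  open import Data.Nat using (ℕ; zero; suc; _+_; _*_; _≤_; _<_; _<ᵇ_; _≟_; _<?_; _⊔_; z≤n; s≤s; s<s)
  open import Data.Rational as ℚ using (ℚ; 0ℚ; 1ℚ)
  open import Data.Unit using (⊤; tt)
  open import Function using (_∘_; _⇔_; Equivalence)
  open import Relation.Nullary using (¬_; yes; no; contradiction; Dec; does)
  open import Relation.Nullary.Decidable using (dec-true; dec-false)
  open import Defs
  open Fan using (_≈[_]_)
  open Rationals using (below; near-refl; 0≤2⁻)
  open Intervals
  open Programs
  open Reductions

  open Real using (approx; regular)

  pair-≥ʳ : ∀ a b → b ≤ pair a b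
  pair-≥ʳ a b = ℕ.m≤m+n b _

  unpair-≤ : ∀ n → proj₁ (unpair n) + proj₂ (unpair n) ≤ n
  unpair-≤ zero    = z≤n
  unpair-≤ (suc n) with unpair n | unpair-≤ n
  ... | zero  , b | b≤n   = s≤s (ℕ.≤-trans (ℕ.≤-reflexive (ℕ.+-identityʳ b)) b≤n)
  ... | suc a , b | a+b<n = ℕ.≤-trans (ℕ.≤-reflexive (ℕ.+-suc a b)) (ℕ.m≤n⇒m≤1+n a+b<n)

  unpair₁-≤ : ∀ n → proj₁ (unpair n) ≤ n
  unpair₁-≤ n = ℕ.≤-trans (ℕ.m≤m+n _ _) (unpair-≤ n)

  -- The first argument bounds the length of the list.
  uncode : ℕ → ℕ → List ℕ
  uncode zero    _       = []
  uncode (suc f) zero    = []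
  uncode (suc f) (suc c) = proj₁ (unpair c) ∷ uncode f (proj₂ (unpair c))

  length≤code : ∀ xs → length xs ≤ code xs
  length≤code []       = z≤n
  length≤code (x ∷ xs) = s≤s (ℕ.≤-trans (length≤code xs) (pair-≥ʳ x (code xs)))

  uncode-code : ∀ f xs → length xs ≤ f → uncode f (code xs) ≡ xs
  uncode-code zero    []       _         = refl
  uncode-code (suc f) []       _         = refl
  uncode-code (suc f) (x ∷ xs) (s≤s len) rewrite unpair-pair x (code xs) = cong (x ∷_) (uncode-code f xs len)

  dispatch : (ℕ → List ℕ → ℕ) → List ℕ → ℕ
  dispatch F []       = 0
  dispatch F (n ∷ xs) = F n xs

  respond : (ℕ → List ℕ → ℕ) → Baire
  respond F c = dispatch F (uncode c c)

  respond-code : ∀ F n xs → respond F (code (n ∷ xs)) ≡ F n xs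
  respond-code F n xs =
    cong (dispatch F) (uncode-code (code (n ∷ xs)) (n ∷ xs) (length≤code (n ∷ xs)))

  -- A positive position codes a question smaller than itself, so changes of the answers from stage
  -- t on are invisible in the first t entries.
  respond-≈ : ∀ {F F′} t → (∀ n → n < t → ∀ xs → F n xs ≡ F′ n xs) → respond F ≈[ t ] respond F′
  respond-≈ t F≡F′ zero    c<t = refl
  respond-≈ t F≡F′ (suc c) c<t =
    F≡F′ (proj₁ (unpair c)) (ℕ.≤-<-trans (ℕ.≤-trans (unpair₁-≤ c) (ℕ.n≤1+n c)) c<t) _

  nth : List ℕ → ℕ → ℕ
  nth []       _       = 0
  nth (x ∷ xs) zero    = x
  nth (x ∷ xs) (suc n) = nth xs n

  nth-applyUpTo : ∀ (r : Baire) {m n} → n < m → nth (applyUpTo r m) n ≡ r n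
  nth-applyUpTo r {suc m} {zero}  _         = refl
  nth-applyUpTo r {suc m} {suc n} (s<s n<m) = nth-applyUpTo (r ∘ suc) n<m

  -- The associate that answers suc (v n xs) to the question n as soon as the
  -- prefix xs has length suc n.
  waiting : (ℕ → List ℕ → ℕ) → ℕ → List ℕ → ℕ
  waiting v n xs = if does (length xs <? suc n) then 0 else suc (v n xs)

  waiting-∙ : ∀ v r → respond (waiting v) ∙ r ≈> λ n → v n (applyUpTo r (suc n))
  waiting-∙ v r n = suc n
    , trans (respond-code (waiting v) n (applyUpTo r (suc n)))
        (cong (if_then 0 else suc (v n (applyUpTo r (suc n))))
          (dec-false (_ <? suc n) (λ l< → ℕ.<-irrefl (length-applyUpTo r (suc n)) l<)))
    , λ i i<1+n → trans (respond-code (waiting v) n (applyUpTo r i))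
        (cong (if_then 0 else suc (v n (applyUpTo r i)))
          (dec-true (_ <? suc n) (subst (_< suc n) (sym (length-applyUpTo r i)) i<1+n)))

  indicator : ∀ {P : Set} → Dec P → ℕ
  indicator P? = if does P? then 1 else 0

  indicator-yes : ∀ {P : Set} (P? : Dec P) → P → indicator P? ≢ 0
  indicator-yes (yes _) _ ()
  indicator-yes (no ¬p) p = contradiction p ¬p

  indicator-no : ∀ {P : Set} (P? : Dec P) → ¬ P → indicator P? ≡ 0
  indicator-no P? ¬p = cong (if_then 1 else 0) (dec-false P? ¬p)

  -- The representative 1ᶜ000... of class `c`, the point to which a collapse leads.
  ones : ℕ → ℕ → Bool
  ones c n = n <ᵇ c

  prefixSum-ones : ∀ n c → c ≤ n → prefixSum n (bit ∘ ones c) ≡ c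
  prefixSum-ones n c c≤n = trans (go n) (ℕ.m≥n⇒m⊓n≡n c≤n)
    where
    open Data.Nat using (_⊓_)
    go : ∀ n → prefixSum n (bit ∘ ones c) ≡ n ⊓ c
    go zero    = refl
    go (suc n) with n <? c
    ... | yes n<c rewrite go n | ℕ.m≤n⇒m⊓n≡m (ℕ.<⇒≤ n<c) | ℕ.m≤n⇒m⊓n≡m n<c
                        | dec-true (n <? c) n<c = ℕ.+-comm n 1
    ... | no n≮c rewrite go n | ℕ.m≥n⇒m⊓n≡n (ℕ.≮⇒≥ n≮c) | ℕ.m≥n⇒m⊓n≡n (ℕ.m≤n⇒m≤1+n (ℕ.≮⇒≥ n≮c))
                        | dec-false (n <? c) n≮c = ℕ.+-identityʳ c

  -- A history is kept because a published part of a name cannot be changed: shrinking takes effect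
  -- from a later stage on. As the intervals are nested around the final one, the set described is
  -- the final interval.
  record Play : Set where
    field
      intervals : ℕ → ℕ → Interval
      time      : ℕ

    final : ℕ → Interval
    final = intervals time

    field
      stable  : ∀ {n} c → time ≤ n → intervals n c ≡ final c
      nested  : ∀ n c → proj₁ (intervals n c) ℚ.≤ proj₁ (final c) × proj₂ (final c) ℚ.≤ proj₂ (intervals n c)
      proper  : ∀ c → proj₁ (final c) ℚ.< proj₂ (final c)
      in-unit : ∀ c → 0ℚ ℚ.≤ proj₁ (final c) × proj₂ (final c) ℚ.≤ 1ℚ

  open Play

  data Status : Set where
    uncollapsed : Status
    collapsed   : (stage class : ℕ) → Status

  record Inst : Set where
    constructor _at-status_
    field
      play   : Play
      status : Status

  open Inst

  collapsedTo : Status → ℕ → Maybe ℕ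
  collapsedTo uncollapsed     n = nothing
  collapsedTo (collapsed s c) n = if does (n <? s) then nothing else just c

  infix 4 _∼[_]_
  _∼[_]_ : Inst → ℕ → Inst → Set
  I ∼[ t ] J = ∀ n → n < t →
    collapsedTo (status I) n ≡ collapsedTo (status J) n × (∀ c → intervals (play I) n c ≡ intervals (play J) n c)

  deviates : ℕ → ℕ → List ℕ → ℕ
  deviates c zero    xs = 0
  deviates c (suc n) xs = if does (nth xs n ≟ bit (ones c n)) then deviates c n xs else 1

  cantorTest : Maybe ℕ → ℕ → List ℕ → ℕ
  cantorTest nothing  n xs = 0
  cantorTest (just c) n xs = deviates c n xs

  intervalTest : (ℕ → Interval) → ℕ → List ℕ → ℕ
  intervalTest J n xs = indicator (outside? (J n) n (ν (nth xs n)))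

  cantorName : Status → Baire
  cantorName st = respond (waiting λ n → cantorTest (collapsedTo st n) n)

  sectionName : Play → ℕ → Baire
  sectionName P c = respond (waiting (intervalTest λ n → intervals P n c))

  sectionsName : Play → Baire
  sectionsName P m = sectionName P (proj₂ (unpair m)) (proj₁ (unpair m))

  instanceName : Inst → Baire
  instanceName I = ⟨ cantorName (status I) , sectionsName (play I) ⟩

  instanceName-≈ : ∀ I J t → I ∼[ t ] J → instanceName I ≈[ t ] instanceName J
  instanceName-≈ I J t I∼J = ⟨,⟩-≈ t
    (respond-≈ t λ n n<t xs → cong (λ s → waiting (λ n → cantorTest s n) n xs) (proj₁ (I∼J n n<t)))
    (λ m m<t → respond-≈ t (λ n n<t xs → cong (λ K →
      if does (length xs <? suc n) then 0 else suc (indicator (outside? K n (ν (nth xs n)))))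
                               (proj₂ (I∼J n n<t) (proj₂ (unpair m))))
      (proj₁ (unpair m)) (ℕ.≤-<-trans (unpair₁-≤ m) m<t))

  selected-instance : ∀ n I r → selected n ⟨ instanceName I , r ⟩ ≗ sectionName (play I) (prefixSum n r)
  selected-instance n I r i = begin
    q (double (suc (double j)))               ≡⟨ even-⟨,⟩ (instanceName I) r (suc (double j)) ⟩
    instanceName I (suc (double j))           ≡⟨ odd-⟨,⟩ (cantorName (status I)) (sectionsName (play I)) j ⟩
    sectionsName (play I) j                   ≡⟨ cong (λ u → sectionName (play I) (proj₂ u) (proj₁ u))
      (unpair-pair i _) ⟩
    sectionName (play I) (prefixSum n (odd q)) i ≡⟨ cong (λ c → sectionName (play I) c i)
                                                    (prefixSum-cong n λ m _ → odd-⟨,⟩ (instanceName I) r m) ⟩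
    sectionName (play I) (prefixSum n r) i    ∎
    where
    open ≡-Reasoning
    q = ⟨ instanceName I , r ⟩
    j = pair i (prefixSum n (odd q))

  deviates-none : ∀ c n xs → (∀ i → i < n → nth xs i ≡ bit (ones c i)) → deviates c n xs ≡ 0
  deviates-none c zero    xs eq = refl
  deviates-none c (suc n) xs eq = trans
    (cong (if_then deviates c n xs else 1) (dec-true (nth xs n ≟ bit (ones c n)) (eq n ℕ.≤-refl)))
    (deviates-none c n xs λ i i<n → eq i (ℕ.m≤n⇒m≤1+n i<n))

  deviates-some : ∀ c n xs i → i < n → nth xs i ≢ bit (ones c i) → deviates c n xs ≢ 0
  deviates-some c (suc n) xs i i<1+n ≢i = by-cases (nth xs n ≟ bit (ones c n)) (ℕ.m≤n⇒m<n∨m≡n (ℕ.≤-pred i<1+n))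
    where
    by-cases : Dec (nth xs n ≡ bit (ones c n)) → i < n ⊎ i ≡ n → deviates c (suc n) xs ≢ 0
    by-cases (no ¬eq) _ dev with () ← trans (sym
      (cong (if_then deviates c n xs else 1) (dec-false (nth xs n ≟ bit (ones c n)) ¬eq))) dev
    by-cases (yes eq) (inj₂ refl) _   = ≢i eq
    by-cases (yes eq) (inj₁ i<n)  dev = deviates-some c n xs i i<n ≢i
      (trans (sym (cong (if_then deviates c n xs else 1) (dec-true (nth xs n ≟ bit (ones c n)) eq))) dev)

  bit-injective : ∀ {a b} → bit a ≡ bit b → a ≡ b
  bit-injective {false} {false} _ = refl
  bit-injective {true}  {true}  _ = refl

  Matches : Status → (ℕ → Bool) → Set
  Matches uncollapsed     x = ⊤
  Matches (collapsed s c) x = x ≗ ones c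

  collapsedTo-late : ∀ {s c n} → s ≤ n → collapsedTo (collapsed s c) n ≡ just c
  collapsedTo-late {s} {c} {n} s≤n = cong (if_then nothing else just c) (dec-false (n <? s) (ℕ.≤⇒≯ s≤n))

  point₀ : RepresentedSpace.Carrier (𝕀 ^ˢ 1) → ℕ → ℚ
  point₀ z = approx (proj₁ (z zero))


  one-coordinate : ∀ k → 0 + k * 1 ≡ k
  one-coordinate k = ℕ.*-identityʳ k

  module _ (em : ExcludedMiddle 0ℓ) where
    open Fan.Classical em using (¬∀⇒∃¬)

    cantorTest-inside : ∀ st {x r} → Matches st x → (∀ n → r n ≡ bit (x n)) → ∀ n →
                        cantorTest (collapsedTo st n) n (applyUpTo r (suc n)) ≡ 0
    cantorTest-inside uncollapsed     _    _    n = refl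
    cantorTest-inside (collapsed s c) {x} {r} x≗ names n = by-cases (n <? s)
      where
      by-cases : Dec (n < s) → cantorTest (collapsedTo (collapsed s c) n) n (applyUpTo r (suc n)) ≡ 0
      by-cases (yes n<s) = cong (λ b → cantorTest (if b then nothing else just c) n (applyUpTo r (suc n)))
        (dec-true (n <? s) n<s)
      by-cases (no n≮s)  = trans (cong (λ b → cantorTest (if b then nothing else just c) n (applyUpTo r (suc n)))
        (dec-false (n <? s) n≮s))
        (deviates-none c n (applyUpTo r (suc n)) λ i i<n →
          trans (nth-applyUpTo r (ℕ.m≤n⇒m≤1+n i<n)) (trans (names i) (cong bit (x≗ i))))

    cantorTest-outside : ∀ st {x r} → ¬ Matches st x → (∀ n → r n ≡ bit (x n)) →
                         ∃[ n ] cantorTest (collapsedTo st n) n (applyUpTo r (suc n)) ≢ 0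
    cantorTest-outside uncollapsed     ¬x _ = contradiction tt ¬x
    cantorTest-outside (collapsed s c) {x} {r} ¬x≗ names =
      let i , x≢ = ¬∀⇒∃¬ ¬x≗
          n      = s ⊔ suc i
          i<n    = ℕ.m≤n⊔m s (suc i)
      in n , subst (λ o → cantorTest o n (applyUpTo r (suc n)) ≢ 0) (sym (collapsedTo-late (ℕ.m≤m⊔n s (suc i))))
           (deviates-some c n (applyUpTo r (suc n)) i i<n λ eq → x≢ (bit-injective
             (trans (sym (names i)) (trans (sym (nth-applyUpTo r (ℕ.m≤n⇒m≤1+n i<n))) eq))))

    Matches-resp : ∀ st {x y} → x ≗ y → Matches st x → Matches st y
    Matches-resp uncollapsed     _   _  = tt
    Matches-resp (collapsed s c) x≗y x≗ = λ n → trans (sym (x≗y n)) (x≗ n)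

    cantorSet : ∀ st → ∃ λ (A : RepresentedSpace.Carrier (𝒜 Cantor)) →
      RepresentedSpace._names_ (𝒜 Cantor) (cantorName st) A × ∀ x → x ∈[ Cantor ] A ⇔ Matches st x
    cantorSet st = closed-set em Cantor (cantorName st) (Matches st) (Matches-resp st) λ r x names →
      _ , waiting-∙ (λ n → cantorTest (collapsedTo st n) n) r
      , (λ in-x → cantorTest-inside st in-x names) , (λ out-x → cantorTest-outside st out-x names)

    cantorSet-AllOrUnique : ∀ st → AllOrUnique (proj₁ (cantorSet st))
    cantorSet-AllOrUnique uncollapsed     = inj₁ λ x → Equivalence.from (proj₂ (proj₂ (cantorSet uncollapsed)) x) tt
    cantorSet-AllOrUnique (collapsed s c) = inj₂ (ones c , proj₂ (proj₂ (cantorSet (collapsed s c))))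

    cantorSet-nonempty : ∀ st → ∃[ x ] Matches st x
    cantorSet-nonempty uncollapsed     = ones 0 , tt
    cantorSet-nonempty (collapsed s c) = ones c , λ _ → refl

    module _ (P : Play) (c : ℕ) where
      private
        J = final P c

      InJ : RepresentedSpace.Carrier (𝕀 ^ˢ 1) → Set
      InJ z = InInterval J (point₀ z)

      value-near : ∀ {r z} → RepresentedSpace._names_ (𝕀 ^ˢ 1) r z → Close (ν ∘ r) (point₀ z)
      value-near {r} names = Close-cong (λ k → cong (λ i → ν (r i)) (one-coordinate k)) (names zero)

      intervalSet : ∃ λ (A : RepresentedSpace.Carrier (𝒜 (𝕀 ^ˢ 1))) →
        RepresentedSpace._names_ (𝒜 (𝕀 ^ˢ 1)) (sectionName P c) A × ∀ z → z ∈[ 𝕀 ^ˢ 1 ] A ⇔ InJ z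
      intervalSet = closed-set em (𝕀 ^ˢ 1) (sectionName P c) InJ
        (λ z≈z′ → InInterval-same {J} (z≈z′ zero)) λ r z names →
        _ , waiting-∙ (intervalTest λ n → intervals P n c) r
        , (λ in-J n → trans (cong (λ v → indicator (outside? (intervals P n c) n (ν v)))
            (nth-applyUpTo r {suc n} {n} ℕ.≤-refl))
                        (indicator-no (outside? (intervals P n c) n (ν (r n)))
                           (inside n (proj₁ (nested P n c)) (proj₂ (nested P n c)) (value-near {r} {z} names) in-J)))
        , λ ¬in-J → excluded r z names (¬∀⇒∃¬ ¬in-J)
        where
        excluded : ∀ r z → RepresentedSpace._names_ (𝕀 ^ˢ 1) r z →
                   ∃[ m ] ¬ (proj₁ J ℚ.≤ point₀ z m ℚ.+ 2⁻ m × point₀ z m ℚ.≤ proj₂ J ℚ.+ 2⁻ m) →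
                   ∃[ n ] intervalTest (λ n → intervals P n c) n (applyUpTo r (suc n)) ≢ 0
        excluded r z names (m , ¬between) = found (outside (proj₁ J ℚ.≤? point₀ z m ℚ.+ 2⁻ m))
          where
          outside : Dec (proj₁ J ℚ.≤ point₀ z m ℚ.+ 2⁻ m) → ∃[ n ] time P ≤ n × Outside J n (ν (r n))
          outside (no ¬≤)  = outside-below {J} {z = point₀ z} {m} (time P) (value-near {r} {z} names) (ℚ.≰⇒> ¬≤)
          outside (yes J≤) = outside-above {J} {z = point₀ z} {m} (time P) (value-near {r} {z} names)
                               (ℚ.≰⇒> λ ≤J → ¬between (J≤ , ≤J))

          found : ∃[ n ] time P ≤ n × Outside J n (ν (r n)) →
                  ∃[ n ] intervalTest (λ n → intervals P n c) n (applyUpTo r (suc n)) ≢ 0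
          found (n , T≤n , out) = n , indicator-yes (outside? (intervals P n c) n (ν (nth (applyUpTo r (suc n)) n)))
            (subst₂ (λ K v → Outside K n (ν v)) (sym (stable P c T≤n))
              (sym (nth-applyUpTo r {suc n} {n} ℕ.≤-refl)) out)

      intervalSet-convex : Convex {1} (proj₁ intervalSet)
      intervalSet-convex x y z t x∈ y∈ z≈ = Equivalence.from (proj₂ (proj₂ intervalSet) z)
        (InInterval-convex {J} {x zero} {y zero} {z zero} {t} (proj₁ (in-unit P c)) (proj₂ (in-unit P c))
          (Equivalence.to (proj₂ (proj₂ intervalSet) x) x∈) (Equivalence.to (proj₂ (proj₂ intervalSet) y) y∈)
            (z≈ zero))

      intervalSet-nonempty : ∃[ z ] InJ z
      intervalSet-nonempty = (λ _ → fromℚ a , 0≤a , a≤1)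
        , λ m → below (near-refl (0≤2⁻ m)) , ℚ.≤-trans (ℚ.<⇒≤ (proper P c)) (below (near-refl (0≤2⁻ m)))
        where
        a = proj₁ J

        weaken : ∀ {p q} m n → p ℚ.≤ q → p ℚ.≤ q ℚ.+ (2⁻ m ℚ.+ 2⁻ n)
        weaken m n p≤q = ℚ.≤-trans p≤q (below (near-refl (ℚ.+-mono-≤ (0≤2⁻ m) (0≤2⁻ n))))

        0≤a : fromℚ 0ℚ ≤ℝ fromℚ a
        0≤a m n = weaken m n (proj₁ (in-unit P c))

        a≤1 : fromℚ a ≤ℝ fromℚ 1ℚ
        a≤1 m n = weaken m n (ℚ.≤-trans (ℚ.<⇒≤ (proper P c)) (proj₂ (in-unit P c)))

    module _ (N : ℕ) where

      Φ : 𝔹 ⇉ 𝔹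
      Φ = f₁ N ⊙ g₁

      open _⇉_ Φ using (_↦_; dom)

      -- `r` is arbitrary, as a composition is defined only where the second factor accepts every
      -- output of the first.
      section-solvable : ∀ I {q r} → q ≗ ⟨ instanceName I , r ⟩ → ∃[ o ] _⇉_._↦_ (f₁ N) q o
      section-solvable I {q} {r} q≗ =
        let c            = prefixSum N r
            A , names , ∈A = intervalSet (play I) c
            z , z∈J      = intervalSet-nonempty (play I) c
            s , s-names  = RepresentedSpace.surjective (𝕀 ^ˢ 1) z
        in ⟨ q , s ⟩
           , lifted {input = A} {output = z} {name = s}
               (rename (𝒜 (𝕀 ^ˢ 1)) A (λ i → sym (trans (selected-cong N q≗ i) (selected-instance N I r i))) names)
               (intervalSet-convex (play I) c , Equivalence.from (∈A z) z∈J) s-names (λ _ → refl)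

      instance-dom : ∀ I → dom (instanceName I)
      instance-dom I =
        let A , names , ∈A = cantorSet (status I)
            x , x-matches  = cantorSet-nonempty (status I)
            q              = ⟨ instanceName I , bit ∘ x ⟩
            o , solves     = section-solvable I {q} {bit ∘ x} λ _ → refl
        in o , (λ q′ (lifted _ _ _ q′≗) → section-solvable I q′≗)
           , q , lifted {input = A} {output = x} {name = bit ∘ x}
               (rename (𝒜 Cantor) A (λ i → sym (even-⟨,⟩ (cantorName (status I)) (sectionsName (play I)) i)) names)
                   (cantorSet-AllOrUnique (status I) , Equivalence.from (∈A x) x-matches) (λ _ → refl) (λ _ → refl)
           , solves

      -- An output has the form ⟨ ⟨ I , x ⟩ , z ⟩; the class is read from the bits of `x`, the real
      -- from `z`.
      answerClass : Baire → ℕ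
      answerClass o = prefixSum N (odd (even o))

      answerValue : Baire → ℕ → ℚ
      answerValue o e = ν (odd o e)

      answer-class : ∀ P s {c o} → c ≤ N → instanceName (P at-status collapsed s c) ↦ o → answerClass o ≡ c
      answer-class P s {c} {o} c≤N (_ , q , lifted {A′} {x} {r} names′
        (_ , x∈A′) r-names q≗ , lifted {name = t} _ _ _ o≗) =
        trans (prefixSum-cong N λ n _ → trans (o≗ _)
          (trans (even-⟨,⟩ q t (suc (double n))) (trans (q≗ (suc (double n)))
                 (trans (odd-⟨,⟩ (instanceName I) r n) (trans (r-names n) (cong bit (x≗ n)))))))
              (prefixSum-ones N c c≤N)
        where
        I = P at-status collapsed s c
        A = proj₁ (cantorSet (status I))

        -- The output solves some set `A′` with the same name as `A`, and a name determines its set.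
        A≈A′ : RepresentedSpace._≈_ (𝒜 Cantor) A A′
        A≈A′ = RepresentedSpace.functional (𝒜 Cantor) {instanceName-even} {A} {A′} names names′
          where
          instanceName-even = even (instanceName I)
          names : RepresentedSpace._names_ (𝒜 Cantor) instanceName-even A
          names = rename (𝒜 Cantor) A (λ i → sym (even-⟨,⟩ (cantorName (status I)) (sectionsName (play I)) i))
            (proj₁ (proj₂ (cantorSet (status I))))

        x≗ : x ≗ ones c
        x≗ = Equivalence.to (proj₂ (proj₂ (cantorSet (status I))) x) (trans (A≈A′ x) x∈A′)

      answer-value : ∀ I {o} → instanceName I ↦ o → ∀ e →
                     proj₁ (final (play I) (answerClass o)) ℚ.≤ answerValue o e ℚ.+ 2⁻ e ×
                     answerValue o e ℚ.≤ proj₂ (final (play I) (answerClass o)) ℚ.+ 2⁻ e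
      answer-value I {o} (_ , q , lifted {_} {_} {r} _ _ _ q≗ , lifted {A′} {z} {s} names′ (_ , z∈A′) s-names o≗) e =
        subst (λ c → proj₁ (final (play I) c) ℚ.≤ answerValue o e ℚ.+ 2⁻ e ×
          answerValue o e ℚ.≤ proj₂ (final (play I) c) ℚ.+ 2⁻ e)
          class≡ (subst (λ v → proj₁ J ℚ.≤ ν v ℚ.+ 2⁻ e × ν v ℚ.≤ proj₂ J ℚ.+ 2⁻ e) value≡
                   (name-bounds {J} (value-near (play I) c {s} {z} s-names) z∈J e))
        where
        c = prefixSum N r
        J = final (play I) c
        A = proj₁ (intervalSet (play I) c)

        class≡ : c ≡ answerClass o
        class≡ = sym (prefixSum-cong N λ n _ → trans (o≗ _)
          (trans (even-⟨,⟩ q s (suc (double n))) (trans (q≗ (suc (double n))) (odd-⟨,⟩ (instanceName I) r n))))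

        value≡ : s e ≡ odd o e
        value≡ = sym (trans (o≗ _) (odd-⟨,⟩ q s e))

        A≈A′ : RepresentedSpace._≈_ (𝒜 (𝕀 ^ˢ 1)) A A′
        A≈A′ = RepresentedSpace.functional (𝒜 (𝕀 ^ˢ 1)) {selected N q} {A} {A′}
          (rename (𝒜 (𝕀 ^ˢ 1)) A (λ i → sym (trans (selected-cong N q≗ i) (selected-instance N I r i)))
            (proj₁ (proj₂ (intervalSet (play I) c)))) names′

        z∈J : InJ (play I) c z
        z∈J = Equivalence.to (proj₂ (proj₂ (intervalSet (play I) c)) z) (trans (A≈A′ z) z∈A′)

-- Digit paths as names of points; a canonical path in a closed set

module Points where

  open import Data.Bool using (true; false)
  open import Data.Fin using (Fin)
  open import Data.List using (List; []; _∷_; applyUpTo)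
  open import Data.List.Membership.Propositional using (_∈_)
  open import Data.List.Relation.Unary.Any using (here; there)
  open import Data.Nat as ℕ using (ℕ; zero; suc; _⊔_)
  import Data.Nat.DivMod as ℕ
  open import Data.Rational hiding (_⊔_; _/_)
  open import Function using (_∘_; Func)
  open import Relation.Binary using (tri<; tri≈; tri>)
  open import Defs
  open Rationals
  open Fan
  open DigitPaths
  open Intervals

  open Real using (approx; regular)

  bound-below : ∀ (f : ℕ → ℕ) m → ∃[ n ] ∀ i → i ℕ.≤ m → f i ℕ.< n
  bound-below f zero    = suc (f 0) , λ { .0 ℕ.z≤n → ℕ.≤-refl }
  bound-below f (suc m) =
    let n , f< = bound-below f m
    in suc (f (suc m)) ⊔ n , λ i i≤1+m → by-cases i f< (ℕ.m≤n⇒m<n∨m≡n i≤1+m)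
    where
    by-cases : ∀ {n} i → (∀ i → i ℕ.≤ m → f i ℕ.< n) → i ℕ.< suc m ⊎ i ≡ suc m → f i ℕ.< suc (f (suc m)) ⊔ n
    by-cases {n} i f< (inj₁ i<1+m) = ℕ.<-≤-trans (f< i (ℕ.≤-pred i<1+m)) (ℕ.m≤n⊔m (suc (f (suc m))) n)
    by-cases {n} i f< (inj₂ refl)  = ℕ.m≤m⊔n (suc (f (suc m))) n

  applyUpTo-cong : ∀ {r r′ : ℕ → ℕ} m → r ≈[ m ] r′ → applyUpTo r m ≡ applyUpTo r′ m
  applyUpTo-cong zero    r≈r′ = refl
  applyUpTo-cong (suc m) r≈r′ = cong₂ _∷_ (r≈r′ 0 ℕ.z<s) (applyUpTo-cong m λ i i<m → r≈r′ (suc i) (ℕ.s<s i<m))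

  -- The search for the answer consults `α` only at the codes of the prefixes of `r` up to length
  -- `m`; `N` lies above all of them.
  ∙-continuous : ∀ {α r q} → α ∙ r ≈> q → ∀ j → ∃[ n ] ∀ {α′ r′ q′} →
                 α ≈[ n ] α′ → r ≈[ n ] r′ → α′ ∙ r′ ≈> q′ → q′ j ≡ q j
  ∙-continuous {α} {r} {q} d j = m ⊔ N , agree
    where
    m = proj₁ (d j)
    query : ℕ → ℕ
    query i = code (j ∷ applyUpTo r i)
    N = proj₁ (bound-below query m)

    agree : ∀ {α′ r′ q′} → α ≈[ m ⊔ N ] α′ → r ≈[ m ⊔ N ] r′ → α′ ∙ r′ ≈> q′ → q′ j ≡ q j
    agree {α′} {r′} {q′} α≈α′ r≈r′ d′ = compare (ℕ.<-cmp m m′)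
      where
      m′ = proj₁ (d′ j)

      same : ∀ i → i ℕ.≤ m → α′ (code (j ∷ applyUpTo r′ i)) ≡ α (query i)
      same i i≤m = trans
        (cong (λ xs → α′ (code (j ∷ xs))) (sym (applyUpTo-cong i (≈-anti (ℕ.≤-trans i≤m (ℕ.m≤m⊔n m N)) r≈r′))))
        (sym (α≈α′ (query i) (ℕ.<-≤-trans (proj₂ (bound-below query m) i i≤m) (ℕ.m≤n⊔m m N))))

      compare : _ → q′ j ≡ q j
      compare (tri< m<m′ _ _) with () ← trans (sym (proj₁ (proj₂ (d j))))
        (trans (sym (same m ℕ.≤-refl)) (proj₂ (proj₂ (d′ j)) m m<m′))
      compare (tri≈ _ m≡m′ _) = ℕ.suc-injective (trans (sym (proj₁ (proj₂ (d′ j))))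
        (trans (cong (λ i → α′ (code (j ∷ applyUpTo r′ i))) (sym m≡m′))
          (trans (same m ℕ.≤-refl) (proj₁ (proj₂ (d j))))))
      compare (tri> _ _ m′<m) with () ← trans (sym (proj₁ (proj₂ (d′ j))))
        (trans (same m′ (ℕ.<⇒≤ m′<m)) (proj₂ (proj₂ (d j)) m′ m′<m))

  regular⇒close : ∀ {a} → Regular a → Close a a
  regular⇒close reg = close λ m n → Near⇒∣∣≤ (reg m n)

  same⇒close : ∀ {a b} → Regular a → Regular b → SameLimit a b → Close a b
  same⇒close {a} {b} rega regb ab = close λ m n → Near⇒∣∣≤ (near-limit λ j →
    let i = suc (suc j)
    in near-resp (eq (2⁻ m) (2⁻ n) (2⁻ j)) refl refl (near-trans (rega m i) (near-trans (ab i) (regb i n))))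
    where
    eq : ∀ x y z → x + ½ * (½ * z) + (½ * (½ * z) + ½ * (½ * z) + (½ * (½ * z) + y)) ≡ x + y + z
    eq = solve 3 (λ x y z → let q = con ½ :* (con ½ :* z) in x :+ q :+ (q :+ q :+ (q :+ y)) := x :+ y :+ z) refl

  module _ {k : ℕ} where

    real : Path k → Fin k → Real
    real α i = record { approx = λ n → point α n i ; regular = regular⇒close (center-regular (coord α i)) }

    InCube : Path k → Set
    InCube α = ∀ i → fromℚ 0ℚ ≤ℝ real α i × real α i ≤ℝ fromℚ 1ℚ

    element : ∀ α → InCube α → RepresentedSpace.Carrier (𝕀 ^ˢ k)
    element α α∈ i = real α i , α∈ i

    cube⇒within : ∀ {x : RepresentedSpace.Carrier 𝕀} → Within ½ (approx (proj₁ x)) ½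
    cube⇒within {x} = within λ n → near
      (linear (proj₂ (unit-bounds x n))
        (solve 2 (λ x e → x :+ (con 1ℚ :+ e) := con ½ :+ (con ½ :+ e) :+ x) refl (approx (proj₁ x) n) (2⁻ n)))
      (linear (proj₁ (unit-bounds x n))
        (solve 2 (λ x e → con ½ :+ x := x :+ (con ½ :+ e) :+ :- e) refl (approx (proj₁ x) n) (2⁻ n)))

    within⇒cube : ∀ {α} → (∀ i → Within ½ (λ n → point α n i) ½) → InCube α
    within⇒cube {α} w i =
        (λ m n → linear (above (near-at (w i) n) ⊕ 0≤2⁻ m)
          (solve 3 (λ c x y → con 0ℚ :+ (c :+ (con ½ :+ y) :+ x) := c :+ (x :+ y) :+ (con ½ :+ con 0ℚ)) refl
            (point α n i) (2⁻ m) (2⁻ n)))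
      , (λ m n → linear (below (near-at (w i) m) ⊕ 0≤2⁻ n)
          (solve 3 (λ c x y → c :+ (con ½ :+ (con ½ :+ x) :+ y) := con 1ℚ :+ (x :+ y) :+ (c :+ con 0ℚ)) refl
            (point α m i) (2⁻ m) (2⁻ n)))

    -- Formed in ℝᵏ, hence independent of a proof that the point lies in the cube. It is computed
    -- entry by entry, so that equal prefixes of paths give equal prefixes of names.
    pathName : Path k → Baire
    pathName α = proj₁ (RepresentedSpace.surjective (ℝ ^ˢ k) (real α))

    pathName-names : ∀ α (α∈ : InCube α) → RepresentedSpace._names_ (𝕀 ^ˢ k) (pathName α) (element α α∈)
    pathName-names α α∈ = proj₂ (RepresentedSpace.surjective (ℝ ^ˢ k) (real α))

  pathName-≈ : ∀ {k} {α β : Path k} n → α ≈[ n ] β → pathName α ≈[ n ] pathName β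
  pathName-≈ {zero}  n α≈β m m<n = refl
  pathName-≈ {suc k} n α≈β m m<n = cong (λ p → proj₁ (ν-surjective p))
    (point-cong (m ℕ./ suc k) (≈-anti (ℕ.≤-trans (ℕ.m/n≤m m (suc k)) (ℕ.<⇒≤ m<n)) α≈β) (m ℕ.mod suc k))

  module ClosedSets (em : ExcludedMiddle 0ℓ) (k : ℕ) where
    open Classical em
    open Refinement em

    𝕏 : RepresentedSpace
    𝕏 = 𝕀 ^ˢ k

    InB : RepresentedSpace.Carrier (𝒜 𝕏) → Path k → Set
    InB B α = ∃[ α∈ ] element α α∈ ∈[ 𝕏 ] B

    -- There are two ways to fail, both finitely visible: some approximation leaves the cube, or the
    -- associate recognises the complement after reading finite parts of `h` and of the name of the
    -- point.
    InB-closed : ∀ {h B α} → RepresentedSpace._names_ (𝒜 𝕏) h B → ¬ InB B α →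
                 ∃[ n ] ∀ h′ B′ β → h ≈[ n ] h′ → RepresentedSpace._names_ (𝒜 𝕏) h′ B′ → α ≈[ n ] β → ¬ InB B′ β
    InB-closed {h} {B} {α} h-names ¬in = by-cases em
      where
      Excluded : Set
      Excluded = ∃[ n ] ∀ h′ B′ β → h ≈[ n ] h′ → RepresentedSpace._names_ (𝒜 𝕏) h′ B′ → α ≈[ n ] β → ¬ InB B′ β

      outside-cube : ∃[ i ] ¬ (fromℚ 0ℚ ≤ℝ real α i × real α i ≤ℝ fromℚ 1ℚ) → Excluded
      outside-cube (i , ¬both) with em {fromℚ 0ℚ ≤ℝ real α i}
      ... | no ¬0≤ =
        let m , ¬0≤m = ¬∀⇒∃¬ ¬0≤
            n , ¬0≤n = ¬∀⇒∃¬ ¬0≤m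
        in n , λ h′ B′ β _ _ α≈β (β∈ , _) → ¬0≤n
             (subst (λ c → 0ℚ ≤ c + (2⁻ m + 2⁻ n)) (sym (point-cong n α≈β i)) (proj₁ (β∈ i) m n))
      ... | yes 0≤ =
        let m , ¬≤1m = ¬∀⇒∃¬ λ ≤1 → ¬both (0≤ , ≤1)
            n , ¬≤1n = ¬∀⇒∃¬ ¬≤1m
        in m , λ h′ B′ β _ _ α≈β (β∈ , _) → ¬≤1n
             (subst (λ c → c ≤ 1ℚ + (2⁻ m + 2⁻ n)) (sym (point-cong m α≈β i)) (proj₂ (β∈ i) m n))

      in-cube : InCube α → Excluded
      in-cube α∈ = from (Func.to (proj₁ B) (element α α∈)) refl
        (h-names (pathName α) (element α α∈) (pathName-names α α∈))
        where
        from : ∀ b → Func.to (proj₁ B) (element α α∈) ≡ b →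
               ∃[ q ] h ∙ pathName α ≈> q × RepresentedSpace._names_ 𝕊 q (Func.to (proj₁ B) (element α α∈)) →
                 Excluded
        from false eq _ = contradiction (α∈ , eq) ¬in
        from true  eq (q , d , names) =
          let j , q≢0 = subst (RepresentedSpace._names_ 𝕊 q) eq names
              n , cont = ∙-continuous {h} {pathName α} d j
          in n , λ h′ B′ β h≈h′ h′-names α≈β (β∈ , in-B′) →
            let q′ , d′ , names′ = h′-names (pathName β) (element β β∈) (pathName-names β β∈)
            in q≢0 (trans (sym (cont {h′} {pathName β} h≈h′ (pathName-≈ n α≈β) d′))
                 (subst (RepresentedSpace._names_ 𝕊 q′) in-B′ names′ j))

      by-cases : Dec (InCube α) → Excluded
      by-cases (yes α∈) = in-cube α∈
      by-cases (no ¬α∈) = outside-cube (¬∀⇒∃¬ ¬α∈)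

    digits : ∀ {B} x → x ∈[ 𝕏 ] B → ∃[ α ] InB B α
    digits {B} x x∈B =
      let α , _ , same , _ = followAll {1ℚ} {½} (2⁻≤1 1) ℚ.≤-refl (λ i → approx (proj₁ (x i))) x-regular 0
            (zip λ _ _ → none)
                               (λ i → cube⇒within {k} {x i}) (linear 0≤½ refl)
          α∈ = within⇒cube {α = α} λ i → within-same (center-regular (coord α i)) (same-sym (same i))
            (cube⇒within {k} {x i})
      in α , α∈ , trans (Func.cong (proj₁ B) λ i →
           same⇒close (center-regular (coord α i)) (x-regular i) (same-sym (same i))) x∈B
      where
      x-regular : ∀ i → Regular (approx (proj₁ (x i)))
      x-regular i = close⇒near (regular (proj₁ (x i)))

  module Leftmost (em : ExcludedMiddle 0ℓ) {D : Set} (FD : Finite D) (default : D) where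

    first : List D → (D → Set) → D
    first []       Q = default
    first (d ∷ ds) Q with em {Q d}
    ... | yes _ = d
    ... | no  _ = first ds Q

    first-satisfies : ∀ {Q : D → Set} {d ds} → d ∈ ds → Q d → Q (first ds Q)
    first-satisfies {Q} {d} {e ∷ ds} d∈ Qd with em {Q e}
    ... | yes Qe = Qe
    first-satisfies (here refl) Qd | no ¬Qe = contradiction Qd ¬Qe
    first-satisfies (there d∈)  Qd | no ¬Qe = first-satisfies d∈ Qd

    first-cong : ∀ {Q R : D → Set} ds → (∀ d → Q d → R d) → (∀ d → R d → Q d) → first ds Q ≡ first ds R
    first-cong []       Q⇒R R⇒Q = refl
    first-cong {Q} {R} (d ∷ ds) Q⇒R R⇒Q with em {Q d} | em {R d}
    ... | yes _  | yes _  = refl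
    ... | yes Qd | no ¬Rd = contradiction (Q⇒R d Qd) ¬Rd
    ... | no ¬Qd | yes Rd = contradiction (R⇒Q d Rd) ¬Qd
    ... | no _   | no _   = first-cong ds Q⇒R R⇒Q

    -- A realizer must be single-valued, so the path may depend only on the set and not on how it is
    -- presented.
    leftmost : ((ℕ → D) → Set) → ℕ → D
    leftmost P zero    = first (elements FD) λ d → ∃[ α ] P (d ◂ α)
    leftmost P (suc n) = leftmost (λ α → P (first (elements FD) (λ d → ∃[ α ] P (d ◂ α)) ◂ α)) n

    -- For general `P` only the prefixes of the leftmost path extend to members of `P`; that the
    -- path itself belongs to a closed set needs closedness in addition.
    leftmost-approximated : ∀ n {P} → (∀ {α β} → α ≗ β → P α → P β) → ∃[ α ] P α → ∃[ α ] leftmost P ≈[ n ] α × P α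
    leftmost-approximated zero    resp (α , Pα) = α , (λ _ ()) , Pα
    leftmost-approximated (suc n) {P} resp (α , Pα) =
      let d = first (elements FD) (λ d → ∃[ α ] P (d ◂ α))
          β , ≈β , Pβ = leftmost-approximated n {λ α → P (d ◂ α)} (λ α≗β → resp λ { zero → refl ; (suc m) → α≗β m })
                          (first-satisfies {λ d → ∃[ α ] P (d ◂ α)} (complete FD (α 0))
                            (α ∘ suc , resp (λ { zero → refl ; (suc m) → refl }) Pα))
      in d ◂ β , (λ { zero _ → refl ; (suc m) (ℕ.s<s m<n) → ≈β m m<n }) , Pβ

    leftmost-cong : ∀ n {P Q} → (∀ α → P α → Q α) → (∀ α → Q α → P α) → leftmost P n ≡ leftmost Q n
    leftmost-cong zero    P⇒Q Q⇒P = first-cong (elements FD) (λ d (α , Pα) → α , P⇒Q (d ◂ α) Pα)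
      (λ d (α , Qα) → α , Q⇒P (d ◂ α) Qα)
    leftmost-cong (suc n) {P} {Q} P⇒Q Q⇒P
      rewrite first-cong {λ d → ∃[ α ] P (d ◂ α)} {λ d → ∃[ α ] Q (d ◂ α)} (elements FD)
        (λ d (α , Pα) → α , P⇒Q (d ◂ α) Pα) (λ d (α , Qα) → α , Q⇒P (d ◂ α) Qα) =
      leftmost-cong n (λ α → P⇒Q _) (λ α → Q⇒P _)

-- The game against a hypothetical reduction

module Opponent where

  open import Data.Bool using (if_then_else_)
  open import Data.Empty using (⊥)
  open import Data.Maybe using (just; nothing)
  open import Data.Nat as ℕ using (ℕ; suc; _⊔_; _<?_; _≟_)
  open import Data.Rational hiding (_⊔_; _/_; _≟_; _<?_)
  open import Data.Unit using (⊤; tt)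
  open import Data.Vec using (replicate)
  open import Function using (_∘_; Func)
  open import Relation.Nullary using (¬_; Dec; yes; no; contradiction; does)
  open import Relation.Nullary.Decidable using (dec-true; dec-false)
  open import Defs
  open Rationals
  open Fan
  open DigitPaths
  open Games
  open Programs
  open Reductions
  open Intervals
  open Instances
  open Points

  open PartialFunction using (Graph)
  open Real using (approx)

  module Selection (em : ExcludedMiddle 0ℓ) (k : ℕ) where
    open ClosedSets em k

    private
      Closed = RepresentedSpace.Carrier (𝒜 𝕏)
      Names  = RepresentedSpace._names_ (𝒜 𝕏)

    InB-same : ∀ {B α β} → InB B α → (∀ i → SameLimit (λ n → point α n i) (λ n → point β n i)) → InB B β
    InB-same {B} {α} {β} (α∈ , in-B) same =
        within⇒cube {α = β} (λ i → within-same (center-regular (coord β i)) (same-sym (same i))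
          (cube⇒within {k} {real α i , α∈ i}))
      , trans (Func.cong (proj₁ B) λ i → same⇒close (center-regular (coord β i)) (center-regular (coord α i))
          (same-sym (same i))) in-B

    InB-≗ : ∀ {B α β} → α ≗ β → InB B α → InB B β
    InB-≗ {B} {α} {β} α≗β in-B = InB-same {B} {α} {β} in-B λ i n →
      near-≡ (ℚ.+-mono-≤ (0≤2⁻ n) (0≤2⁻ n)) (point-cong n (λ m _ → α≗β m) i)

    InB-≈ : ∀ {B B′} → RepresentedSpace._≈_ (𝒜 𝕏) B B′ → ∀ α → InB B α → InB B′ α
    InB-≈ B≈B′ α (α∈ , in-B) = α∈ , trans (sym (B≈B′ (element α α∈))) in-B

    record Solvable (h : Baire) (B : Closed) : Set where
      constructor solvable
      field
        named    : Names h B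
        convex   : Convex {k} B
        nonempty : ∃[ α ] InB B α

    open Leftmost em (finite-vec finite-digit k) (replicate k none)

    canonical : Closed → Path k
    canonical B = leftmost (InB B)

    canonical∈ : ∀ {h B} → Solvable h B → InB B (canonical B)
    canonical∈ {h} {B} (solvable named _ nonempty) = Classical.by-contradiction em λ ¬in →
      let n , excluded = InB-closed {h} {B} {canonical B} named ¬in
          α , ≈α , in-B = leftmost-approximated n (λ {α} {β} → InB-≗ {B} {α} {β}) nonempty
      in excluded h B α (λ _ _ → refl) named ≈α in-B

    canonical-≈ : ∀ {B B′} → RepresentedSpace._≈_ (𝒜 𝕏) B B′ → canonical B ≗ canonical B′
    canonical-≈ {B} {B′} B≈B′ n =
      leftmost-cong n (InB-≈ {B} {B′} B≈B′) (InB-≈ {B′} {B} λ x → sym (B≈B′ x))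

    -- The realizer of XC k that picks the leftmost digit path, except that, when
    -- the flag S is up, the name r is picked for the input h.
    selector : Set → (h r : Baire) → PartialFunction
    selector S h r = record
      { Graph      = λ p q → (S × p ≗ h × q ≗ r)
                           ⊎ (¬ (S × p ≗ h) × ∃[ B ] Solvable p B × q ≗ pathName (canonical B))
      ; resp       = λ { p≗p′ q≗q′ (inj₁ (s , p≗h , q≗r)) →
                           inj₁ (s , (λ n → trans (sym (p≗p′ n)) (p≗h n)) , λ n → trans (sym (q≗q′ n)) (q≗r n))
                       ; p≗p′ q≗q′ (inj₂ (p≢h , B , solvable named convex nonempty , q≗)) →
                           inj₂ ( (λ (s , p′≗h) → p≢h (s , λ n → trans (p≗p′ n) (p′≗h n)))
                                , B , solvable (rename (𝒜 𝕏) B p≗p′ named) convex nonempty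
                                , λ n → trans (sym (q≗q′ n)) (q≗ n)) }
      ; functional = λ { (inj₁ (_ , _ , q≗r)) (inj₁ (_ , _ , q′≗r)) n → trans (q≗r n) (sym (q′≗r n))
                       ; (inj₁ (s , p≗h , _)) (inj₂ (p≢h , _)) → contradiction (s , p≗h) p≢h
                       ; (inj₂ (p≢h , _)) (inj₁ (s , p≗h , _)) → contradiction (s , p≗h) p≢h
                       ; {p} (inj₂ (_ , B , solvable named _ _ , q≗)) (inj₂ (_ , B′ , solvable named′ _ _ , q′≗)) n →
                           trans (q≗ n) (trans
                             (pathName-≈ (suc n) (λ m _ →
                               canonical-≈ {B} {B′} (RepresentedSpace.functional (𝒜 𝕏) {p} {B} {B′} named named′)
                                 m) n ℕ.≤-refl)
                             (sym (q′≗ n))) }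
      }

    selector-realizes : ∀ {S h r} → (S → ∃[ B ] Names h B × ∃[ α ] InB B α × r ≗ pathName α) → selector S h r ⊩ XC k
    selector-realizes {S} {h} {r} valid p B named (y , convex , y∈B) = by-cases em
      where
      Selected : Set
      Selected = ∃[ q ] Graph (selector S h r) p q ×
        (∃[ z ] RepresentedSpace._names_ 𝕏 q z × (Convex {k} B × z ∈[ 𝕏 ] B))

      by-cases : Dec (S × p ≗ h) → Selected
      by-cases (yes (s , p≗h)) =
        let B′ , named′ , α , (α∈ , in-B′) , r≗ = valid s
            B′≈B = RepresentedSpace.functional (𝒜 𝕏) {h} {B′} {B} named′ (rename (𝒜 𝕏) B p≗h named)
        in r , inj₁ (s , p≗h , λ _ → refl)
           , element α α∈ , rename 𝕏 (element α α∈) (sym ∘ r≗) (pathName-names α α∈) , convex , trans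
               (sym (B′≈B (element α α∈))) in-B′
      by-cases (no p≢h) =
        let sol       = solvable named convex (digits {B} y y∈B)
            α∈ , in-B = canonical∈ sol
        in pathName (canonical B) , inj₂ (p≢h , B , sol , λ _ → refl)
           , element (canonical B) α∈ , pathName-names (canonical B) α∈ , convex , in-B

  module Extraction (em : ExcludedMiddle 0ℓ) (k : ℕ) {X Y U V} {f : X ⇉ Y} {g : U ⇉ V}
                    (f≤g : f ≤W g) (g≤XC : g ≤W XC k) where
    open Selection em k
    open ClosedSets em k

    private
      module X = RepresentedSpace X
      module Y = RepresentedSpace Y
      H₁ = proj₁ f≤g
      K₁ = proj₁ (proj₂ f≤g)
      H₂ = proj₁ g≤XC
      K₂ = proj₁ (proj₂ g≤XC)
      module H₁ = PartialFunction H₁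
      module K₁ = PartialFunction K₁
      module H₂ = PartialFunction H₂
      module K₂ = PartialFunction K₂

    -- p ⇝ h: h is the instance of XC k to which the instance p is reduced.
    -- p , r ⇝ o: o is the answer to p obtained from the solution r.
    infix 4 _⇝_ _,_⇝_
    _⇝_ : Baire → Baire → Set
    p ⇝ h = ∃[ h₁ ] Graph H₁ p h₁ × Graph H₂ h₁ h

    _,_⇝_ : Baire → Baire → Baire → Set
    p , r ⇝ o = ∃[ h₁ ] ∃[ r₁ ] Graph H₁ p h₁ × Graph K₂ ⟨ h₁ , r ⟩ r₁ × Graph K₁ ⟨ p , r₁ ⟩ o

    ⇝-functional : ∀ {p h h′} → p ⇝ h → p ⇝ h′ → h ≗ h′
    ⇝-functional (h₁ , a , b) (h₁′ , a′ , b′) = H₂.functional b (H₂.resp (H₁.functional a′ a) (λ _ → refl) b′)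

    -- The second reduction turns the realizer of `XC k` into one of `g`, which the first one
    -- consumes; the two are used side by side, and no programs are composed.
    run : ∀ {S h r} → selector S h r ⊩ XC k → ∀ {p x} → p X.names x → _⇉_.dom f x →
          ∃[ h′ ] ∃[ r′ ] ∃[ o ] p ⇝ h′ × Graph (selector S h r) h′ r′ × p , r′ ⇝ o × ∃[ y ] o Y.names y ×
            _⇉_._↦_ f x y
    run {S} {h} {r₀} realizes {p} {x} names-x x∈dom =
      let o , (h₁ , r₁ , H₁p , (h₂ , r , H₂h , Gr , K₂r) , K₁r) , y , names-y , fxy =
            proj₂ (proj₂ (proj₂ (proj₂ f≤g))) (transform H₂ K₂ (selector S h r₀))
              (proj₂ (proj₂ (proj₂ (proj₂ g≤XC))) (selector S h r₀) realizes) p x names-x x∈dom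
      in h₂ , r , o , (h₁ , H₁p , H₂h) , Gr , (h₁ , r₁ , H₁p , K₂r , K₁r) , y , names-y , fxy

    -- With the flag down, the selector is defined only at names of non-empty convex sets, so its
    -- having been applied to `h` is the information wanted.
    reduced : ∀ {p x} → p X.names x → _⇉_.dom f x → ∃[ h ] p ⇝ h × ∃[ B ] Solvable h B
    reduced {p} {x} names-x x∈dom = from (run {⊥} {λ _ → 0} {λ _ → 0} (selector-realizes λ ()) names-x x∈dom)
      where
      from : ∃[ h ] ∃[ r ] ∃[ o ] p ⇝ h × Graph (selector ⊥ (λ _ → 0) (λ _ → 0)) h r × p , r ⇝ o ×
        ∃[ y ] o Y.names y × _⇉_._↦_ f x y →
             ∃[ h ] p ⇝ h × ∃[ B ] Solvable h B
      from (h , r , o , p⇝h , inj₂ (_ , B , sol , _) , _) = h , p⇝h , B , sol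

    -- A reduction must succeed with every realizer, in particular with the one that returns the
    -- name of `α` at `h`; so it can be confronted with any solution.
    answered : ∀ {p x h B α} → p X.names x → _⇉_.dom f x → p ⇝ h → RepresentedSpace._names_ (𝒜 𝕏) h B → InB B α →
               ∃[ o ] p , pathName α ⇝ o × ∃[ y ] o Y.names y × _⇉_._↦_ f x y
    answered {p} {x} {h} {B} {α} names-x x∈dom p⇝h named in-B =
      from (run {⊤} {h} {pathName α} (selector-realizes λ _ → B , named , α , in-B , λ _ → refl) names-x x∈dom)
      where
      from : ∃[ h′ ] ∃[ r′ ] ∃[ o ] p ⇝ h′ × Graph (selector ⊤ h (pathName α)) h′ r′ × p , r′ ⇝ o ×
        ∃[ y ] o Y.names y × _⇉_._↦_ f x y →
             ∃[ o ] p , pathName α ⇝ o × ∃[ y ] o Y.names y × _⇉_._↦_ f x y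
      from (h′ , r′ , o , p⇝h′ , inj₁ (_ , _ , r′≗) , (h₁ , r₁ , a , b , c) , result) =
        o , (h₁ , r₁ , a , K₂.resp (⟨,⟩-cong (λ _ → refl) r′≗) (λ _ → refl) b , c) , result
      from (h′ , r′ , o , p⇝h′ , inj₂ (¬sel , _) , _) = contradiction (tt , ⇝-functional p⇝h′ p⇝h) ¬sel

    ⇝-continuous : ∀ {p h} → p ⇝ h → ∀ N → Use p (λ p′ → ∀ h′ → p′ ⇝ h′ → h ≈[ N ] h′)
    ⇝-continuous {p} {h} (h₁ , H₁p , H₂h) N =
      let m , u = continuous {H₂} (proj₁ (proj₂ (proj₂ g≤XC))) H₂h N
          n , v = continuous {H₁} (proj₁ (proj₂ (proj₂ f≤g))) H₁p m
      in n , λ p′ p≈p′ h′ (h₁′ , H₁p′ , H₂h′) → u h₁′ (v p′ p≈p′ h₁′ H₁p′) h′ H₂h′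

    answer-continuous : ∀ {p r o} → p , r ⇝ o → ∀ N →
                        ∃[ n ] ∀ {p′ r′ o′} → p ≈[ n ] p′ → r ≈[ n ] r′ → p′ , r′ ⇝ o′ → o ≈[ N ] o′
    answer-continuous {p} {r} {o} (h₁ , r₁ , H₁p , K₂r , K₁r) N =
      let a , u = continuous {K₁} (proj₁ (proj₂ (proj₂ (proj₂ f≤g)))) K₁r N
          b , v = continuous {K₂} (proj₁ (proj₂ (proj₂ (proj₂ g≤XC)))) K₂r a
          c , w = continuous {H₁} (proj₁ (proj₂ (proj₂ f≤g))) H₁p b
          n     = a ⊔ (b ⊔ c)
          a≤n   = ℕ.m≤m⊔n a (b ⊔ c)
          b≤n   = ℕ.≤-trans (ℕ.m≤m⊔n b c) (ℕ.m≤n⊔m a (b ⊔ c))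
          c≤n   = ℕ.≤-trans (ℕ.m≤n⊔m b c) (ℕ.m≤n⊔m a (b ⊔ c))
      in n , λ {p′} {r′} {o′} p≈p′ r≈r′ (h₁′ , r₁′ , H₁p′ , K₂r′ , K₁r′) →
           let h≈h′  = w p′ (≈-anti c≤n p≈p′) h₁′ H₁p′
               r₁≈r₁′ = v ⟨ h₁′ , r′ ⟩ (⟨,⟩-≈ b h≈h′ (≈-anti b≤n r≈r′)) r₁′ K₂r′
           in u ⟨ p′ , r₁′ ⟩ (⟨,⟩-≈ a (≈-anti a≤n p≈p′) r₁≈r₁′) o′ K₁r′

  initialPlay : Play
  initialPlay = record
    { intervals = λ _ _ → 0ℚ , 1ℚ
    ; time      = 0
    ; stable    = λ _ _ → refl
    ; nested    = λ _ _ → ℚ.≤-refl , ℚ.≤-refl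
    ; proper    = λ _ → 0<2⁻n 0
    ; in-unit   = λ _ → ℚ.≤-refl , ℚ.≤-refl
    }

  module Shrink (P : Play) (n c : ℕ) {a b : ℚ} (lo≤a : proj₁ (Play.final P c) ≤ a) (a<b : a < b)
                (b≤hi : b ≤ proj₂ (Play.final P c)) where
    open Play P

    -- Past `n` the change is invisible to the required agreement; past `time` the intervals of all
    -- other classes are final.
    T : ℕ
    T = n ⊔ time

    choose : ∀ {A : Set} → ℕ → A → A → A
    choose m x y = if does (m <? T) then x else y

    choose-early : ∀ {A : Set} {m} {x y : A} → m ℕ.< T → choose m x y ≡ x
    choose-early {m = m} {x} {y} m<T = cong (if_then x else y) (dec-true (m <? T) m<T)

    choose-late : ∀ {A : Set} {m} {x y : A} → T ℕ.≤ m → choose m x y ≡ y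
    choose-late {m = m} {x} {y} T≤m = cong (if_then x else y) (dec-false (m <? T) (ℕ.≤⇒≯ T≤m))

    goal : ℕ → Interval
    goal c′ = if does (c′ ≟ c) then (a , b) else final c′

    goal-same : goal c ≡ (a , b)
    goal-same = cong (if_then (a , b) else final c) (dec-true (c ≟ c) refl)

    goal-other : ∀ {c′} → c′ ≢ c → goal c′ ≡ final c′
    goal-other {c′} c′≢c = cong (if_then (a , b) else final c′) (dec-false (c′ ≟ c) c′≢c)

    by-class : ∀ {Q : ℕ → Interval → Set} → Q c (a , b) → (∀ c′ → Q c′ (final c′)) → ∀ c′ → Q c′ (goal c′)
    by-class {Q} here there c′ = by-cases (c′ ≟ c)
      where
      by-cases : Dec (c′ ≡ c) → Q c′ (goal c′)
      by-cases (yes refl) = subst (Q c) (sym goal-same) here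
      by-cases (no c′≢c)  = subst (Q c′) (sym (goal-other c′≢c)) (there c′)

    goal⊆final : ∀ c′ → proj₁ (final c′) ≤ proj₁ (goal c′) × proj₂ (goal c′) ≤ proj₂ (final c′)
    goal⊆final = by-class {λ c′ I → proj₁ (final c′) ≤ proj₁ I × proj₂ I ≤ proj₂ (final c′)} (lo≤a , b≤hi) λ _ →
      ℚ.≤-refl , ℚ.≤-refl

    intervals′ : ℕ → ℕ → Interval
    intervals′ m c′ = choose m (intervals m c′) (goal c′)

    late : ∀ c′ {m} → T ℕ.≤ m → intervals′ m c′ ≡ goal c′
    late c′ T≤m = choose-late T≤m

    within-goal : ∀ m c′ → proj₁ (intervals′ m c′) ≤ proj₁ (goal c′) × proj₂ (goal c′) ≤ proj₂ (intervals′ m c′)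
    within-goal m c′ = by-cases (m <? T)
      where
      by-cases : Dec (m ℕ.< T) → proj₁ (intervals′ m c′) ≤ proj₁ (goal c′) ×
        proj₂ (goal c′) ≤ proj₂ (intervals′ m c′)
      by-cases (yes m<T) = subst (λ I → proj₁ I ≤ proj₁ (goal c′) × proj₂ (goal c′) ≤ proj₂ I)
        (sym (choose-early m<T))
        (ℚ.≤-trans (proj₁ (nested m c′)) (proj₁ (goal⊆final c′)) , ℚ.≤-trans (proj₂ (goal⊆final c′))
          (proj₂ (nested m c′)))
      by-cases (no m≮T)  = subst (λ I → proj₁ I ≤ proj₁ (goal c′) × proj₂ (goal c′) ≤ proj₂ I)
        (sym (late c′ (ℕ.≮⇒≥ m≮T)))
        (ℚ.≤-refl , ℚ.≤-refl)

    at-time : ∀ c′ → goal c′ ≡ intervals′ T c′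
    at-time c′ = sym (late c′ ℕ.≤-refl)

    result : Play
    result = record
      { intervals = intervals′
      ; time      = T
      ; stable    = λ c′ T≤m → trans (late c′ T≤m) (at-time c′)
      ; nested    = λ m c′ → subst (λ I → proj₁ (intervals′ m c′) ≤ proj₁ I × proj₂ I ≤ proj₂ (intervals′ m c′))
          (at-time c′) (within-goal m c′)
      ; proper    = λ c′ → subst (λ I → proj₁ I < proj₂ I) (at-time c′)
                      (by-class {λ _ I → proj₁ I < proj₂ I} a<b proper c′)
      ; in-unit   = λ c′ → subst (λ I → 0ℚ ≤ proj₁ I × proj₂ I ≤ 1ℚ) (at-time c′)
                      (by-class {λ _ I → 0ℚ ≤ proj₁ I × proj₂ I ≤ 1ℚ}
                        (ℚ.≤-trans (proj₁ (in-unit c)) lo≤a , ℚ.≤-trans b≤hi (proj₂ (in-unit c))) in-unit c′)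
      }

    final-same : Play.final result c ≡ (a , b)
    final-same = trans (sym (at-time c)) goal-same

    final-other : ∀ {c′} → c′ ≢ c → Play.final result c′ ≡ final c′
    final-other {c′} c′≢c = trans (sym (at-time c′)) (goal-other c′≢c)

    agrees : (P at-status uncollapsed) ∼[ n ] (result at-status uncollapsed)
    agrees m m<n = refl , λ c′ → sym (choose-early (ℕ.<-≤-trans m<n (ℕ.m≤m⊔n n time)))

  double-mono : ∀ {m n} → m ℕ.≤ n → double m ℕ.≤ double n
  double-mono ℕ.z≤n       = ℕ.z≤n
  double-mono (ℕ.s≤s m≤n) = ℕ.s≤s (ℕ.s≤s (double-mono m≤n))

  module _ (em : ExcludedMiddle 0ℓ) (k : ℕ) {U V} {g : U ⇉ V} (Φ≤g : Φ em (suc k) ≤W g) (g≤XC : g ≤W XC k) where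
    open Selection em k
    open ClosedSets em k
    open Extraction em k {f = Φ em (suc k)} {g = g} Φ≤g g≤XC

    private
      -- A sum of k + 1 bits ranges over exactly the classes 0, ..., k + 1.
      N = suc k

      reduction : ∀ I → ∃[ h ] instanceName I ⇝ h × ∃[ B ] Solvable h B
      reduction I = reduced {x = instanceName I} (λ _ → refl) (instance-dom em N I)

      name-of : Inst → Baire
      name-of I = proj₁ (reduction I)

      set-of : Inst → RepresentedSpace.Carrier (𝒜 𝕏)
      set-of I = proj₁ (proj₂ (proj₂ (reduction I)))

      reduces : ∀ I → instanceName I ⇝ name-of I
      reduces I = proj₁ (proj₂ (reduction I))

      solvable-set : ∀ I → Solvable (name-of I) (set-of I)
      solvable-set I = proj₂ (proj₂ (proj₂ (reduction I)))

      In : Inst → Path k → Set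
      In I = InB (set-of I)

      answer : ∀ {I α} → In I α → ∃[ o ] instanceName I , pathName α ⇝ o × ∃[ y ] o ≗ y ×
        _⇉_._↦_ (Φ em N) (instanceName I) y
      answer {I} {α} p = answered {x = instanceName I} {h = name-of I} {B = set-of I} {α = α} (λ _ → refl)
        (instance-dom em N I) (reduces I) (Solvable.named (solvable-set I)) p

      output : ∀ {I α} → In I α → Baire
      output {I} {α} p = proj₁ (answer {I} {α} p)

      output-solves : ∀ {I α} (p : In I α) → _⇉_._↦_ (Φ em N) (instanceName I) (output {I} {α} p)
      output-solves {I} {α} p =
        let o , _ , y , o≗y , solves = answer {I} {α} p
        in _⇉_.resp (Φ em N) (λ _ → refl) (sym ∘ o≗y) solves

      closed : ∀ {I α} → ¬ In I α → ∃[ n ] ∀ J β → I ∼[ n ] J → α ≈[ n ] β → ¬ In J β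
      closed {I} {α} ¬in =
        let n , excluded = InB-closed {name-of I} {set-of I} {α} (Solvable.named (solvable-set I)) ¬in
            m , cont     = ⇝-continuous (reduces I) n
        in m ⊔ n , λ J β I∼J α≈β → excluded (name-of J) (set-of J) β
             (cont (instanceName J) (instanceName-≈ I J m λ i i<m → I∼J i (ℕ.<-≤-trans i<m (ℕ.m≤m⊔n m n)))
               (name-of J) (reduces J))
             (Solvable.named (solvable-set J)) (≈-anti (ℕ.m≤n⊔m m n) α≈β)

      answers-continuous : ∀ {I α} (p : In I α) e → ∃[ n ] ∀ J β → I ∼[ n ] J → α ≈[ n ] β → (q : In J β) →
        answerClass em N (output {J} {β} q) ≡ answerClass em N (output {I} {α} p) ×
          answerValue em N (output {J} {β} q) e ≡ answerValue em N (output {I} {α} p) e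
      answers-continuous {I} {α} p e =
        let n , cont = answer-continuous (proj₁ (proj₂ (answer {I} {α} p))) M
        in n , λ J β I∼J α≈β q → same (cont (instanceName-≈ I J n I∼J) (pathName-≈ n α≈β)
             (proj₁ (proj₂ (answer {J} {β} q))))
        where
        -- Bounds on positions in ⟨ ⟨ I , x ⟩ , z ⟩: bit n of `x` stands at
        -- `double (suc (double n))`, entry `e` of `z` at `suc (double e)`.
        M₁ = double (double N)
        M₂ = suc (suc (double e))
        M  = M₁ ⊔ M₂

        same : ∀ {o o′} → o ≈[ M ] o′ → answerClass em N o′ ≡ answerClass em N o ×
          answerValue em N o′ e ≡ answerValue em N o e
        same o≈o′ = prefixSum-cong N (λ n n<N → sym (o≈o′ (double (suc (double n)))
                        (ℕ.<-≤-trans (ℕ.≤-<-trans (ℕ.n≤1+n _) (double-< (double-< n<N))) (ℕ.m≤m⊔n M₁ M₂))))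
                  , cong ν (sym (o≈o′ (suc (double e)) (ℕ.m≤n⊔m M₁ M₂)))
          where
          double-< : ∀ {m n} → m ℕ.< n → suc (double m) ℕ.< double n
          double-< m<n = double-mono m<n

      convex : ∀ {I α β γ t} → In I α → In I β → 0ℚ ≤ t → t ≤ 1ℚ →
               (∀ i → SameLimit (λ n → comb t (point α n i) (point β n i)) (λ n → point γ n i)) → In I γ
      convex {I} {α} {β} {γ} {t} (α∈ , inα) (β∈ , inβ) 0≤t t≤1 same = γ∈ ,
        Solvable.convex (solvable-set I) (element α α∈) (element β β∈) (element γ γ∈) unit inα inβ limit
        where
        unit : RepresentedSpace.Carrier 𝕀
        unit = fromℚ t , (λ m n → ℚ.≤-trans 0≤t (below (near-refl (ℚ.+-mono-≤ (0≤2⁻ m) (0≤2⁻ n)))))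
                       , (λ m n → ℚ.≤-trans t≤1 (below (near-refl (ℚ.+-mono-≤ (0≤2⁻ m) (0≤2⁻ n)))))

        γ∈ : InCube γ
        γ∈ = within⇒cube {α = γ} λ i → within-same (center-regular (coord γ i)) (same-sym (same i)) (within λ n →
          near-resp refl refl (comb-same t ½) (near-comb-same 0≤t t≤1
            (near-at (cube⇒within {k} {real α i , α∈ i}) n) (near-at (cube⇒within {k} {real β i , β∈ i}) n)))

        limit : ∀ i → real γ i ≈[ fromℚ t ] real α i ⊹ real β i
        limit i n = suc n , λ m n<m → Near⇒∣∣≤ (near-mono
          (ℚ.≤-trans (2⁻-anti {suc n} {m} n<m ⊕ 2⁻-anti {suc n} {m} n<m) (ℚ.≤-reflexive (half+half (2⁻ n))))
            (same i m))

    game : Game k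
    game = record
      { Inst      = Inst
      ; Play      = Play
      ; inst      = λ P → P at-status uncollapsed
      ; _∼[_]_    = _∼[_]_
      ; ∼-refl    = λ n m m<n → refl , λ c → refl
      ; ∼-trans   = λ I∼J J∼K m m<n → trans (proj₁ (I∼J m m<n)) (proj₁ (J∼K m m<n))
                                    , λ c → trans (proj₂ (I∼J m m<n) c) (proj₂ (J∼K m m<n) c)
      ; ∼-anti    = λ m≤n I∼J i i<m → I∼J i (ℕ.<-≤-trans i<m m≤n)
      ; In        = In
      ; nonempty  = λ I → Solvable.nonempty (solvable-set I)
      ; bounded   = λ {I} {α} (α∈ , _) i → cube⇒within {k} {real α i , α∈ i}
      ; convex    = λ {I} {α} {β} {γ} → convex {I} {α} {β} {γ}
      ; closed    = λ {I} {α} → closed {I} {α}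
      ; class     = λ {I} {α} p → answerClass em N (output {I} {α} p)
      ; ζ         = λ {I} {α} p → answerValue em N (output {I} {α} p)
      ; answers-continuous = λ {I} {α} → answers-continuous {I} {α}
      ; lo        = λ P c → proj₁ (Play.final P c)
      ; hi        = λ P c → proj₂ (Play.final P c)
      ; lo<hi     = Play.proper
      ; ζ-bounds  = λ P {α} p → answer-value em N (P at-status uncollapsed)
          (output-solves {P at-status uncollapsed} {α} p)
      ; initial   = initialPlay
      ; shrink    = λ P n c lo≤a a<b b≤hi → let open Shrink P n c lo≤a a<b b≤hi in
                      result , agrees , cong proj₁ final-same , cong proj₂ final-same
                      , λ c′≢c → cong proj₁ (final-other c′≢c) , cong proj₂ (final-other c′≢c)
      ; collapse  = λ P n {c} c≤N → P at-status collapsed n c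
                      , (λ m m<n → sym (cong (if_then nothing else just c) (dec-true (m <? n) m<n)) , λ _ → refl)
                      , λ {α} p → answer-class em N P n c≤N (output-solves {P at-status collapsed n c} {α} p)
      }

-- From the compositional product to the game

open import Data.Nat using (ℕ; suc)
open import Defs
open Reductions using (g₁; f₁; g₁≤AoUC; f₁≤XC₁)
open Strategy using (no-game)
open Opponent using (game)

theorem32 : ExcludedMiddle 0ℓ →
    (k : ℕ) {X Y : RepresentedSpace} (XC₁⋆AoUC : X ⇉ Y) →
    XC₁⋆AoUC Represents XC 1 ⋆ AoUC → ¬ (XC₁⋆AoUC ≤W XC k)
theorem32 em k XC₁⋆AoUC represents XC₁⋆AoUC≤XC = no-game em (game em k {g = XC₁⋆AoUC} composition≤ XC₁⋆AoUC≤XC)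
  where
  -- This one composition defeats every representative of the product, since each of them lies above
  -- it.
  composition≤ : f₁ (suc k) ⊙ g₁ ≤W XC₁⋆AoUC
  composition≤ = _Represents_⋆_.upperBound represents (f₁ (suc k)) g₁ (f₁≤XC₁ (suc k)) g₁≤AoUC
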